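{- Let $n$ be a positive integer. Then $$t(1,1,2,16;n)=4\sum_{d\mid 2n+5}\frac{2n+5}{d}\left(\frac 2d\right)-4\sum_{\substack{(r,s)\in\mathbb Z^2,\ 4\mid r-1\\ 2n+5=r^2+2s^2}} r,$$ where the first sum is over positive divisors $d$.
   Context: $\left(\frac{a}{m}\right)$ is the Legendre–Jacobi–Kronecker symbol. For positive integers $a,b,c,d$ and a nonnegative integer $n$, $t(a,b,c,d;n)$ denotes the number of $(x,y,z,w)\in\mathbb Z^4$ with $n=a\frac{x(x-1)}2+b\frac{y(y-1)}2+c\frac{z(z-1)}2+d\frac{w(w-1)}2$. -}

module Defs where

open import Data.Nat as ℕ using (ℕ; zero; suc)
open import Data.Nat.Divisibility using (_∣?_)
open import Data.Nat.DivMod as ND using ()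
open import Data.Integer as ℤ using (ℤ; +_; -[1+_]; 0ℤ; 1ℤ)
open import Data.Integer.DivMod using () renaming (_/_ to _divℤ_)
open import Data.List using (List; []; _∷_; map; filter; foldr; upTo; concatMap)
open import Data.Product using (Σ; _×_; _,_)
open import Data.Bool using (Bool; true; false; if_then_else_; _∧_)
open import Data.Fin using (Fin)
open import Function.Bundles using (_↔_)
open import Relation.Binary.PropositionalEquality using (_≡_)
open import Relation.Nullary.Decidable using (does; ⌊_⌋)

sumℤ : List ℤ → ℤ
sumℤ = foldr ℤ._+_ 0ℤ

-- x(x-1)/2 for an integer x (x(x-1) is always even, so the division is exact)
tri : ℤ → ℤ
tri x = (x ℤ.* (x ℤ.- 1ℤ)) divℤ (+ 2)

TSol : ℕ → ℕ → ℕ → ℕ → ℕ → Set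
TSol a b c d n =
  Σ (ℤ × ℤ × ℤ × ℤ) λ { (x , y , z , w) →
    + n ≡ (+ a) ℤ.* tri x ℤ.+ (+ b) ℤ.* tri y ℤ.+ (+ c) ℤ.* tri z ℤ.+ (+ d) ℤ.* tri w }

HasCard : Set → ℕ → Set
HasCard A k = A ↔ Fin k

t≡ : ℕ → ℕ → ℕ → ℕ → ℕ → ℤ → Set
t≡ a b c d n N = Σ ℕ λ k → (N ≡ + k) × HasCard (TSol a b c d n) k

isSquareMod : ℕ → (p : ℕ) → .{{ℕ.NonZero p}} → Bool
isSquareMod a p = go p
  where
  go : ℕ → Bool
  go zero = false
  go (suc x) = if ⌊ ((x ℕ.* x) ND.% p) ℕ.≟ (a ND.% p) ⌋ then true else go x

-- Legendre symbol (a/p) for an odd prime p; Kronecker's (a/2) for p = 2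
legendre : ℕ → ℕ → ℤ
legendre a zero = 0ℤ
legendre a 2 with a ND.% 8
... | 1 = 1ℤ
... | 7 = 1ℤ
... | 3 = -[1+ 0 ]
... | 5 = -[1+ 0 ]
... | _ = 0ℤ
legendre a p@(suc p') with ⌊ (a ND.% p) ℕ.≟ 0 ⌋
... | true = 0ℤ
... | false = if isSquareMod a p then 1ℤ else -[1+ 0 ]

-- least divisor ≥ 2 of m (searching 2,3,...,m), i.e. the least prime factor
-- of m when m ≥ 2; returned as j with factor 2 + j (so it is visibly nonzero)
leastFactor-2 : ℕ → ℕ
leastFactor-2 m = go m 0
  where
  go : ℕ → ℕ → ℕ
  go zero j = m ℕ.∸ 2
  go (suc f) j = if ⌊ (2 ℕ.+ j) ∣? m ⌋ then j else go f (suc j)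

-- Kronecker (Jacobi) symbol (a/m) for m ≥ 1: product of (a/p) over the
-- prime factorisation of m (with multiplicity); fuel = m suffices.
kronecker : ℕ → ℕ → ℤ
kronecker a m = go m m
  where
  go : ℕ → ℕ → ℤ
  go zero k = 1ℤ
  go (suc f) zero = 1ℤ
  go (suc f) 1 = 1ℤ
  go (suc f) k@(suc (suc _)) with leastFactor-2 k
  ... | j = legendre a (2 ℕ.+ j) ℤ.* go f (k ND./ (2 ℕ.+ j))

divisorSum : ℕ → ℤ
divisorSum m = sumℤ (map term (filter (λ d → d ∣? m) (map suc (upTo m))))
  where
  term : ℕ → ℤ
  term zero = 0ℤ
  term d@(suc _) = (+ (m ND./ d)) ℤ.* kronecker 2 d

rangeℤ : ℕ → List ℤ
rangeℤ B = map (λ i → (+ i) ℤ.- (+ B)) (upTo (suc (2 ℕ.* B)))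

-- Σ_{(r,s) ∈ ℤ², 4 ∣ r - 1, m = r² + 2s²} r ; every such pair has |r|,|s| ≤ m,
-- so the sum over the box [-m,m]² is the full sum.
repSum : ℕ → ℤ
repSum m = sumℤ (concatMap (λ r → concatMap (λ s → term r s) (rangeℤ m)) (rangeℤ m))
  where
  term : ℤ → ℤ → List ℤ
  term r s = if ⌊ (r ℤ.- 1ℤ) ℤ.% (+ 4) ℕ.≟ 0 ⌋
               ∧ ⌊ (+ m) ℤ.≟ r ℤ.* r ℤ.+ (+ 2) ℤ.* (s ℤ.* s) ⌋
             then r ∷ [] else []

{-# OPTIONS --safe #-}

-- With m = 2 n + 5, completing squares turns t(1,1,2,16;n) into the number of representations of 4 m by
-- X² + Y² + 2 Z² + 16 W² with all variables odd, and the rotation (u , v) ↦ (u + v , u - v), applied twice, into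
-- 4 times the number of representations of m by x² + 2 y² + 4 z² + 4 w² with x and w odd.  In terms of theta
-- series, the restriction to odd w is half the difference between the full sum and the sum with sign (-1)^w.
--   * The signed sum collapses by Jacobi's θ₁′ = θ₂ θ₃ θ₄ to a sum of (-1/r) r over m = r² + 2 s².  Jacobi's
--     identity holds because both sides satisfy the same Landen relation, again a rotation.
--   * For the full sum, the shear a x + (a + b) y = a (x + y) + b y yields Liouville's identities for sums of
--     characters over a x + b y = n.  They show that 1 + 4 Σ (-4/d) and 1 + 2 Σ (-8/d) satisfy the recursions of
--     θ(q)² and θ(q) θ(q²), and they evaluate the number of representations as 2 Σ (m/d) (8/d).
-- Finally (2/d) = (8/d) for odd d by the second supplementary law: descent for d ≡ ±3 (mod 8), Gauss's lemma for
-- primes p ≡ 7, and for p ≡ 1 the representations p = x² + 2 y² = z² + w², which give square roots of -2 and -1.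

module Submission where

open import Defs
open import Data.Nat using (ℕ; suc; _+_; _*_)
open import Data.Integer using (+_) renaming (_-_ to _-ℤ_; _*_ to _*ℤ_)

open import Data.Nat using (zero; _∸_; _^_; _!; _≤_; _<_; z≤n; s≤s; NonZero; >-nonZero; ⌊_/2⌋)
open import Data.Nat.Base using (nonTrivial⇒n>1)
import Data.Nat.Properties as ℕₚ
import Data.Nat.Tactic.RingSolver as ℕ-Ring
open import Data.Nat.Coprimality using (Coprime; coprime-Bézout)
open import Data.Nat.Divisibility using (divides; _∣?_; ∣⇒≤; ∣-refl; ∣-trans; ∣m+n∣m⇒∣n; ∣m∣n⇒∣m+n; m∣m*n; ∣1⇒≡1; *-pres-∣; ∣-reflexive) renaming (_∣_ to _∣ₙ_)
open import Data.Nat.Divisibility.Core using (hasNonTrivialDivisor)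
open import Data.Nat.DivMod using (_%_; _/_; m≡m%n+[m/n]*n; m%n<n; %-distribˡ-*; [m+kn]%n≡m%n; m/n*n≡m; m*n/n≡m; m/n<m)
open import Data.Nat.GCD using (module Bézout)
open import Data.Nat.Induction using (<-rec)
open import Data.Nat.Primality using (Prime; euclidsLemma; prime⇒irreducible; prime⇒nonTrivial; prime⇒nonZero; _Rough_; 2-rough; ∤⇒rough-suc; rough∧∣⇒prime)
open import Data.Integer using (ℤ; -[1+_]; 0ℤ; 1ℤ; ∣_∣) renaming (_+_ to _+ℤ_; -_ to -ℤ_)
import Data.Integer.Divisibility.Signed as ℤ-Signed
open import Data.Integer.DivMod using (a≡a%n+[a/n]*n; n%d<d) renaming (_/_ to _divℤ_; _%_ to _modℤ_)
import Data.Integer.Properties as ℤₚ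
import Data.Integer.Tactic.RingSolver as ℤ-Ring
open import Data.Bool using (Bool; true; false; if_then_else_; _∧_)
open import Data.Empty using (⊥; ⊥-elim)
open import Data.Fin as Fin using (Fin; #_)
import Data.Fin.Properties as Finₚ
open import Data.List using (List; []; _∷_; _++_; map; filter; concatMap; upTo; length; lookup)
open import Data.List.Membership.Propositional using (_∈_; find; lose)
open import Data.List.Membership.Propositional.Properties using (∈-map⁺; ∈-map⁻; ∈-filter⁺; ∈-filter⁻; ∈-concatMap⁺; ∈-concatMap⁻; ∈-upTo⁺; ∈-upTo⁻; ∈-lookup)
open import Data.List.Membership.Propositional.Properties.WithK using (unique∧set⇒bag)
open import Data.List.Properties using (map-∘)
open import Data.List.Relation.Binary.BagAndSetEquality using (∼bag⇒↭)
open import Data.List.Relation.Binary.Permutation.Propositional as Perm using (_↭_)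
open import Data.List.Relation.Unary.All as All using ([]; _∷_)
open import Data.List.Relation.Unary.AllPairs using ([]; _∷_)
open import Data.List.Relation.Unary.Any using (here; there; index)
open import Data.List.Relation.Unary.Any.Properties using (lookup-index)
open import Data.List.Relation.Unary.Unique.Propositional using (Unique)
import Data.List.Relation.Unary.Unique.Propositional.Properties as Uniqueₚ
open import Data.Maybe as Maybe using (Maybe)
open import Data.Product using (Σ; ∃; ∃₂; _×_; _,_; proj₁; proj₂)
open import Data.Sum using (_⊎_; inj₁; inj₂; [_,_]′)
open import Data.Unit using (⊤; tt)
open import Data.Vec as Vec using (Vec; []; _∷_)
open import Algebra.Bundles using (CommutativeRing)
import Algebra.Solver.Ring
open import Algebra.Solver.Ring.AlmostCommutativeRing using (AlmostCommutativeRing; fromCommutativeRing; _-Raw-AlmostCommutative⟶_)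
open import Axiom.UniquenessOfIdentityProofs.WithK using (uip)
open import Function using (_∘_; id; case_of_)
open import Function.Bundles using (mk↔ₛ′; mk⇔)
open import Level using (0ℓ)
open import Relation.Binary.Consequences using (dec⇒weaklyDec)
open import Relation.Binary.PropositionalEquality using (_≡_; _≢_; refl; sym; trans; cong; cong₂; subst; module ≡-Reasoning)
import Relation.Binary.Reasoning.Setoid as SetoidReasoning
open import Relation.Nullary using (¬_; Dec; yes; no)
open import Relation.Nullary.Decidable using (True; toWitness; ⌊_⌋; ¬?; _×-dec_; _⊎-dec_)
open import Relation.Unary using (Decidable; Irrelevant)

-- Finite sums over enumerations

-- No convergence and no division of series is used, so product identities are proved by uniqueness:
-- in a relation f s = g(q²) whose factor s begins with 2 q, coefficient n of f depends only on
-- coefficients of index at most (n + 1)/2 on the right, and two solutions with the same first two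
-- coefficients agree. The Landen and mean relations are arranged to have this shape.
--
-- Liouville's identities evaluate a product of two Lambert series only up to the failure of an
-- addition law. For (-4/.) there is no failure; for (-8/.) the error separates the variables and is
-- again a product of Lambert series.
--
-- The quaternary count at odd n factors in two ways, as 2 E₈ᵒ (1 + 4 E₄(q⁴)) and as 2 E₄ᵒ (1 + 2
-- E₈(q²)). Neither product is evaluated alone. Liouville's identity for the mixed pair (-4/.),
-- (-8/.) expresses the second through the first, and twice the second evaluation minus the first
-- leaves exactly the divisor sum.
--
-- All weights are functions modulo 8, so each addition law is a finite check of tables.

private variable
  A B : Set

∑ : (A → ℤ) → List A → ℤ
∑ f xs = sumℤ (map f xs)

∑-++ : ∀ (f : A → ℤ) xs ys → ∑ f (xs ++ ys) ≡ ∑ f xs +ℤ ∑ f ys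
∑-++ f [] ys = sym (ℤₚ.+-identityˡ _)
∑-++ f (x ∷ xs) ys = trans (cong (f x +ℤ_) (∑-++ f xs ys)) (sym (ℤₚ.+-assoc (f x) _ _))

∑-cong : ∀ {f g : A → ℤ} xs → (∀ {x} → x ∈ xs → f x ≡ g x) → ∑ f xs ≡ ∑ g xs
∑-cong [] eq = refl
∑-cong (x ∷ xs) eq = cong₂ _+ℤ_ (eq (here refl)) (∑-cong xs (eq ∘ there))

∑-↭ : ∀ (f : A → ℤ) {xs ys} → xs ↭ ys → ∑ f xs ≡ ∑ f ys
∑-↭ f Perm.refl = refl
∑-↭ f (Perm.prep x p) = cong (f x +ℤ_) (∑-↭ f p)
∑-↭ f (Perm.swap {xs} {ys} x y p) = begin
  f x +ℤ (f y +ℤ ∑ f xs) ≡⟨ cong (λ z → f x +ℤ (f y +ℤ z)) (∑-↭ f p) ⟩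
  f x +ℤ (f y +ℤ ∑ f ys) ≡⟨ exchange (f x) (f y) (∑ f ys) ⟩
  f y +ℤ (f x +ℤ ∑ f ys) ∎
  where
  open ≡-Reasoning
  exchange : ∀ a b c → a +ℤ (b +ℤ c) ≡ b +ℤ (a +ℤ c)
  exchange = ℤ-Ring.solve-∀
∑-↭ f (Perm.trans p q) = trans (∑-↭ f p) (∑-↭ f q)

∑-map : ∀ (f : B → ℤ) (g : A → B) xs → ∑ f (map g xs) ≡ ∑ (f ∘ g) xs
∑-map f g xs = cong sumℤ (sym (map-∘ xs))

∑-concatMap : ∀ (f : B → ℤ) (g : A → List B) xs → ∑ f (concatMap g xs) ≡ ∑ (λ a → ∑ f (g a)) xs
∑-concatMap f g [] = refl
∑-concatMap f g (x ∷ xs) = trans (∑-++ f (g x) (concatMap g xs)) (cong (∑ f (g x) +ℤ_) (∑-concatMap f g xs))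

∑-+ : ∀ (f g : A → ℤ) xs → ∑ (λ x → f x +ℤ g x) xs ≡ ∑ f xs +ℤ ∑ g xs
∑-+ f g [] = refl
∑-+ f g (x ∷ xs) = trans (cong (f x +ℤ g x +ℤ_) (∑-+ f g xs)) (interchange (f x) (g x) (∑ f xs) (∑ g xs))
  where
  interchange : ∀ a b c d → a +ℤ b +ℤ (c +ℤ d) ≡ a +ℤ c +ℤ (b +ℤ d)
  interchange = ℤ-Ring.solve-∀

∑-* : ∀ c (f : A → ℤ) xs → ∑ (λ x → c *ℤ f x) xs ≡ c *ℤ ∑ f xs
∑-* c f [] = sym (ℤₚ.*-zeroʳ c)
∑-* c f (x ∷ xs) = trans (cong (c *ℤ f x +ℤ_) (∑-* c f xs)) (sym (ℤₚ.*-distribˡ-+ c (f x) _))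

∑-filter : ∀ (f : A → ℤ) {Q : A → Set} (Q? : Decidable Q) xs →
  ∑ f xs ≡ ∑ f (filter Q? xs) +ℤ ∑ f (filter (¬? ∘ Q?) xs)
∑-filter f Q? [] = refl
∑-filter f Q? (x ∷ xs) with Q? x | ∑-filter f Q? xs
... | yes _ | eq = trans (cong (f x +ℤ_) eq) (sym (ℤₚ.+-assoc (f x) _ _))
... | no _ | eq = trans (cong (f x +ℤ_) eq) (exchange (f x) (∑ f (filter Q? xs)) (∑ f (filter (¬? ∘ Q?) xs)))
  where
  exchange : ∀ a b c → a +ℤ (b +ℤ c) ≡ b +ℤ (a +ℤ c)
  exchange = ℤ-Ring.solve-∀

∑-0 : (xs : List A) → ∑ (λ _ → 0ℤ) xs ≡ 0ℤ
∑-0 [] = refl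
∑-0 (x ∷ xs) = trans (ℤₚ.+-identityˡ _) (∑-0 xs)

-- A finite set presented by a duplicate-free list. Multiplicity one makes a sum over it depend on
-- `P` alone, so a change of variables needs only a bijection between predicates.
record Enum {A : Set} (P : A → Set) : Set where
  field
    elems    : List A
    unique   : Unique elems
    sound    : ∀ {x} → x ∈ elems → P x
    complete : ∀ {x} → P x → x ∈ elems

open Enum

sumE : {P : A → Set} → Enum P → (A → ℤ) → ℤ
sumE E f = ∑ f (elems E)

sumE-cong : {P : A → Set} (E : Enum P) {f g : A → ℤ} → (∀ x → P x → f x ≡ g x) → sumE E f ≡ sumE E g
sumE-cong E eq = ∑-cong (elems E) (eq _ ∘ sound E)

sumE-0 : {P : A → Set} (E : Enum P) {f : A → ℤ} → (∀ x → P x → f x ≡ 0ℤ) → sumE E f ≡ 0ℤ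
sumE-0 E eq = trans (sumE-cong E eq) (∑-0 (elems E))

Matches : (P : A → Set) (Q : B → Set) → (A → B) → (B → A) → Set
Matches P Q g h = ∀ a → P a → Q (g a) × h (g a) ≡ a

module _ {A B : Set} {P : A → Set} {Q : B → Set} (g : A → B) (h : B → A) (to : Matches P Q g h) (from : Matches Q P h g) where

  mapUnique : ∀ {xs} → (∀ {x} → x ∈ xs → P x) → Unique xs → Unique (map g xs)
  mapUnique {[]} s [] = []
  mapUnique {x ∷ xs} s (x∉ ∷ u) = All.tabulate fresh ∷ mapUnique (s ∘ there) u
    where
    fresh : ∀ {y} → y ∈ map g xs → ¬ g x ≡ y
    fresh y∈ gx≡y with ∈-map⁻ g y∈
    ... | z , z∈ , y≡gz = All.lookup x∉ z∈
      (trans (sym (proj₂ (to x (s (here refl))))) (trans (cong h (trans gx≡y y≡gz)) (proj₂ (to z (s (there z∈))))))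

  mapE : Enum P → Enum Q
  mapE E .elems = map g (elems E)
  mapE E .unique = mapUnique (sound E) (unique E)
  mapE E .sound x∈ with ∈-map⁻ g x∈
  ... | z , z∈ , refl = proj₁ (to z (sound E z∈))
  mapE E .complete {x} Qx = subst (_∈ map g (elems E)) (proj₂ (from x Qx)) (∈-map⁺ g (complete E (proj₁ (from x Qx))))

-- Duplicate-free lists with the same members are equal as bags, hence permutations of each other.
sumE-unique : {P : A → Set} (E F : Enum P) (f : A → ℤ) → sumE E f ≡ sumE F f
sumE-unique E F f = ∑-↭ f (∼bag⇒↭ (unique∧set⇒bag (unique E) (unique F)
  (mk⇔ (complete F ∘ sound E) (complete E ∘ sound F))))

reindex : {P : A → Set} {Q : B → Set} (E : Enum P) (F : Enum Q) {f : A → ℤ} {f′ : B → ℤ} (g : A → B) (h : B → A) →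
  Matches P Q g h → Matches Q P h g → (∀ a → P a → f a ≡ f′ (g a)) → sumE E f ≡ sumE F f′
reindex E F {f} {f′} g h to from eq = begin
  sumE E f                        ≡⟨ sumE-cong E eq ⟩
  sumE E (f′ ∘ g)                 ≡⟨ ∑-map f′ g (elems E) ⟨
  sumE (mapE g h to from E) f′    ≡⟨ sumE-unique (mapE g h to from E) F f′ ⟩
  sumE F f′                       ∎
  where open ≡-Reasoning

relabel : {P Q : A → Set} → (∀ a → P a → Q a) → (∀ a → Q a → P a) → Enum P → Enum Q
relabel to from = mapE id id (λ a p → to a p , refl) (λ a q → from a q , refl)

filterE : {P : A → Set} {Q : A → Set} → Decidable Q → Enum P → Enum (λ a → P a × Q a)
filterE Q? E .elems = filter Q? (elems E)
filterE Q? E .unique = Uniqueₚ.filter⁺ Q? (unique E)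
filterE Q? E .sound x∈ = let x∈E , Qx = ∈-filter⁻ Q? x∈ in sound E x∈E , Qx
filterE Q? E .complete (Px , Qx) = ∈-filter⁺ Q? (complete E Px) Qx

sumE-split : {P Q : A → Set} (Q? : Decidable Q) (E : Enum P) (f : A → ℤ) →
  sumE E f ≡ sumE (filterE Q? E) f +ℤ sumE (filterE (¬? ∘ Q?) E) f
sumE-split Q? E f = ∑-filter f Q? (elems E)

module _ {A B : Set} {P : A → Set} {R : A → B → Set} (E : Enum P) (F : ∀ a → Enum (R a)) where

  private
    fibre : A → List (A × B)
    fibre a = map (a ,_) (elems (F a))

    fibreUnique : ∀ a → Unique (fibre a)
    fibreUnique a = Uniqueₚ.map⁺ (cong proj₂) (unique (F a))

    pairsUnique : ∀ {xs} → Unique xs → Unique (concatMap fibre xs)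
    pairsUnique [] = []
    pairsUnique {x ∷ xs} (x∉ ∷ u) = Uniqueₚ.++⁺ (fibreUnique x) (pairsUnique u) disjoint
      where
      disjoint : ∀ {ab} → ¬ (ab ∈ fibre x × ab ∈ concatMap fibre xs)
      disjoint (l , r) with ∈-map⁻ (x ,_) l | find (∈-concatMap⁻ fibre {xs = xs} r)
      ... | _ , _ , refl | a , a∈ , ab∈ with ∈-map⁻ (a ,_) ab∈
      ... | _ , _ , refl = All.lookup x∉ a∈ refl

  pairE : Enum (λ (ab : A × B) → P (proj₁ ab) × R (proj₁ ab) (proj₂ ab))
  pairE .elems = concatMap fibre (elems E)
  pairE .unique = pairsUnique (unique E)
  pairE .sound ab∈ with find (∈-concatMap⁻ fibre {xs = elems E} ab∈)
  ... | a , a∈ , ab∈′ with ∈-map⁻ (a ,_) ab∈′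
  ... | b , b∈ , refl = sound E a∈ , sound (F a) b∈
  pairE .complete (p , r) = ∈-concatMap⁺ fibre (lose (complete E p) (∈-map⁺ (_ ,_) (complete (F _) r)))

  sumE-pair : ∀ f → sumE pairE f ≡ sumE E (λ a → sumE (F a) (λ b → f (a , b)))
  sumE-pair f = trans (∑-concatMap f fibre (elems E)) (∑-cong (elems E) (λ {a} _ → ∑-map f (a ,_) (elems (F a))))

upToE : ∀ n → Enum (_< n)
upToE n .elems = upTo n
upToE n .unique = Uniqueₚ.upTo⁺ n
upToE n .sound = ∈-upTo⁻
upToE n .complete = ∈-upTo⁺

private
  lookup-injective : ∀ {xs : List A} → Unique xs → ∀ i j → lookup xs i ≡ lookup xs j → i ≡ j
  lookup-injective (_ ∷ _) Fin.zero Fin.zero _ = refl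
  lookup-injective {xs = x ∷ xs} (x∉ ∷ _) Fin.zero (Fin.suc j) eq = ⊥-elim (All.lookup x∉ (∈-lookup j) eq)
  lookup-injective {xs = x ∷ xs} (x∉ ∷ _) (Fin.suc i) Fin.zero eq = ⊥-elim (All.lookup x∉ (∈-lookup i) (sym eq))
  lookup-injective (_ ∷ u) (Fin.suc i) (Fin.suc j) eq = cong Fin.suc (lookup-injective u i j eq)

-- The elements to be counted carry proofs. Irrelevance of these proofs makes an element determined
-- by its position in the list.
hasCard : {P : A → Set} → Irrelevant P → (E : Enum P) → HasCard (Σ A P) (length (elems E))
hasCard {A} {P} irr E = mk↔ₛ′ (λ (a , p) → index (complete E p)) (λ i → lookup (elems E) i , sound E (∈-lookup i))
  (λ i → lookup-injective (unique E) _ _ (sym (lookup-index (complete E (sound E (∈-lookup {xs = elems E} i))))))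
  (λ (a , p) → pair≡ (sym (lookup-index (complete E p))))
  where
  pair≡ : ∀ {a b} {p : P a} {q : P b} → a ≡ b → (a , p) ≡ (b , q)
  pair≡ refl = cong (_ ,_) (irr _ _)

sumE-length : {P : A → Set} (E : Enum P) → sumE E (λ _ → 1ℤ) ≡ + length (elems E)
sumE-length {A} E = go (elems E)
  where
  go : (xs : List A) → ∑ (λ _ → 1ℤ) xs ≡ + length xs
  go [] = refl
  go (x ∷ xs) = cong (1ℤ +ℤ_) (go xs)

-- Formal power series

Series : Set
Series = ℕ → ℤ

infix 4 _≈_
_≈_ : Series → Series → Set
f ≈ g = ∀ n → f n ≡ g n

tail : Series → Series
tail f n = f (suc n)

infixl 6 _⊞_
infixl 7 _⊛_
_⊞_ : Series → Series → Series
(f ⊞ g) n = f n +ℤ g n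

⊟_ : Series → Series
(⊟ f) n = -ℤ f n

-- The Cauchy product, by recursion on f = f(0) + q · `tail f`.
_⊛_ : Series → Series → Series
(f ⊛ g) zero = f 0 *ℤ g 0
(f ⊛ g) (suc n) = f 0 *ℤ g (suc n) +ℤ (tail f ⊛ g) n

𝟘 𝟙 : Series
𝟘 _ = 0ℤ
𝟙 zero = 1ℤ
𝟙 (suc _) = 0ℤ

⊛-cong : ∀ {f f′ g g′} → f ≈ f′ → g ≈ g′ → f ⊛ g ≈ f′ ⊛ g′
⊛-cong p q zero = cong₂ _*ℤ_ (p 0) (q 0)
⊛-cong p q (suc n) = cong₂ _+ℤ_ (cong₂ _*ℤ_ (p 0) (q (suc n))) (⊛-cong (p ∘ suc) q n)

⊛-zeroˡ : ∀ {f} g → f ≈ 𝟘 → f ⊛ g ≈ 𝟘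
⊛-zeroˡ g p zero = trans (cong (_*ℤ g 0) (p 0)) (ℤₚ.*-zeroˡ (g 0))
⊛-zeroˡ g p (suc n) = cong₂ _+ℤ_ (trans (cong (_*ℤ g (suc n)) (p 0)) (ℤₚ.*-zeroˡ (g (suc n)))) (⊛-zeroˡ g (p ∘ suc) n)

⊛-identityˡ : ∀ f → 𝟙 ⊛ f ≈ f
⊛-identityˡ f zero = ℤₚ.*-identityˡ (f 0)
⊛-identityˡ f (suc n) = trans (cong₂ _+ℤ_ (ℤₚ.*-identityˡ (f (suc n))) (⊛-zeroˡ f (λ _ → refl) n)) (ℤₚ.+-identityʳ _)

⊛-distribʳ : ∀ h f g → (f ⊞ g) ⊛ h ≈ f ⊛ h ⊞ g ⊛ h
⊛-distribʳ h f g zero = ℤₚ.*-distribʳ-+ (h 0) (f 0) (g 0)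
⊛-distribʳ h f g (suc n) = trans (cong ((f 0 +ℤ g 0) *ℤ h (suc n) +ℤ_) (⊛-distribʳ h (tail f) (tail g) n))
  (arith (f 0) (g 0) (h (suc n)) ((tail f ⊛ h) n) ((tail g ⊛ h) n))
  where
  arith : ∀ a b c x y → (a +ℤ b) *ℤ c +ℤ (x +ℤ y) ≡ a *ℤ c +ℤ x +ℤ (b *ℤ c +ℤ y)
  arith = ℤ-Ring.solve-∀

⊛-scale : ∀ c f g → (λ n → c *ℤ f n) ⊛ g ≈ (λ n → c *ℤ (f ⊛ g) n)
⊛-scale c f g zero = ℤₚ.*-assoc c (f 0) (g 0)
⊛-scale c f g (suc n) = trans (cong (c *ℤ f 0 *ℤ g (suc n) +ℤ_) (⊛-scale c (tail f) g n)) (arith c (f 0) (g (suc n)) ((tail f ⊛ g) n))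
  where
  arith : ∀ a b c x → a *ℤ b *ℤ c +ℤ a *ℤ x ≡ a *ℤ (b *ℤ c +ℤ x)
  arith = ℤ-Ring.solve-∀

⊛-sucʳ : ∀ f g n → (f ⊛ g) (suc n) ≡ f (suc n) *ℤ g 0 +ℤ (f ⊛ tail g) n
⊛-sucʳ f g zero = ℤₚ.+-comm (f 0 *ℤ g 1) (f 1 *ℤ g 0)
⊛-sucʳ f g (suc n) = trans (cong (f 0 *ℤ g (2 + n) +ℤ_) (⊛-sucʳ (tail f) g n))
  (arith (f 0 *ℤ g (2 + n)) (f (2 + n) *ℤ g 0) ((tail f ⊛ tail g) n))
  where
  arith : ∀ a b c → a +ℤ (b +ℤ c) ≡ b +ℤ (a +ℤ c)
  arith = ℤ-Ring.solve-∀

⊛-comm : ∀ f g → f ⊛ g ≈ g ⊛ f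
⊛-comm f g zero = ℤₚ.*-comm (f 0) (g 0)
⊛-comm f g (suc n) = trans (cong₂ _+ℤ_ (ℤₚ.*-comm (f 0) (g (suc n))) (⊛-comm (tail f) g n)) (sym (⊛-sucʳ g f n))

⊛-assoc : ∀ f g h → (f ⊛ g) ⊛ h ≈ f ⊛ (g ⊛ h)
⊛-assoc f g h zero = ℤₚ.*-assoc (f 0) (g 0) (h 0)
⊛-assoc f g h (suc n) = begin
  f 0 *ℤ g 0 *ℤ h (suc n) +ℤ (tail (f ⊛ g) ⊛ h) n
    ≡⟨ cong (f 0 *ℤ g 0 *ℤ h (suc n) +ℤ_) (⊛-distribʳ h (λ k → f 0 *ℤ tail g k) (tail f ⊛ g) n) ⟩
  f 0 *ℤ g 0 *ℤ h (suc n) +ℤ (((λ k → f 0 *ℤ tail g k) ⊛ h) n +ℤ ((tail f ⊛ g) ⊛ h) n)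
    ≡⟨ cong₂ (λ x y → f 0 *ℤ g 0 *ℤ h (suc n) +ℤ (x +ℤ y)) (⊛-scale (f 0) (tail g) h n) (⊛-assoc (tail f) g h n) ⟩
  f 0 *ℤ g 0 *ℤ h (suc n) +ℤ (f 0 *ℤ (tail g ⊛ h) n +ℤ (tail f ⊛ (g ⊛ h)) n)
    ≡⟨ arith (f 0) (g 0) (h (suc n)) ((tail g ⊛ h) n) ((tail f ⊛ (g ⊛ h)) n) ⟩
  f 0 *ℤ (g 0 *ℤ h (suc n) +ℤ (tail g ⊛ h) n) +ℤ (tail f ⊛ (g ⊛ h)) n ∎
  where
  open ≡-Reasoning
  arith : ∀ a b c x y → a *ℤ b *ℤ c +ℤ (a *ℤ x +ℤ y) ≡ a *ℤ (b *ℤ c +ℤ x) +ℤ y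
  arith = ℤ-Ring.solve-∀

seriesRing : CommutativeRing 0ℓ 0ℓ
seriesRing = record
  { Carrier = Series ; _≈_ = _≈_ ; _+_ = _⊞_ ; _*_ = _⊛_ ; -_ = ⊟_ ; 0# = 𝟘 ; 1# = 𝟙
  ; isCommutativeRing = record
    { isRing = record
      { +-isAbelianGroup = record
        { isGroup = record
          { isMonoid = record
            { isSemigroup = record
              { isMagma = record
                { isEquivalence = record { refl = λ _ → refl ; sym = λ p n → sym (p n) ; trans = λ p q n → trans (p n) (q n) }
                ; ∙-cong = λ p q n → cong₂ _+ℤ_ (p n) (q n) }
              ; assoc = λ f g h n → ℤₚ.+-assoc (f n) (g n) (h n) }
            ; identity = (λ f n → ℤₚ.+-identityˡ (f n)) , (λ f n → ℤₚ.+-identityʳ (f n)) }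
          ; inverse = (λ f n → ℤₚ.+-inverseˡ (f n)) , (λ f n → ℤₚ.+-inverseʳ (f n))
          ; ⁻¹-cong = λ p n → cong -ℤ_ (p n) }
        ; comm = λ f g n → ℤₚ.+-comm (f n) (g n) }
      ; *-cong = ⊛-cong
      ; *-assoc = ⊛-assoc
      ; *-identity = ⊛-identityˡ , (λ f n → trans (⊛-comm f 𝟙 n) (⊛-identityˡ f n))
      ; distrib = (λ h f g n → trans (⊛-comm h (f ⊞ g) n) (trans (⊛-distribʳ h f g n) (cong₂ _+ℤ_ (⊛-comm f h n) (⊛-comm g h n)))) , ⊛-distribʳ }
    ; *-comm = ⊛-comm } }

open CommutativeRing seriesRing public using () renaming (setoid to seriesSetoid)

≈-refl : ∀ {f} → f ≈ f
≈-refl n = refl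

≈-sym : ∀ {f g} → f ≈ g → g ≈ f
≈-sym p n = sym (p n)

≈-trans : ∀ {f g h} → f ≈ g → g ≈ h → f ≈ h
≈-trans p q n = trans (p n) (q n)

⊞-cong : ∀ {f f′ g g′} → f ≈ f′ → g ≈ g′ → f ⊞ g ≈ f′ ⊞ g′
⊞-cong p q n = cong₂ _+ℤ_ (p n) (q n)

seriesAlmostRing : AlmostCommutativeRing 0ℓ 0ℓ
seriesAlmostRing = fromCommutativeRing seriesRing

constant : ℤ → Series
constant c n = c *ℤ 𝟙 n

-- Equality of series is undecidable, so the ring solver takes its coefficients from the integers,
-- embedded as constant series.
constantHomomorphism : CommutativeRing.rawRing ℤₚ.+-*-commutativeRing -Raw-AlmostCommutative⟶ seriesAlmostRing
constantHomomorphism = record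
  { ⟦_⟧ = constant
  ; +-homo = λ a b n → ℤₚ.*-distribʳ-+ (𝟙 n) a b
  ; *-homo = λ a b n → begin
      a *ℤ b *ℤ 𝟙 n                ≡⟨ ℤₚ.*-assoc a b (𝟙 n) ⟩
      a *ℤ (b *ℤ 𝟙 n)              ≡⟨ cong (a *ℤ_) (⊛-identityˡ (constant b) n) ⟨
      a *ℤ (𝟙 ⊛ constant b) n      ≡⟨ ⊛-scale a 𝟙 (constant b) n ⟨
      (constant a ⊛ constant b) n  ∎
  ; -‿homo = λ a n → sym (ℤₚ.neg-distribˡ-* a (𝟙 n))
  ; 0-homo = λ n → ℤₚ.*-zeroˡ (𝟙 n)
  ; 1-homo = λ n → ℤₚ.*-identityˡ (𝟙 n) }
  where open ≡-Reasoning

constant≟ : ∀ a b → Maybe (constant a ≈ constant b)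
constant≟ a b = Maybe.map (λ p n → cong (_*ℤ 𝟙 n) p) (dec⇒weaklyDec ℤₚ._≟_ a b)

module SeriesSolver = Algebra.Solver.Ring (CommutativeRing.rawRing ℤₚ.+-*-commutativeRing) seriesAlmostRing constantHomomorphism
  constant≟

⊞-congˡ : ∀ f {g h} → g ≈ h → f ⊞ g ≈ f ⊞ h
⊞-congˡ f p n = cong (f n +ℤ_) (p n)

⊛-congˡ : ∀ f {g h} → g ≈ h → f ⊛ g ≈ f ⊛ h
⊛-congˡ f = ⊛-cong (≈-refl {f})

⊛-congʳ : ∀ h {f g} → f ≈ g → f ⊛ h ≈ g ⊛ h
⊛-congʳ h p = ⊛-cong p (≈-refl {h})

open SeriesSolver using (solve; _:=_; _:+_; _:*_; _:-_; con)

-- Dilation q ↦ q² and graded sets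

data Parity : ℕ → Set where
  even : ∀ k → Parity (k + k)
  odd  : ∀ k → Parity (suc (k + k))

parity : ∀ n → Parity n
parity zero = even 0
parity (suc n) with parity n
... | even k = odd k
... | odd k = subst (Parity ∘ suc) (ℕₚ.+-suc k k) (even (suc k))

dil : Series → Series
dil f zero = f 0
dil f (suc zero) = 0ℤ
dil f (suc (suc n)) = dil (tail f) n

dil-double : ∀ f k → dil f (k + k) ≡ f k
dil-double f zero = refl
dil-double f (suc k) = trans (cong (dil f ∘ suc) (ℕₚ.+-suc k k)) (dil-double (tail f) k)

dil-odd : ∀ f k → dil f (suc (k + k)) ≡ 0ℤ
dil-odd f zero = refl
dil-odd f (suc k) = trans (cong (dil f ∘ suc ∘ suc) (ℕₚ.+-suc k k)) (dil-odd (tail f) k)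

dil-cong : ∀ {f g} → f ≈ g → dil f ≈ dil g
dil-cong p zero = p 0
dil-cong p (suc zero) = refl
dil-cong p (suc (suc n)) = dil-cong (p ∘ suc) n

dil-⊞ : ∀ f g → dil (f ⊞ g) ≈ dil f ⊞ dil g
dil-⊞ f g zero = refl
dil-⊞ f g (suc zero) = refl
dil-⊞ f g (suc (suc n)) = dil-⊞ (tail f) (tail g) n

dil-scale : ∀ c f → dil (λ n → c *ℤ f n) ≈ (λ n → c *ℤ dil f n)
dil-scale c f zero = refl
dil-scale c f (suc zero) = sym (ℤₚ.*-zeroʳ c)
dil-scale c f (suc (suc n)) = dil-scale c (tail f) n

dil-𝟘 : ∀ n → dil 𝟘 n ≡ 0ℤ
dil-𝟘 zero = refl
dil-𝟘 (suc zero) = refl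
dil-𝟘 (suc (suc n)) = dil-𝟘 n

dil-𝟙 : dil 𝟙 ≈ 𝟙
dil-𝟙 zero = refl
dil-𝟙 (suc zero) = refl
dil-𝟙 (suc (suc n)) = dil-𝟘 n

dil-⊛ : ∀ f g → dil (f ⊛ g) ≈ dil f ⊛ dil g
dil-⊛ f g zero = refl
dil-⊛ f g (suc zero) = sym (cong₂ _+ℤ_ (ℤₚ.*-zeroʳ (f 0)) (ℤₚ.*-zeroˡ (g 0)))
dil-⊛ f g (suc (suc n)) = begin
  dil (λ k → f 0 *ℤ tail g k +ℤ (tail f ⊛ g) k) n
    ≡⟨ dil-⊞ (λ k → f 0 *ℤ tail g k) (tail f ⊛ g) n ⟩
  dil (λ k → f 0 *ℤ tail g k) n +ℤ dil (tail f ⊛ g) n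
    ≡⟨ cong₂ _+ℤ_ (dil-scale (f 0) (tail g) n) (dil-⊛ (tail f) g n) ⟩
  f 0 *ℤ dil (tail g) n +ℤ (dil (tail f) ⊛ dil g) n
    ≡⟨ cong (f 0 *ℤ dil (tail g) n +ℤ_) (ℤₚ.+-identityˡ _) ⟨
  f 0 *ℤ dil (tail g) n +ℤ (0ℤ +ℤ (dil (tail f) ⊛ dil g) n)
    ≡⟨ cong (λ z → f 0 *ℤ dil (tail g) n +ℤ (z +ℤ (dil (tail f) ⊛ dil g) n)) (ℤₚ.*-zeroˡ (dil g (suc n))) ⟨
  f 0 *ℤ dil (tail g) n +ℤ (0ℤ *ℤ dil g (suc n) +ℤ (dil (tail f) ⊛ dil g) n) ∎
  where open ≡-Reasoning

antidiagonal : ∀ n → Enum (λ ij → proj₁ ij + proj₂ ij ≡ n)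
antidiagonal n = record { elems = list n ; unique = unique′ n ; sound = sound′ n ; complete = λ {ij} → complete′ ij }
  where
  shift : ℕ × ℕ → ℕ × ℕ
  shift (i , j) = suc i , j
  list : ℕ → List (ℕ × ℕ)
  list zero = (0 , 0) ∷ []
  list (suc n) = (0 , suc n) ∷ map shift (list n)
  unique′ : ∀ n → Unique (list n)
  unique′ zero = [] ∷ []
  unique′ (suc n) = All.tabulate (λ p eq → case ∈-map⁻ shift p of λ where (_ , _ , refl) → case eq of λ ()) ∷ Uniqueₚ.map⁺ (λ where refl → refl) (unique′ n)
  sound′ : ∀ n {ij} → ij ∈ list n → proj₁ ij + proj₂ ij ≡ n
  sound′ zero (here refl) = refl
  sound′ (suc n) (here refl) = refl
  sound′ (suc n) (there p) with ∈-map⁻ shift p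
  ... | _ , q , refl = cong suc (sound′ n q)
  member : ∀ i j → (i , j) ∈ list (i + j)
  member zero zero = here refl
  member zero (suc j) = here refl
  member (suc i) j = there (∈-map⁺ shift (member i j))
  complete′ : ∀ ij → proj₁ ij + proj₂ ij ≡ n → ij ∈ list n
  complete′ (i , j) refl = member i j

⊛-antidiagonal : ∀ f g n → (f ⊛ g) n ≡ sumE (antidiagonal n) (λ ij → f (proj₁ ij) *ℤ g (proj₂ ij))
⊛-antidiagonal f g zero = sym (ℤₚ.+-identityʳ _)
⊛-antidiagonal f g (suc n) = cong (f 0 *ℤ g (suc n) +ℤ_) (trans (⊛-antidiagonal (tail f) g n) (sym (∑-map _ _ (elems (antidiagonal n)))))

-- Objects with finitely many members of each weight; `ser` is then the generating function Σ f(a)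
-- q^(wt a).
record Graded (A : Set) : Set₁ where
  field
    Ok   : A → Set
    wt   : A → ℕ
    enum : ∀ n → Enum (λ a → Ok a × wt a ≡ n)

open Graded public

ser : Graded A → (A → ℤ) → Series
ser G f n = sumE (enum G n) f

ser-cong : (G : Graded A) {f g : A → ℤ} → (∀ a → Ok G a → f a ≡ g a) → ser G f ≈ ser G g
ser-cong G eq n = sumE-cong (enum G n) (λ a p → eq a (proj₁ p))

ser-⊞ : (G : Graded A) (f g : A → ℤ) → ser G (λ a → f a +ℤ g a) ≈ ser G f ⊞ ser G g
ser-⊞ G f g n = ∑-+ f g (elems (enum G n))

ser-scale : (G : Graded A) (c : ℤ) (f : A → ℤ) → ser G (λ a → c *ℤ f a) ≈ (λ n → c *ℤ ser G f n)
ser-scale G c f n = ∑-* c f (elems (enum G n))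

ser-reindex : (G : Graded A) (θ₁′ : Graded B) {f : A → ℤ} {f′ : B → ℤ} (g : A → B) (h : B → A) →
  (∀ a → Ok G a → Ok θ₁′ (g a) × wt θ₁′ (g a) ≡ wt G a × h (g a) ≡ a) →
  (∀ b → Ok θ₁′ b → Ok G (h b) × wt G (h b) ≡ wt θ₁′ b × g (h b) ≡ b) →
  (∀ a → Ok G a → f a ≡ f′ (g a)) → ser G f ≈ ser θ₁′ f′
ser-reindex G θ₁′ g h to from eq n = reindex (enum G n) (enum θ₁′ n) g h
  (λ a (o , w) → let o′ , w′ , i = to a o in (o′ , trans w′ w) , i)
  (λ b (o , w) → let o′ , w′ , i = from b o in (o′ , trans w′ w) , i)
  (λ a (o , _) → eq a o)

self-neg⇒0 : ∀ {x} → x ≡ -ℤ x → x ≡ 0ℤ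
self-neg⇒0 {+ zero} _ = refl
self-neg⇒0 {+ suc n} ()
self-neg⇒0 { -[1+ n ]} ()

-- Reindexing by the involution `σ` equates each coefficient with its own negative.
ser-antisymmetric : (G : Graded A) {f : A → ℤ} (σ : A → A) →
  (∀ a → Ok G a → Ok G (σ a) × wt G (σ a) ≡ wt G a × σ (σ a) ≡ a) →
  (∀ a → Ok G a → f a ≡ -ℤ f (σ a)) → ser G f ≈ 𝟘
ser-antisymmetric G {f} σ inv anti n = self-neg⇒0 (begin
  ser G f n                    ≡⟨ ser-reindex G G σ σ inv inv anti n ⟩
  ser G (λ a → -ℤ f a) n       ≡⟨ ser-cong G (λ a _ → sym (ℤₚ.-1*i≡-i (f a))) n ⟩
  ser G (λ a → -[1+ 0 ] *ℤ f a) n ≡⟨ ser-scale G -[1+ 0 ] f n ⟩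
  -[1+ 0 ] *ℤ ser G f n        ≡⟨ ℤₚ.-1*i≡-i _ ⟩
  -ℤ ser G f n                 ∎)
  where open ≡-Reasoning

infixr 7 _⊗_
_⊗_ : Graded A → Graded B → Graded (A × B)
(G ⊗ θ₁′) .Ok (a , b) = Ok G a × Ok θ₁′ b
(G ⊗ θ₁′) .wt (a , b) = wt G a + wt θ₁′ b
_⊗_ {A} {B} G θ₁′ .enum n = mapE proj₂ (λ ab → (wt G (proj₁ ab) , wt θ₁′ (proj₂ ab)) , ab)
  (λ where ((i , j) , (a , b)) (ij , (oa , refl) , (ob , refl)) → ((oa , ob) , ij) , refl)
  (λ where (a , b) ((oa , ob) , w) → (w , (oa , refl) , (ob , refl)) , refl)
  (pairE (antidiagonal n) (λ ij → pairE (enum G (proj₁ ij)) (λ _ → enum θ₁′ (proj₂ ij))))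

ser-⊗ : (G : Graded A) (θ₁′ : Graded B) (f : A → ℤ) (g : B → ℤ) →
  ser (G ⊗ θ₁′) (λ ab → f (proj₁ ab) *ℤ g (proj₂ ab)) ≈ ser G f ⊛ ser θ₁′ g
ser-⊗ {A} {B} G θ₁′ f g n = begin
  ser (G ⊗ θ₁′) fg n
    ≡⟨ ∑-map fg proj₂ (elems levels) ⟩
  sumE levels (fg ∘ proj₂)
    ≡⟨ sumE-pair (antidiagonal n) (λ ij → pairE (enum G (proj₁ ij)) (λ _ → enum θ₁′ (proj₂ ij))) (fg ∘ proj₂) ⟩
  sumE (antidiagonal n) (λ ij → sumE (pairE (enum G (proj₁ ij)) (λ _ → enum θ₁′ (proj₂ ij))) fg)
    ≡⟨ sumE-cong (antidiagonal n) (λ (i , j) _ → product i j) ⟩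
  sumE (antidiagonal n) (λ ij → ser G f (proj₁ ij) *ℤ ser θ₁′ g (proj₂ ij))
    ≡⟨ ⊛-antidiagonal (ser G f) (ser θ₁′ g) n ⟨
  (ser G f ⊛ ser θ₁′ g) n ∎
  where
  open ≡-Reasoning
  fg : A × B → ℤ
  fg ab = f (proj₁ ab) *ℤ g (proj₂ ab)
  levels = pairE (antidiagonal n) (λ ij → pairE (enum G (proj₁ ij)) (λ _ → enum θ₁′ (proj₂ ij)))
  product : ∀ i j → sumE (pairE (enum G i) (λ _ → enum θ₁′ j)) fg ≡ ser G f i *ℤ ser θ₁′ g j
  product i j = begin
    sumE (pairE (enum G i) (λ _ → enum θ₁′ j)) fg
      ≡⟨ sumE-pair (enum G i) (λ _ → enum θ₁′ j) fg ⟩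
    sumE (enum G i) (λ a → sumE (enum θ₁′ j) (λ b → f a *ℤ g b))
      ≡⟨ sumE-cong (enum G i) (λ a _ → trans (∑-* (f a) g (elems (enum θ₁′ j))) (ℤₚ.*-comm (f a) (ser θ₁′ g j))) ⟩
    sumE (enum G i) (λ a → ser θ₁′ g j *ℤ f a)
      ≡⟨ ∑-* (ser θ₁′ g j) f (elems (enum G i)) ⟩
    ser θ₁′ g j *ℤ ser G f i
      ≡⟨ ℤₚ.*-comm (ser θ₁′ g j) (ser G f i) ⟩
    ser G f i *ℤ ser θ₁′ g j ∎

emptyE : {P : A → Set} → (∀ a → ¬ P a) → Enum P
emptyE no-P = record { elems = [] ; unique = [] ; sound = λ () ; complete = λ p → ⊥-elim (no-P _ p) }

double-injective : ∀ {a b} → a + a ≡ b + b → a ≡ b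
double-injective {a} {b} eq = trans (ℕₚ.n≡⌊n+n/2⌋ a) (trans (cong ⌊_/2⌋ eq) (sym (ℕₚ.n≡⌊n+n/2⌋ b)))

double≢odd : ∀ a k → a + a ≢ suc (k + k)
double≢odd zero k ()
double≢odd (suc a) zero eq with () ← trans (sym (ℕₚ.+-suc a a)) (ℕₚ.suc-injective eq)
double≢odd (suc a) (suc k) eq = double≢odd a k (ℕₚ.suc-injective (trans (sym (ℕₚ.+-suc a a)) (trans (ℕₚ.suc-injective eq) (cong suc (ℕₚ.+-suc k k)))))

dilated : Graded A → Graded A
dilated G .Ok = Ok G
dilated G .wt a = wt G a + wt G a
dilated G .enum n with parity n
... | even k = relabel (λ a (o , w) → o , cong₂ _+_ w w) (λ a (o , w) → o , double-injective w) (enum G k)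
... | odd k = emptyE (λ a (o , w) → double≢odd (wt G a) k w)

ser-dilated : (G : Graded A) (f : A → ℤ) → ser (dilated G) f ≈ dil (ser G f)
ser-dilated G f n with parity n
... | even k = trans (∑-map f id (elems (enum G k))) (sym (dil-double (ser G f) k))
... | odd k = sym (dil-odd (ser G f) k)

-- Residues modulo 8

next prev opposite : Fin 8 → Fin 8
next = Vec.lookup (# 1 ∷ # 2 ∷ # 3 ∷ # 4 ∷ # 5 ∷ # 6 ∷ # 7 ∷ # 0 ∷ [])
prev = Vec.lookup (# 7 ∷ # 0 ∷ # 1 ∷ # 2 ∷ # 3 ∷ # 4 ∷ # 5 ∷ # 6 ∷ [])
opposite = Vec.lookup (# 0 ∷ # 7 ∷ # 6 ∷ # 5 ∷ # 4 ∷ # 3 ∷ # 2 ∷ # 1 ∷ [])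

residue : ℤ → Fin 8
residue (+ zero) = Fin.zero
residue (+ suc n) = next (residue (+ n))
residue -[1+ zero ] = prev Fin.zero
residue -[1+ suc n ] = prev (residue -[1+ n ])

-- The implicit argument is settled by evaluating the decision on all eight residues; identities
-- between functions modulo 8 are proved by such table checks.
by-cases₁ : {R : Fin 8 → Set} (R? : Decidable R) {_ : True (Finₚ.all? R?)} → ∀ i → R i
by-cases₁ R? {t} = toWitness t

by-cases₂ : {R : Fin 8 → Fin 8 → Set} (R? : ∀ i j → Dec (R i j)) {_ : True (Finₚ.all? (λ i → Finₚ.all? (R? i)))} → ∀ i j → R i j
by-cases₂ R? {t} = toWitness t

infixl 6 _⊕_
infixl 7 _⊙_
_⊕_ _⊙_ : Fin 8 → Fin 8 → Fin 8
i ⊕ j = go (Fin.toℕ j)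
  where
  go : ℕ → Fin 8
  go zero = i
  go (suc n) = next (go n)
i ⊙ j = go (Fin.toℕ i)
  where
  go : ℕ → Fin 8
  go zero = Fin.zero
  go (suc n) = j ⊕ go n

residue-suc : ∀ x → residue (1ℤ +ℤ x) ≡ next (residue x)
residue-suc (+ n) = refl
residue-suc -[1+ zero ] = refl
residue-suc -[1+ suc n ] = sym (by-cases₁ (λ i → next (prev i) Finₚ.≟ i) (residue -[1+ n ]))

residue-pred : ∀ x → residue (-[1+ 0 ] +ℤ x) ≡ prev (residue x)
residue-pred (+ zero) = refl
residue-pred (+ suc n) = sym (by-cases₁ (λ i → prev (next i) Finₚ.≟ i) (residue (+ n)))
residue-pred -[1+ n ] = refl

residue-+ : ∀ x y → residue (x +ℤ y) ≡ residue x ⊕ residue y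
residue-+ x (+ zero) = cong residue (ℤₚ.+-identityʳ x)
residue-+ x (+ suc n) = begin
  residue (x +ℤ (1ℤ +ℤ + n))           ≡⟨ cong residue (arith x (+ n)) ⟩
  residue (1ℤ +ℤ (x +ℤ + n))           ≡⟨ residue-suc (x +ℤ + n) ⟩
  next (residue (x +ℤ + n))            ≡⟨ cong next (residue-+ x (+ n)) ⟩
  next (residue x ⊕ residue (+ n))     ≡⟨ by-cases₂ (λ i j → next (i ⊕ j) Finₚ.≟ i ⊕ next j) (residue x) (residue (+ n)) ⟩
  residue x ⊕ next (residue (+ n))     ∎
  where
  open ≡-Reasoning
  arith : ∀ a b → a +ℤ (1ℤ +ℤ b) ≡ 1ℤ +ℤ (a +ℤ b)
  arith = ℤ-Ring.solve-∀
residue-+ x -[1+ zero ] = begin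
  residue (x +ℤ -[1+ 0 ])              ≡⟨ cong residue (ℤₚ.+-comm x -[1+ 0 ]) ⟩
  residue (-[1+ 0 ] +ℤ x)              ≡⟨ residue-pred x ⟩
  prev (residue x)                     ≡⟨ by-cases₁ (λ i → prev i Finₚ.≟ i ⊕ prev Fin.zero) (residue x) ⟩
  residue x ⊕ prev Fin.zero            ∎
  where open ≡-Reasoning
residue-+ x -[1+ suc n ] = begin
  residue (x +ℤ (-[1+ 0 ] +ℤ -[1+ n ])) ≡⟨ cong residue (arith x -[1+ 0 ] -[1+ n ]) ⟩
  residue (-[1+ 0 ] +ℤ (x +ℤ -[1+ n ])) ≡⟨ residue-pred (x +ℤ -[1+ n ]) ⟩
  prev (residue (x +ℤ -[1+ n ]))       ≡⟨ cong prev (residue-+ x -[1+ n ]) ⟩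
  prev (residue x ⊕ residue -[1+ n ])  ≡⟨ by-cases₂ (λ i j → prev (i ⊕ j) Finₚ.≟ i ⊕ prev j) (residue x) (residue -[1+ n ]) ⟩
  residue x ⊕ prev (residue -[1+ n ])  ∎
  where
  open ≡-Reasoning
  arith : ∀ a c b → a +ℤ (c +ℤ b) ≡ c +ℤ (a +ℤ b)
  arith = ℤ-Ring.solve-∀

residue-neg : ∀ x → residue (-ℤ x) ≡ opposite (residue x)
residue-neg x = begin
  residue (-ℤ x)                                    ≡⟨ by-cases₂ (λ i j → (opposite i ⊕ (i ⊕ j)) Finₚ.≟ j) (residue x) (residue (-ℤ x)) ⟨
  opposite (residue x) ⊕ (residue x ⊕ residue (-ℤ x)) ≡⟨ cong (opposite (residue x) ⊕_) (residue-+ x (-ℤ x)) ⟨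
  opposite (residue x) ⊕ residue (x -ℤ x)           ≡⟨ cong (λ z → opposite (residue x) ⊕ residue z) (ℤₚ.+-inverseʳ x) ⟩
  opposite (residue x)                              ∎
  where open ≡-Reasoning

residue-- : ∀ x y → residue (x -ℤ y) ≡ residue x ⊕ opposite (residue y)
residue-- x y = trans (residue-+ x (-ℤ y)) (cong (residue x ⊕_) (residue-neg y))

residue-* : ∀ m n → residue (+ (m * n)) ≡ residue (+ m) ⊙ residue (+ n)
residue-* zero n = refl
residue-* (suc m) n = begin
  residue (+ n +ℤ + (m * n))                        ≡⟨ residue-+ (+ n) (+ (m * n)) ⟩
  residue (+ n) ⊕ residue (+ (m * n))               ≡⟨ cong (residue (+ n) ⊕_) (residue-* m n) ⟩
  residue (+ n) ⊕ residue (+ m) ⊙ residue (+ n)     ≡⟨ by-cases₂ (λ i j → j ⊕ i ⊙ j Finₚ.≟ next i ⊙ j) (residue (+ m)) (residue (+ n)) ⟩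
  next (residue (+ m)) ⊙ residue (+ n)              ∎
  where open ≡-Reasoning

Table : Set
Table = Fin 8 → ℤ

table : Vec ℤ 8 → Table
table = Vec.lookup

-1ℤ : ℤ
-1ℤ = -[1+ 0 ]

ε′ σ′ ω′ δ′ o′ e′ η′ : Table
ε′ = table (0ℤ ∷ 1ℤ ∷ 0ℤ ∷ -1ℤ ∷ 0ℤ ∷ 1ℤ ∷ 0ℤ ∷ -1ℤ ∷ [])
σ′ = table (1ℤ ∷ 0ℤ ∷ -1ℤ ∷ 0ℤ ∷ 1ℤ ∷ 0ℤ ∷ -1ℤ ∷ 0ℤ ∷ [])
ω′ = table (0ℤ ∷ 1ℤ ∷ 0ℤ ∷ 1ℤ ∷ 0ℤ ∷ -1ℤ ∷ 0ℤ ∷ -1ℤ ∷ [])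
δ′ = table (0ℤ ∷ 1ℤ ∷ 0ℤ ∷ -1ℤ ∷ 0ℤ ∷ -1ℤ ∷ 0ℤ ∷ 1ℤ ∷ [])
o′ = table (0ℤ ∷ 1ℤ ∷ 0ℤ ∷ 1ℤ ∷ 0ℤ ∷ 1ℤ ∷ 0ℤ ∷ 1ℤ ∷ [])
e′ = table (1ℤ ∷ 0ℤ ∷ 1ℤ ∷ 0ℤ ∷ 1ℤ ∷ 0ℤ ∷ 1ℤ ∷ 0ℤ ∷ [])
η′ = table (0ℤ ∷ 0ℤ ∷ 1ℤ ∷ 0ℤ ∷ 0ℤ ∷ 0ℤ ∷ -1ℤ ∷ 0ℤ ∷ [])

-- ε = (-4/·), ω = (-8/·) and δ = (8/·) are Dirichlet characters, o and e the indicators of odd and even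
-- integers; ε x = sin (π x / 2), σ x = cos (π x / 2), and η x = ε (x / 2) for even x, η x = 0 for odd x.
ε σ ω δ o e η : ℤ → ℤ
ε x = ε′ (residue x)
σ x = σ′ (residue x)
ω x = ω′ (residue x)
δ x = δ′ (residue x)
o x = o′ (residue x)
e x = e′ (residue x)
η x = η′ (residue x)

next^ : ℕ → Fin 8 → Fin 8
next^ zero i = i
next^ (suc k) i = next (next^ k i)

module _ (f : Table) where
  private F : ℤ → ℤ
          F x = f (residue x)

  table-+ : ∀ x y → F (x +ℤ y) ≡ f (residue x ⊕ residue y)
  table-+ x y = cong f (residue-+ x y)

  table-- : ∀ x y → F (x -ℤ y) ≡ f (residue x ⊕ opposite (residue y))
  table-- x y = cong f (residue-- x y)

-- Sums over squares and the rotation (u , v) ↦ (u + v , u - v)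

half : ℤ → ℤ
half (+ n) = + ⌊ n /2⌋
half -[1+ n ] = -ℤ (+ ⌊ suc n /2⌋)

half-neg : ∀ x → half (-ℤ x) ≡ -ℤ half x
half-neg (+ zero) = refl
half-neg (+ suc n) = refl
half-neg -[1+ n ] = sym (ℤₚ.neg-involutive _)

half-double : ∀ x → half (x +ℤ x) ≡ x
half-double (+ n) = cong +_ (sym (ℕₚ.n≡⌊n+n/2⌋ n))
half-double -[1+ n ] = begin
  half (-[1+ n ] +ℤ -[1+ n ]) ≡⟨ cong half (ℤₚ.neg-distrib-+ (+ suc n) (+ suc n)) ⟨
  half (-ℤ (+ (suc n + suc n))) ≡⟨ half-neg (+ (suc n + suc n)) ⟩
  -ℤ (+ ⌊ suc n + suc n /2⌋)   ≡⟨ cong (-ℤ_ ∘ +_) (ℕₚ.n≡⌊n+n/2⌋ (suc n)) ⟨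
  -[1+ n ]                     ∎
  where open ≡-Reasoning

Even : ℤ → Set
Even x = half x +ℤ half x ≡ x

even? : Decidable Even
even? x = half x +ℤ half x ℤₚ.≟ x

double-even : ∀ x → Even (x +ℤ x)
double-even x = cong₂ _+ℤ_ (half-double x) (half-double x)

o-odd : ∀ x → o (1ℤ +ℤ (x +ℤ x)) ≡ 1ℤ
o-odd x = begin
  o (1ℤ +ℤ (x +ℤ x))             ≡⟨ cong o′ (residue-suc (x +ℤ x)) ⟩
  o′ (next (residue (x +ℤ x)))   ≡⟨ cong (o′ ∘ next) (residue-+ x x) ⟩
  o′ (next (residue x ⊕ residue x)) ≡⟨ by-cases₁ (λ i → o′ (next (i ⊕ i)) ℤₚ.≟ 1ℤ) (residue x) ⟩
  1ℤ                             ∎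
  where open ≡-Reasoning

o-neg : ∀ x → o (-ℤ x) ≡ o x
o-neg x = trans (cong o′ (residue-neg x)) (by-cases₁ (λ i → o′ (opposite i) ℤₚ.≟ o′ i) (residue x))

even⊎odd : ∀ x → Even x ⊎ o x ≡ 1ℤ
even⊎odd (+ n) with parity n
... | even k = inj₁ (double-even (+ k))
... | odd k = inj₂ (o-odd (+ k))
even⊎odd -[1+ n ] with even⊎odd (+ suc n)
... | inj₁ p = inj₁ (trans (sym (ℤₚ.neg-distrib-+ (+ ⌊ suc n /2⌋) (+ ⌊ suc n /2⌋))) (cong -ℤ_ p))
... | inj₂ q = inj₂ (trans (o-neg (+ suc n)) q)

∣x∣²≡x² : ∀ x → + (∣ x ∣ * ∣ x ∣) ≡ x *ℤ x
∣x∣²≡x² (+ n) = ℤₚ.pos-* n n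
∣x∣²≡x² -[1+ n ] = refl

intervalE : ∀ b → Enum (λ x → ∣ x ∣ ≤ b)
intervalE b = mapE (λ i → + i -ℤ + b) (λ x → ∣ x +ℤ + b ∣) to from (upToE (suc (2 * b)))
  where
  twice : 2 * b ≡ b + b
  twice = cong (λ z → b + z) (ℕₚ.+-identityʳ b)
  bound : ∀ i → i ≤ b + b → ∣ + i -ℤ + b ∣ ≤ b
  bound i i≤ with ℕₚ.≤-total b i
  ... | inj₁ b≤i = subst (_≤ b) (cong ∣_∣ (sym (trans (ℤₚ.m-n≡m⊖n i b) (ℤₚ.⊖-≥ b≤i)))) (ℕₚ.m≤n+o⇒m∸n≤o i b i≤)
  ... | inj₂ i≤b = subst (_≤ b) (sym (trans (cong ∣_∣ (ℤₚ.m-n≡m⊖n i b)) (ℤₚ.∣⊖∣-≤ i≤b))) (ℕₚ.m∸n≤m b i)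
  to : Matches (_< suc (2 * b)) (λ x → ∣ x ∣ ≤ b) (λ i → + i -ℤ + b) (λ x → ∣ x +ℤ + b ∣)
  to i (s≤s i≤) = bound i (subst (i ≤_) twice i≤) , cong ∣_∣ (arith (+ i) (+ b))
    where
    arith : ∀ x y → x -ℤ y +ℤ y ≡ x
    arith = ℤ-Ring.solve-∀
  from : Matches (λ x → ∣ x ∣ ≤ b) (_< suc (2 * b)) (λ x → ∣ x +ℤ + b ∣) (λ i → + i -ℤ + b)
  from x x≤ = s≤s (subst (∣ x +ℤ + b ∣ ≤_) (sym twice) (ℕₚ.≤-trans (ℤₚ.∣i+j∣≤∣i∣+∣j∣ x (+ b)) (ℕₚ.+-monoˡ-≤ b x≤))) ,
    trans (cong (_-ℤ + b) (nonneg x x≤)) (arith x (+ b))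
    where
    arith : ∀ x y → x +ℤ y -ℤ y ≡ x
    arith = ℤ-Ring.solve-∀
    nonneg : ∀ x → ∣ x ∣ ≤ b → + ∣ x +ℤ + b ∣ ≡ x +ℤ + b
    nonneg (+ n) _ = refl
    nonneg -[1+ n ] le = trans (cong (+_ ∘ ∣_∣) (ℤₚ.⊖-≥ le)) (sym (ℤₚ.⊖-≥ le))

n≤n*n : ∀ n → n ≤ n * n
n≤n*n zero = z≤n
n≤n*n (suc n) = ℕₚ.m≤m+n (suc n) (n * suc n)

Squares : Graded ℤ
Squares .Ok _ = ⊤
Squares .wt x = ∣ x ∣ * ∣ x ∣
Squares .enum n = relabel (λ x (_ , w) → tt , w) (λ x (_ , w) → subst (∣ x ∣ ≤_) w (n≤n*n ∣ x ∣) , w)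
  (filterE (λ x → ∣ x ∣ * ∣ x ∣ ℕₚ.≟ n) (intervalE n))

rot : ℤ × ℤ → ℤ × ℤ
rot (u , v) = u +ℤ v , u -ℤ v

wt-rot : ∀ uv → wt (Squares ⊗ Squares) (rot uv) ≡ wt (dilated (Squares ⊗ Squares)) uv
wt-rot (u , v) = ℤₚ.+-injective (begin
  + (∣ u +ℤ v ∣ * ∣ u +ℤ v ∣) +ℤ + (∣ u -ℤ v ∣ * ∣ u -ℤ v ∣)
    ≡⟨ cong₂ _+ℤ_ (∣x∣²≡x² (u +ℤ v)) (∣x∣²≡x² (u -ℤ v)) ⟩
  (u +ℤ v) *ℤ (u +ℤ v) +ℤ (u -ℤ v) *ℤ (u -ℤ v)
    ≡⟨ arith u v ⟩
  u *ℤ u +ℤ v *ℤ v +ℤ (u *ℤ u +ℤ v *ℤ v)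
    ≡⟨ cong₂ (λ a b → a +ℤ b +ℤ (a +ℤ b)) (∣x∣²≡x² u) (∣x∣²≡x² v) ⟨
  + (∣ u ∣ * ∣ u ∣ + ∣ v ∣ * ∣ v ∣ + (∣ u ∣ * ∣ u ∣ + ∣ v ∣ * ∣ v ∣)) ∎)
  where
  open ≡-Reasoning
  arith : ∀ u v → (u +ℤ v) *ℤ (u +ℤ v) +ℤ (u -ℤ v) *ℤ (u -ℤ v) ≡ u *ℤ u +ℤ v *ℤ v +ℤ (u *ℤ u +ℤ v *ℤ v)
  arith = ℤ-Ring.solve-∀

-- The rotation doubles u² + v² and maps ℤ² bijectively onto the pairs with even coordinate sum,
-- which carry the support of `f`. The Landen relations for theta series come from here.
ser-rot : ∀ f → (∀ x y → o (x +ℤ y) ≡ 1ℤ → f (x , y) ≡ 0ℤ) →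
  ser (Squares ⊗ Squares) f ≈ dil (ser (Squares ⊗ Squares) (f ∘ rot))
ser-rot f vanish n = begin
  ser S² f n
    ≡⟨ sumE-split sameParity? (enum S² n) f ⟩
  sumE (filterE sameParity? (enum S² n)) f +ℤ sumE (filterE (¬? ∘ sameParity?) (enum S² n)) f
    ≡⟨ cong₂ _+ℤ_ same different ⟩
  ser (dilated S²) (f ∘ rot) n +ℤ 0ℤ
    ≡⟨ ℤₚ.+-identityʳ _ ⟩
  ser (dilated S²) (f ∘ rot) n
    ≡⟨ ser-dilated S² (f ∘ rot) n ⟩
  dil (ser S² (f ∘ rot)) n ∎
  where
  open ≡-Reasoning
  S² = Squares ⊗ Squares
  sameParity? : Decidable (λ (xy : ℤ × ℤ) → Even (proj₁ xy +ℤ proj₂ xy))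
  sameParity? (x , y) = even? (x +ℤ y)
  unrot : ℤ × ℤ → ℤ × ℤ
  unrot (x , y) = half (x +ℤ y) , x -ℤ half (x +ℤ y)
  sum-rot : ∀ u v → u +ℤ v +ℤ (u -ℤ v) ≡ u +ℤ u
  sum-rot = ℤ-Ring.solve-∀
  diff-rot : ∀ u v → u +ℤ v -ℤ u ≡ v
  diff-rot = ℤ-Ring.solve-∀
  unrot-rot : ∀ u v → unrot (rot (u , v)) ≡ (u , v)
  unrot-rot u v = cong₂ _,_ h (trans (cong (λ z → u +ℤ v -ℤ z) h) (diff-rot u v))
    where
    h : half (u +ℤ v +ℤ (u -ℤ v)) ≡ u
    h = trans (cong half (sum-rot u v)) (half-double u)
  rot-unrot : ∀ x y → Even (x +ℤ y) → rot (unrot (x , y)) ≡ (x , y)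
  rot-unrot x y ev = cong₂ _,_ (arith₁ x (half (x +ℤ y))) (begin
    half (x +ℤ y) -ℤ (x -ℤ half (x +ℤ y))   ≡⟨ arith₂ x (half (x +ℤ y)) ⟩
    half (x +ℤ y) +ℤ half (x +ℤ y) -ℤ x     ≡⟨ cong (_-ℤ x) ev ⟩
    x +ℤ y -ℤ x                             ≡⟨ diff-rot x y ⟩
    y                                       ∎)
    where
    arith₁ : ∀ x h → h +ℤ (x -ℤ h) ≡ x
    arith₁ = ℤ-Ring.solve-∀
    arith₂ : ∀ x h → h -ℤ (x -ℤ h) ≡ h +ℤ h -ℤ x
    arith₂ = ℤ-Ring.solve-∀
  same : sumE (filterE sameParity? (enum S² n)) f ≡ ser (dilated S²) (f ∘ rot) n
  same = sym (reindex (enum (dilated S²) n) (filterE sameParity? (enum S² n)) rot unrot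
    (λ where (u , v) (_ , w) → ((_ , trans (wt-rot (u , v)) w) , subst Even (sym (sum-rot u v)) (double-even u)) , unrot-rot u v)
    (λ where (x , y) ((_ , w) , ev) → (_ , trans (sym (wt-rot (unrot (x , y)))) (trans (cong (wt S²) (rot-unrot x y ev)) w)) , rot-unrot x y ev)
    (λ _ _ → refl))
  different : sumE (filterE (¬? ∘ sameParity?) (enum S² n)) f ≡ 0ℤ
  different = sumE-0 (filterE (¬? ∘ sameParity?) (enum S² n)) zero-term
    where
    zero-term : ∀ xy → _ × ¬ Even (proj₁ xy +ℤ proj₂ xy) → f xy ≡ 0ℤ
    zero-term (x , y) (_ , ¬ev) with even⊎odd (x +ℤ y)
    ... | inj₁ ev = ⊥-elim (¬ev ev)
    ... | inj₂ od = vanish x y od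

-- Theta series

ser-even : ∀ f → (∀ x → o x ≡ 1ℤ → f x ≡ 0ℤ) → ser Squares f ≈ dil (dil (ser Squares (λ y → f (y +ℤ y))))
ser-even f vanish n = begin
  ser Squares f n
    ≡⟨ sumE-split even? (enum Squares n) f ⟩
  sumE (filterE even? (enum Squares n)) f +ℤ sumE (filterE (¬? ∘ even?) (enum Squares n)) f
    ≡⟨ cong₂ _+ℤ_ evens odds ⟩
  ser (dilated (dilated Squares)) (λ y → f (y +ℤ y)) n +ℤ 0ℤ
    ≡⟨ ℤₚ.+-identityʳ _ ⟩
  ser (dilated (dilated Squares)) (λ y → f (y +ℤ y)) n
    ≡⟨ ser-dilated (dilated Squares) (λ y → f (y +ℤ y)) n ⟩
  dil (ser (dilated Squares) (λ y → f (y +ℤ y))) n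
    ≡⟨ dil-cong (ser-dilated Squares (λ y → f (y +ℤ y))) n ⟩
  dil (dil (ser Squares (λ y → f (y +ℤ y)))) n ∎
  where
  open ≡-Reasoning
  wt-double : ∀ y → wt Squares (y +ℤ y) ≡ wt (dilated (dilated Squares)) y
  wt-double y = ℤₚ.+-injective (trans (∣x∣²≡x² (y +ℤ y)) (trans (arith y) (cong (λ a → a +ℤ a +ℤ (a +ℤ a)) (sym (∣x∣²≡x² y)))))
    where
    arith : ∀ y → (y +ℤ y) *ℤ (y +ℤ y) ≡ y *ℤ y +ℤ y *ℤ y +ℤ (y *ℤ y +ℤ y *ℤ y)
    arith = ℤ-Ring.solve-∀
  evens : sumE (filterE even? (enum Squares n)) f ≡ ser (dilated (dilated Squares)) (λ y → f (y +ℤ y)) n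
  evens = sym (reindex (enum (dilated (dilated Squares)) n) (filterE even? (enum Squares n)) (λ y → y +ℤ y) half
    (λ y (_ , w) → ((_ , trans (wt-double y) w) , double-even y) , half-double y)
    (λ x ((_ , w) , ev) → (_ , trans (sym (wt-double (half x))) (trans (cong (wt Squares) ev) w)) , ev)
    (λ _ _ → refl))
  odds : sumE (filterE (¬? ∘ even?) (enum Squares n)) f ≡ 0ℤ
  odds = sumE-0 (filterE (¬? ∘ even?) (enum Squares n))
    (λ x (_ , ¬ev) → [ (λ ev → ⊥-elim (¬ev ev)) , vanish x ]′ (even⊎odd x))

-- In Jacobi's notation `θ` is θ₃(q), and `θo`, `θe`, `θs`, `θ₁′` are θ₂, θ₃, θ₄, θ₁′ at argument 0
-- and nome q⁴.
θ θo θe θs θ₁′ : Series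
θ = ser Squares (λ _ → 1ℤ)
θo = ser Squares o
θe = ser Squares e
θs = ser Squares σ
θ₁′ = ser Squares (λ x → ε x *ℤ x)

Squares² : Graded (ℤ × ℤ)
Squares² = Squares ⊗ Squares

ser² : (ℤ → ℤ) → (ℤ → ℤ) → Series
ser² f g = ser Squares² (λ xy → f (proj₁ xy) *ℤ g (proj₂ xy))

odd-series-0 : ∀ f → (∀ x → f x ≡ -ℤ f (-ℤ x)) → ser Squares f ≈ 𝟘
odd-series-0 f anti = ser-antisymmetric Squares -ℤ_
  (λ x _ → _ , cong (λ n → n * n) (ℤₚ.∣-i∣≡∣i∣ x) , ℤₚ.neg-involutive x) (λ x _ → anti x)

ε-odd : ∀ x → ε (-ℤ x) ≡ -ℤ ε x
ε-odd x = trans (cong ε′ (residue-neg x)) (by-cases₁ (λ i → ε′ (opposite i) ℤₚ.≟ -ℤ ε′ i) (residue x))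

ω-odd : ∀ x → ω (-ℤ x) ≡ -ℤ ω x
ω-odd x = trans (cong ω′ (residue-neg x)) (by-cases₁ (λ i → ω′ (opposite i) ℤₚ.≟ -ℤ ω′ i) (residue x))

θ-split : θ ≈ θe ⊞ θo
θ-split = ≈-trans (ser-cong Squares (λ x _ → sym (by-cases₁ (λ i → e′ i +ℤ o′ i ℤₚ.≟ 1ℤ) (residue x)))) (ser-⊞ Squares e o)

vanish-off-parity : (f g : Table) {_ : True (Finₚ.all? (λ i → Finₚ.all? (λ j → o′ (i ⊕ j) *ℤ (f i *ℤ g j) ℤₚ.≟ 0ℤ)))} →
  ∀ x y → o (x +ℤ y) ≡ 1ℤ → f (residue x) *ℤ g (residue y) ≡ 0ℤ
vanish-off-parity f g {t} x y odd-sum = begin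
  f (residue x) *ℤ g (residue y)                    ≡⟨ ℤₚ.*-identityˡ _ ⟨
  1ℤ *ℤ (f (residue x) *ℤ g (residue y))            ≡⟨ cong (_*ℤ (f (residue x) *ℤ g (residue y))) (trans (sym odd-sum) (table-+ o′ x y)) ⟩
  o′ (residue x ⊕ residue y) *ℤ (f (residue x) *ℤ g (residue y)) ≡⟨ by-cases₂ (λ i j → o′ (i ⊕ j) *ℤ (f i *ℤ g j) ℤₚ.≟ 0ℤ) {t} (residue x) (residue y) ⟩
  0ℤ                                                ∎
  where open ≡-Reasoning

module _ (f g a b c d : Table)
  {off-parity : True (Finₚ.all? (λ i → Finₚ.all? (λ j → o′ (i ⊕ j) *ℤ (f i *ℤ g j) ℤₚ.≟ 0ℤ)))}
  {addition : True (Finₚ.all? (λ i → Finₚ.all? (λ j → f (i ⊕ j) *ℤ g (i ⊕ opposite j) ℤₚ.≟ a i *ℤ b j +ℤ c i *ℤ d j)))} where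

  private
    ⟨_⟩ : Table → ℤ → ℤ
    ⟨ t ⟩ x = t (residue x)

  -- An addition law f(u + v) g(u - v) = a(u) b(v) + c(u) d(v) becomes, through the rotation, an
  -- identity between products of theta series. Its hypotheses are table checks, so an instance only
  -- names the six functions.
  table-rot : ser Squares ⟨ f ⟩ ⊛ ser Squares ⟨ g ⟩ ≈ dil (ser Squares ⟨ a ⟩ ⊛ ser Squares ⟨ b ⟩ ⊞ ser Squares ⟨ c ⟩ ⊛ ser Squares ⟨ d ⟩)
  table-rot = begin
    ser Squares ⟨ f ⟩ ⊛ ser Squares ⟨ g ⟩
      ≈⟨ ser-⊗ Squares Squares ⟨ f ⟩ ⟨ g ⟩ ⟨
    ser² ⟨ f ⟩ ⟨ g ⟩
      ≈⟨ ser-rot _ (vanish-off-parity f g {off-parity}) ⟩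
    dil (ser Squares² (λ uv → ⟨ f ⟩ (proj₁ uv +ℤ proj₂ uv) *ℤ ⟨ g ⟩ (proj₁ uv -ℤ proj₂ uv)))
      ≈⟨ dil-cong (ser-cong Squares² (λ (u , v) _ → trans (cong₂ _*ℤ_ (table-+ f u v) (table-- g u v))
           (by-cases₂ (λ i j → f (i ⊕ j) *ℤ g (i ⊕ opposite j) ℤₚ.≟ a i *ℤ b j +ℤ c i *ℤ d j) {addition} (residue u) (residue v)))) ⟩
    dil (ser Squares² (λ uv → ⟨ a ⟩ (proj₁ uv) *ℤ ⟨ b ⟩ (proj₂ uv) +ℤ ⟨ c ⟩ (proj₁ uv) *ℤ ⟨ d ⟩ (proj₂ uv)))
      ≈⟨ dil-cong (≈-trans (ser-⊞ Squares² _ _) (⊞-cong (ser-⊗ Squares Squares ⟨ a ⟩ ⟨ b ⟩) (ser-⊗ Squares Squares ⟨ c ⟩ ⟨ d ⟩))) ⟩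
    dil (ser Squares ⟨ a ⟩ ⊛ ser Squares ⟨ b ⟩ ⊞ ser Squares ⟨ c ⟩ ⊛ ser Squares ⟨ d ⟩) ∎
    where open SetoidReasoning seriesSetoid

1′ : Table
1′ _ = 1ℤ

-- Landen's θ₂(q)² = 2 θ₂(q²) θ₃(q²).
θo² : θo ⊛ θo ≈ dil (θo ⊛ θe ⊞ θe ⊛ θo)
θo² = table-rot o′ o′ o′ e′ e′ o′

θe² : θe ⊛ θe ≈ dil (θe ⊛ θe ⊞ θo ⊛ θo)
θe² = table-rot e′ e′ e′ e′ o′ o′

sine-0 : ser Squares ε ≈ 𝟘
sine-0 = odd-series-0 ε (λ x → sym (trans (cong -ℤ_ (ε-odd x)) (ℤₚ.neg-involutive _)))

-- θ₃(q) θ₄(q) = θ₄(q²)². This is the subtraction formula of the cosine; the sine product drops out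
-- because `ε` is odd.
θeθs : θe ⊛ θs ≈ dil (θs ⊛ θs)
θeθs = ≈-trans (table-rot e′ σ′ σ′ σ′ ε′ ε′)
  (dil-cong (λ n → trans (cong ((θs ⊛ θs) n +ℤ_) (⊛-zeroˡ (ser Squares ε) sine-0 n)) (ℤₚ.+-identityʳ _)))

-- θ₁′(q) θ₂(q) = 2 θ₁′(q²) θ₄(q²), from the addition formula of the sine with the extra factor u +
-- v. Of the four products that arise, the two whose sine carries no linear factor contain the
-- vanishing series of `ε`.
θ₁′θo : θ₁′ ⊛ θo ≈ dil (θ₁′ ⊛ θs ⊞ θs ⊛ θ₁′)
θ₁′θo = begin
  θ₁′ ⊛ θo
    ≈⟨ ser-⊗ Squares Squares (λ x → ε x *ℤ x) o ⟨
  ser² (λ x → ε x *ℤ x) o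
    ≈⟨ ser-rot _ (λ x y odd-sum → trans (arith₁ (ε x) x (o y)) (trans (cong (x *ℤ_) (vanish-off-parity ε′ o′ x y odd-sum)) (ℤₚ.*-zeroʳ x))) ⟩
  dil (ser Squares² (λ uv → ε (proj₁ uv +ℤ proj₂ uv) *ℤ (proj₁ uv +ℤ proj₂ uv) *ℤ o (proj₁ uv -ℤ proj₂ uv)))
    ≈⟨ dil-cong (ser-cong Squares² (λ (u , v) _ → expand u v)) ⟩
  dil (ser Squares² (λ uv → (ε (proj₁ uv) *ℤ proj₁ uv *ℤ σ (proj₂ uv) +ℤ ε (proj₁ uv) *ℤ (σ (proj₂ uv) *ℤ proj₂ uv))
                         +ℤ (σ (proj₁ uv) *ℤ (ε (proj₂ uv) *ℤ proj₂ uv) +ℤ σ (proj₁ uv) *ℤ proj₁ uv *ℤ ε (proj₂ uv))))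
    ≈⟨ dil-cong (≈-trans (ser-⊞ Squares² _ _) (⊞-cong (≈-trans (ser-⊞ Squares² _ _) (⊞-cong (ser-⊗ Squares Squares (λ x → ε x *ℤ x) σ) (ser-⊗ Squares Squares ε (λ x → σ x *ℤ x))))
         (≈-trans (ser-⊞ Squares² _ _) (⊞-cong (ser-⊗ Squares Squares σ (λ x → ε x *ℤ x)) (ser-⊗ Squares Squares (λ x → σ x *ℤ x) ε))))) ⟩
  dil ((θ₁′ ⊛ θs ⊞ ser Squares ε ⊛ Z) ⊞ (θs ⊛ θ₁′ ⊞ Z ⊛ ser Squares ε))
    ≈⟨ dil-cong (λ n → cong₂ (λ a b → (θ₁′ ⊛ θs) n +ℤ a +ℤ ((θs ⊛ θ₁′) n +ℤ b))
         (⊛-zeroˡ Z sine-0 n) (trans (⊛-comm Z (ser Squares ε) n) (⊛-zeroˡ Z sine-0 n))) ⟩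
  dil ((θ₁′ ⊛ θs ⊞ 𝟘) ⊞ (θs ⊛ θ₁′ ⊞ 𝟘))
    ≈⟨ dil-cong (⊞-cong (λ n → ℤₚ.+-identityʳ ((θ₁′ ⊛ θs) n)) (λ n → ℤₚ.+-identityʳ ((θs ⊛ θ₁′) n))) ⟩
  dil (θ₁′ ⊛ θs ⊞ θs ⊛ θ₁′) ∎
  where
  open SetoidReasoning seriesSetoid
  Z : Series
  Z = ser Squares (λ x → σ x *ℤ x)
  arith₁ : ∀ a x b → a *ℤ x *ℤ b ≡ x *ℤ (a *ℤ b)
  arith₁ = ℤ-Ring.solve-∀
  arith₂ : ∀ p q u v → (p +ℤ q) *ℤ (u +ℤ v) ≡ p *ℤ u +ℤ p *ℤ v +ℤ (q *ℤ v +ℤ q *ℤ u)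
  arith₂ = ℤ-Ring.solve-∀
  arith₃ : ∀ a b c d u v → a *ℤ b *ℤ u +ℤ a *ℤ b *ℤ v +ℤ (c *ℤ d *ℤ v +ℤ c *ℤ d *ℤ u)
    ≡ a *ℤ u *ℤ b +ℤ a *ℤ (b *ℤ v) +ℤ (c *ℤ (d *ℤ v) +ℤ c *ℤ u *ℤ d)
  arith₃ = ℤ-Ring.solve-∀
  absorb : ∀ u v → ε (u +ℤ v) *ℤ o (u -ℤ v) ≡ ε u *ℤ σ v +ℤ σ u *ℤ ε v
  absorb u v = trans (cong₂ _*ℤ_ (table-+ ε′ u v) (table-- o′ u v))
    (by-cases₂ (λ i j → ε′ (i ⊕ j) *ℤ o′ (i ⊕ opposite j) ℤₚ.≟ ε′ i *ℤ σ′ j +ℤ σ′ i *ℤ ε′ j) (residue u) (residue v))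
  expand : ∀ u v → ε (u +ℤ v) *ℤ (u +ℤ v) *ℤ o (u -ℤ v) ≡
    ε u *ℤ u *ℤ σ v +ℤ ε u *ℤ (σ v *ℤ v) +ℤ (σ u *ℤ (ε v *ℤ v) +ℤ σ u *ℤ u *ℤ ε v)
  expand u v = trans (trans (arith₁ (ε (u +ℤ v)) (u +ℤ v) (o (u -ℤ v))) (ℤₚ.*-comm (u +ℤ v) _)) (trans (cong (_*ℤ (u +ℤ v)) (absorb u v))
    (trans (arith₂ (ε u *ℤ σ v) (σ u *ℤ ε v) u v) (arith₃ (ε u) (σ v) (σ u) (ε v) u v)))

θe-dil : θe ≈ dil (dil θ)
θe-dil = ≈-trans (ser-even e (λ x p → trans (by-cases₁ (λ i → e′ i ℤₚ.≟ 1ℤ -ℤ o′ i) (residue x)) (cong (λ z → 1ℤ -ℤ z) p)))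
  (dil-cong (dil-cong (ser-cong Squares (λ y _ → trans (table-+ e′ y y) (by-cases₁ (λ i → e′ (i ⊕ i) ℤₚ.≟ 1ℤ) (residue y))))))

-- `e` and `σ` differ only at x ≡ 2 (mod 4), and there by 2; writing x = 2 y leaves odd y. This is
-- the identity that later isolates odd w.
θe-θs : θe ≈ θs ⊞ dil (dil (θo ⊞ θo))
θe-θs = begin
  θe
    ≈⟨ ser-cong Squares (λ x _ → arith (σ x) (e x)) ⟩
  ser Squares (λ x → σ x +ℤ (e x -ℤ σ x))
    ≈⟨ ser-⊞ Squares σ (λ x → e x -ℤ σ x) ⟩
  θs ⊞ ser Squares (λ x → e x -ℤ σ x)
    ≈⟨ ⊞-congˡ θs (ser-even (λ x → e x -ℤ σ x) (λ x p → trans (by-cases₁ (λ i → e′ i -ℤ σ′ i ℤₚ.≟ (1ℤ -ℤ o′ i) *ℤ (e′ i -ℤ σ′ i)) (residue x)) (cong (λ z → (1ℤ -ℤ z) *ℤ (e x -ℤ σ x)) p))) ⟩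
  θs ⊞ dil (dil (ser Squares (λ y → e (y +ℤ y) -ℤ σ (y +ℤ y))))
    ≈⟨ ⊞-congˡ θs (dil-cong (dil-cong (ser-cong Squares (λ y _ → trans (cong₂ _-ℤ_ (table-+ e′ y y) (table-+ σ′ y y)) (by-cases₁ (λ i → e′ (i ⊕ i) -ℤ σ′ (i ⊕ i) ℤₚ.≟ o′ i +ℤ o′ i) (residue y)))))) ⟩
  θs ⊞ dil (dil (ser Squares (λ y → o y +ℤ o y)))
    ≈⟨ ⊞-congˡ θs (dil-cong (dil-cong (ser-⊞ Squares o o))) ⟩
  θs ⊞ dil (dil (θo ⊞ θo)) ∎
  where
  open SetoidReasoning seriesSetoid
  arith : ∀ a b → b ≡ a +ℤ (b -ℤ a)
  arith = ℤ-Ring.solve-∀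

-- Liouville's identities for a x + b y = n

Factorisations : Graded (ℕ × ℕ)
Factorisations .Ok (d , e) = 0 < d × 0 < e
Factorisations .wt (d , e) = d * e
Factorisations .enum n = relabel
  (λ (d , e) (_ , p) → p)
  (λ (d , e) ((d>0 , e>0) , w) →
    (s≤s (subst (d ≤_) w (ℕₚ.m≤m*n d e {{>-nonZero e>0}})) , s≤s (subst (e ≤_) w (ℕₚ.m≤n*m e d {{>-nonZero d>0}}))) , (d>0 , e>0) , w)
  (filterE (λ (d , e) → (0 ℕₚ.<? d ×-dec 0 ℕₚ.<? e) ×-dec d * e ℕₚ.≟ n) (pairE (upToE (suc n)) (λ _ → upToE (suc n))))

Positive : ℕ → ℕ × ℕ → Set
Positive n (x , y) = x + y ≡ n × 0 < x × 0 < y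

positive? : Decidable (λ (xy : ℕ × ℕ) → 0 < proj₁ xy × 0 < proj₂ xy)
positive? (x , y) = 0 ℕₚ.<? x ×-dec 0 ℕₚ.<? y

compositions : ∀ n → Enum (Positive n)
compositions n = filterE positive? (antidiagonal n)

-- The inner sum left on the diagonals a = b and x = y of a x + b y = n.
conv : (ℤ → ℤ) → (ℤ → ℤ) → ℕ → ℤ
conv φ ψ n = sumE (compositions n) (λ xy → φ (+ proj₁ xy) *ℤ ψ (+ proj₂ xy))

Quad : Set
Quad = (ℕ × ℕ) × (ℕ × ℕ)

Quads : Graded Quad
Quads = Factorisations ⊗ Factorisations

sumE-filter : {A : Set} {P Q R : A → Set} (Q? : Decidable Q) (R? : Decidable R) → (∀ a → R a → ¬ Q a) → (E : Enum P) (f : A → ℤ) →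
  sumE (filterE R? (filterE (¬? ∘ Q?) E)) f ≡ sumE (filterE R? E) f
sumE-filter Q? R? R⇒¬Q E f = reindex (filterE R? (filterE (¬? ∘ Q?) E)) (filterE R? E) id id
  (λ a ((p , _) , r) → (p , r) , refl) (λ a (p , r) → ((p , R⇒¬Q a r) , r) , refl) (λ _ _ → refl)

module _ {A : Set} {P : A → Set} (l r : A → ℕ) (E : Enum P) where
  below diagonal above : Enum _
  below = filterE (λ a → l a ℕₚ.<? r a) E
  diagonal = filterE (λ a → l a ℕₚ.≟ r a) E
  above = filterE (λ a → r a ℕₚ.<? l a) E

  sumE-trichotomy : ∀ f → sumE E f ≡ sumE below f +ℤ (sumE diagonal f +ℤ sumE above f)
  sumE-trichotomy f = trans (sumE-split (λ a → l a ℕₚ.<? r a) E f) (cong (sumE below f +ℤ_) (begin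
    sumE not-below f
      ≡⟨ sumE-split (λ a → l a ℕₚ.≟ r a) not-below f ⟩
    sumE (filterE (λ a → l a ℕₚ.≟ r a) not-below) f +ℤ sumE (filterE (λ a → ¬? (l a ℕₚ.≟ r a)) not-below) f
      ≡⟨ cong₂ _+ℤ_ (sumE-filter (λ a → l a ℕₚ.<? r a) (λ a → l a ℕₚ.≟ r a) (λ _ → ℕₚ.<-irrefl) E f)
           (reindex (filterE (λ a → ¬? (l a ℕₚ.≟ r a)) not-below) above id id
             (λ a ((p , ≮) , ≢) → (p , ℕₚ.≤∧≢⇒< (ℕₚ.≮⇒≥ ≮) (≢ ∘ sym)) , refl)
             (λ a (p , r<l) → ((p , ℕₚ.<-asym r<l) , λ eq → ℕₚ.<-irrefl (sym eq) r<l) , refl)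
             (λ _ _ → refl)) ⟩
    sumE diagonal f +ℤ sumE above f ∎))
    where
    open ≡-Reasoning
    not-below = filterE (λ a → ¬? (l a ℕₚ.<? r a)) E

-- ((a , x) , (b , y)) encodes a x + (a + b) y = a (x + y) + b y; reading it as a point of Quads in the two
-- ways, and swapping the factors, gives the four regions a < b, b < a, y < x and x < y of Quads.
Sheared : ℕ → Quad → Set
Sheared n ((a , x) , (b , y)) = ((0 < a × 0 < x) × (0 < b × 0 < y)) × a * x + (a + b) * y ≡ n

fstL fstR sndL sndR : Quad → ℕ
fstL ((a , x) , (b , y)) = a
sndL ((a , x) , (b , y)) = x
fstR ((a , x) , (b , y)) = b
sndR ((a , x) , (b , y)) = y

private
  +>0 : ∀ {a} b → 0 < a → 0 < a + b
  +>0 b (s≤s _) = s≤s z≤n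
  a<a+b : ∀ a {b} → 0 < b → a < a + b
  a<a+b a {suc b} _ = ℕₚ.m<m+n a (s≤s z≤n)

sheared : ∀ n → Enum (Sheared n)
sheared n = mapE (λ ((a , x) , (b , y)) → (a , x) , (b ∸ a , y)) (λ ((a , x) , (b , y)) → (a , x) , (a + b , y))
  (λ where ((a , x) , (b , y)) ((((a>0 , x>0) , (b>0 , y>0)) , w) , a<b) →
             let eq = ℕₚ.m+[n∸m]≡n (ℕₚ.<⇒≤ a<b) in
             (((a>0 , x>0) , (ℕₚ.m<n⇒0<n∸m a<b , y>0)) , trans (cong (λ c → a * x + c * y) eq) w) , cong (λ c → (a , x) , (c , y)) eq)
  (λ where ((a , x) , (b , y)) (((a>0 , x>0) , (b>0 , y>0)) , w) →
             ((((a>0 , x>0) , (+>0 b a>0 , y>0)) , w) , a<a+b a b>0) , cong (λ c → (a , x) , (c , y)) (ℕₚ.m+n∸m≡n a b))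
  (below fstL fstR (enum Quads n))

module _ (F : Quad → ℤ) (n : ℕ) where
  private
    Q = enum Quads n

  shear-a<b : sumE (below fstL fstR Q) F ≡ sumE (sheared n) (λ ((a , x) , (b , y)) → F ((a , x) , (a + b , y)))
  shear-a<b = sym (reindex (sheared n) (below fstL fstR Q) (λ ((a , x) , (b , y)) → (a , x) , (a + b , y)) (λ ((a , x) , (b , y)) → (a , x) , (b ∸ a , y))
    (λ where ((a , x) , (b , y)) (((a>0 , x>0) , (b>0 , y>0)) , w) →
               ((((a>0 , x>0) , (+>0 b a>0 , y>0)) , w) , a<a+b a b>0) , cong (λ c → (a , x) , (c , y)) (ℕₚ.m+n∸m≡n a b))
    (λ where ((a , x) , (b , y)) ((((a>0 , x>0) , (b>0 , y>0)) , w) , a<b) →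
               let eq = ℕₚ.m+[n∸m]≡n (ℕₚ.<⇒≤ a<b) in
               (((a>0 , x>0) , (ℕₚ.m<n⇒0<n∸m a<b , y>0)) , trans (cong (λ c → a * x + c * y) eq) w) , cong (λ c → (a , x) , (c , y)) eq)
    (λ _ _ → refl))

  shear-b<a : sumE (above fstL fstR Q) F ≡ sumE (sheared n) (λ ((a , x) , (b , y)) → F ((a + b , y) , (a , x)))
  shear-b<a = sym (reindex (sheared n) (above fstL fstR Q) (λ ((a , x) , (b , y)) → (a + b , y) , (a , x)) (λ ((b , y) , (a , x)) → (a , x) , (b ∸ a , y))
    (λ where ((a , x) , (b , y)) (((a>0 , x>0) , (b>0 , y>0)) , w) →
               ((((+>0 b a>0 , y>0) , (a>0 , x>0)) , trans (ℕₚ.+-comm ((a + b) * y) (a * x)) w) , a<a+b a b>0) , cong (λ c → (a , x) , (c , y)) (ℕₚ.m+n∸m≡n a b))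
    (λ where ((b , y) , (a , x)) ((((b>0 , y>0) , (a>0 , x>0)) , w) , a<b) →
               let eq = ℕₚ.m+[n∸m]≡n (ℕₚ.<⇒≤ a<b) in
               (((a>0 , x>0) , (ℕₚ.m<n⇒0<n∸m a<b , y>0)) , trans (cong (λ c → a * x + c * y) eq) (trans (ℕₚ.+-comm (a * x) (b * y)) w)) , cong (λ c → (c , y) , (a , x)) eq)
    (λ _ _ → refl))

  shear-y<x : sumE (above sndL sndR Q) F ≡ sumE (sheared n) (λ ((a , x) , (b , y)) → F ((a , x + y) , (b , y)))
  shear-y<x = sym (reindex (sheared n) (above sndL sndR Q) (λ ((a , x) , (b , y)) → (a , x + y) , (b , y)) (λ ((a , x) , (b , y)) → (a , x ∸ y) , (b , y))
    (λ where ((a , x) , (b , y)) (((a>0 , x>0) , (b>0 , y>0)) , w) →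
               ((((a>0 , +>0 y x>0) , (b>0 , y>0)) , trans (arith a x b y) w) , subst (y <_) (ℕₚ.+-comm y x) (a<a+b y x>0)) , cong (λ c → (a , c) , (b , y)) (ℕₚ.m+n∸n≡m x y))
    (λ where ((a , x) , (b , y)) ((((a>0 , x>0) , (b>0 , y>0)) , w) , y<x) →
               let eq = ℕₚ.m∸n+n≡m (ℕₚ.<⇒≤ y<x) in
               (((a>0 , ℕₚ.m<n⇒0<n∸m y<x) , (b>0 , y>0)) , trans (sym (arith a (x ∸ y) b y)) (trans (cong (λ c → a * c + b * y) eq) w)) , cong (λ c → (a , c) , (b , y)) eq)
    (λ _ _ → refl))
    where
    arith : ∀ a x b y → a * (x + y) + b * y ≡ a * x + (a + b) * y
    arith = ℕ-Ring.solve-∀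

  shear-x<y : sumE (below sndL sndR Q) F ≡ sumE (sheared n) (λ ((a , x) , (b , y)) → F ((b , y) , (a , x + y)))
  shear-x<y = sym (reindex (sheared n) (below sndL sndR Q) (λ ((a , x) , (b , y)) → (b , y) , (a , x + y)) (λ ((b , y) , (a , x)) → (a , x ∸ y) , (b , y))
    (λ where ((a , x) , (b , y)) (((a>0 , x>0) , (b>0 , y>0)) , w) →
               ((((b>0 , y>0) , (a>0 , +>0 y x>0)) , trans (arith a x b y) w) , subst (y <_) (ℕₚ.+-comm y x) (a<a+b y x>0)) , cong (λ c → (a , c) , (b , y)) (ℕₚ.m+n∸n≡m x y))
    (λ where ((b , y) , (a , x)) ((((b>0 , y>0) , (a>0 , x>0)) , w) , y<x) →
               let eq = ℕₚ.m∸n+n≡m (ℕₚ.<⇒≤ y<x) in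
               (((a>0 , ℕₚ.m<n⇒0<n∸m y<x) , (b>0 , y>0)) , trans (sym (arith a (x ∸ y) b y)) (trans (cong (λ c → b * y + a * c) eq) w)) , cong (λ c → (b , y) , (a , c)) eq)
    (λ _ _ → refl))
    where
    arith : ∀ a x b y → b * y + a * (x + y) ≡ a * x + (a + b) * y
    arith = ℕ-Ring.solve-∀

  -- For a = b = d the form is d (x + y), so a diagonal point is a factorisation n = d e with a
  -- composition e = x + y.
  diagonal-a≡b : sumE (diagonal fstL fstR Q) F ≡ ser Factorisations (λ (d , e) → sumE (compositions e) (λ (x , y) → F ((d , x) , (d , y)))) n
  diagonal-a≡b = trans (sym (reindex (pairE (enum Factorisations n) (λ (d , e) → compositions e)) (diagonal fstL fstR Q)
    (λ ((d , e) , (x , y)) → (d , x) , (d , y)) (λ ((a , x) , (b , y)) → (a , x + y) , (x , y))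
    (λ where ((d , _) , (x , y)) (((d>0 , e>0) , w) , (refl , x>0 , y>0)) →
               ((((d>0 , x>0) , (d>0 , y>0)) , trans (sym (ℕₚ.*-distribˡ-+ d x y)) w) , refl) , refl)
    (λ where ((a , x) , (b , y)) ((((a>0 , x>0) , (b>0 , y>0)) , w) , refl) →
               (((a>0 , +>0 y x>0) , trans (ℕₚ.*-distribˡ-+ a x y) w) , (refl , x>0 , y>0)) , refl)
    (λ _ _ → refl))) (sumE-pair (enum Factorisations n) (λ (d , e) → compositions e) _)

  diagonal-x≡y : sumE (diagonal sndL sndR Q) F ≡ ser Factorisations (λ (d , e) → sumE (compositions e) (λ (a , b) → F ((a , d) , (b , d)))) n
  diagonal-x≡y = trans (sym (reindex (pairE (enum Factorisations n) (λ (d , e) → compositions e)) (diagonal sndL sndR Q)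
    (λ ((d , e) , (a , b)) → (a , d) , (b , d)) (λ ((a , x) , (b , y)) → (x , a + b) , (a , b))
    (λ where ((d , _) , (a , b)) (((d>0 , e>0) , w) , (refl , a>0 , b>0)) →
               ((((a>0 , d>0) , (b>0 , d>0)) , trans (arith a b d) w) , refl) , refl)
    (λ where ((a , x) , (b , y)) ((((a>0 , x>0) , (b>0 , y>0)) , w) , refl) →
               (((x>0 , +>0 b a>0) , trans (sym (arith a b x)) w) , (refl , a>0 , b>0)) , refl)
    (λ _ _ → refl))) (sumE-pair (enum Factorisations n) (λ (d , e) → compositions e) _)
    where
    arith : ∀ a b d → a * d + b * d ≡ d * (a + b)
    arith = ℕ-Ring.solve-∀

one : ℤ → ℤ
one _ = 1ℤ

module Liouville (α β γ κ : ℤ → ℤ) (α-odd : ∀ x → α (-ℤ x) ≡ -ℤ α x) (β-odd : ∀ x → β (-ℤ x) ≡ -ℤ β x)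
  (γ-step : ∀ x y → γ (x +ℤ (y +ℤ y)) ≡ γ x) (κ-step : ∀ x y → κ (x +ℤ (y +ℤ y)) ≡ κ x) where

  -- Up to sign, `Y` and `Z` are `M` composed with shears that preserve a x + b y: they replace (b ,
  -- x) by (b ∓ a , x ± y), respectively (a , y) by (a ∓ b , y ± x). The functions `γ` and `κ`
  -- depend on parity only and do not distinguish x + y from x - y.
  M Y⁻ Y⁺ Z⁻ Z⁺ : Quad → ℤ
  M ((a , x) , (b , y)) = α (+ a) *ℤ β (+ b) *ℤ γ (+ x) *ℤ κ (+ y)
  Y⁻ ((a , x) , (b , y)) = α (+ a) *ℤ β (+ a -ℤ + b) *ℤ γ (+ x +ℤ + y) *ℤ κ (+ y)
  Y⁺ ((a , x) , (b , y)) = α (+ a) *ℤ β (+ a +ℤ + b) *ℤ γ (+ x +ℤ + y) *ℤ κ (+ y)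
  Z⁻ ((a , x) , (b , y)) = α (+ b -ℤ + a) *ℤ β (+ b) *ℤ γ (+ x) *ℤ κ (+ x +ℤ + y)
  Z⁺ ((a , x) , (b , y)) = α (+ b +ℤ + a) *ℤ β (+ b) *ℤ γ (+ x) *ℤ κ (+ x +ℤ + y)

  -- The diagonal contributions: a = b and x = y in `M`, then x = y in `Y⁺` and in `Z⁺`. The values
  -- at 0 arise from x + y = 2 d.
  D : ℕ × ℕ → ℤ
  D (d , e) = α (+ d) *ℤ β (+ d) *ℤ conv γ κ e +ℤ γ (+ d) *ℤ κ (+ d) *ℤ conv α β e
    -ℤ γ 0ℤ *ℤ (κ (+ d) *ℤ (β (+ e) *ℤ conv α one e)) -ℤ κ 0ℤ *ℤ (γ (+ d) *ℤ (α (+ e) *ℤ conv one β e))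

  private
    ∸-+ : ∀ a b → a +ℤ b -ℤ a ≡ b
    ∸-+ = ℤ-Ring.solve-∀

    neg-∸-+ : ∀ a b → a -ℤ (a +ℤ b) ≡ -ℤ b
    neg-∸-+ = ℤ-Ring.solve-∀

    next-next : ∀ x y → y +ℤ (x +ℤ y) ≡ x +ℤ (y +ℤ y)
    next-next = ℤ-Ring.solve-∀

    next-next′ : ∀ x y → x +ℤ y +ℤ y ≡ x +ℤ (y +ℤ y)
    next-next′ = ℤ-Ring.solve-∀

    γ-shift : ∀ x y → γ (y +ℤ (x +ℤ y)) ≡ γ x
    γ-shift x y = trans (cong γ (next-next x y)) (γ-step x y)

    γ-shift′ : ∀ x y → γ (x +ℤ y +ℤ y) ≡ γ x
    γ-shift′ x y = trans (cong γ (next-next′ x y)) (γ-step x y)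

    κ-shift : ∀ x y → κ (y +ℤ (x +ℤ y)) ≡ κ x
    κ-shift x y = trans (cong κ (next-next x y)) (κ-step x y)

    κ-shift′ : ∀ x y → κ (x +ℤ y +ℤ y) ≡ κ x
    κ-shift′ x y = trans (cong κ (next-next′ x y)) (κ-step x y)

    neg-front : ∀ u p q r → u *ℤ -ℤ p *ℤ q *ℤ r ≡ -[1+ 0 ] *ℤ (u *ℤ p *ℤ q *ℤ r)
    neg-front = ℤ-Ring.solve-∀

    neg-front′ : ∀ p u q r → -ℤ p *ℤ u *ℤ q *ℤ r ≡ -[1+ 0 ] *ℤ (p *ℤ u *ℤ q *ℤ r)
    neg-front′ = ℤ-Ring.solve-∀

    odd-at-0 : ∀ (f : ℤ → ℤ) → (∀ x → f (-ℤ x) ≡ -ℤ f x) → f 0ℤ ≡ 0ℤ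
    odd-at-0 f f-odd = self-neg⇒0 (f-odd 0ℤ)

  module _ (n : ℕ) where
    private
      Q = enum Quads n
      K = sheared n

      neg-sum : ∀ (f : Quad → ℤ) → sumE K (λ q → -[1+ 0 ] *ℤ f q) ≡ -ℤ sumE K f
      neg-sum f = trans (∑-* -[1+ 0 ] f (elems K)) (ℤₚ.-1*i≡-i _)

      Z⁻-a<b : sumE (below fstL fstR Q) Z⁻ ≡ sumE (below sndL sndR Q) Y⁺
      Z⁻-a<b = trans (shear-a<b Z⁻ n) (trans (sumE-cong K (λ ((a , x) , (b , y)) _ →
        cong₂ (λ p q → p *ℤ β (+ a +ℤ + b) *ℤ q *ℤ κ (+ x +ℤ + y)) (cong α (∸-+ (+ a) (+ b))) (sym (γ-shift (+ x) (+ y)))))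
        (trans (sumE-cong K (λ ((a , x) , (b , y)) _ → cong (λ s → α (+ b) *ℤ β s *ℤ γ (+ y +ℤ (+ x +ℤ + y)) *ℤ κ (+ x +ℤ + y)) (ℤₚ.+-comm (+ a) (+ b))))
        (sym (shear-x<y Y⁺ n))))

      Z⁻-b<a : sumE (above fstL fstR Q) Z⁻ ≡ -ℤ sumE (below sndL sndR Q) M
      Z⁻-b<a = trans (shear-b<a Z⁻ n) (trans (sumE-cong K (λ ((a , x) , (b , y)) _ →
        trans (cong₂ (λ p q → p *ℤ β (+ a) *ℤ γ (+ y) *ℤ κ q) (trans (cong α (neg-∸-+ (+ a) (+ b))) (α-odd (+ b))) (ℤₚ.+-comm (+ y) (+ x)))
          (neg-front′ (α (+ b)) (β (+ a)) (γ (+ y)) (κ (+ x +ℤ + y)))))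
        (trans (neg-sum (λ ((a , x) , (b , y)) → M ((b , y) , (a , x + y)))) (cong -ℤ_ (sym (shear-x<y M n)))))

      Z⁺-y<x : sumE (above sndL sndR Q) Z⁺ ≡ sumE (above fstL fstR Q) Y⁻
      Z⁺-y<x = trans (shear-y<x Z⁺ n) (trans (sumE-cong K (λ ((a , x) , (b , y)) _ →
        cong₂ (λ p q → p *ℤ q) (cong₂ (λ p q → α p *ℤ β (+ b) *ℤ γ q) (ℤₚ.+-comm (+ b) (+ a)) (ℤₚ.+-comm (+ x) (+ y))) (κ-shift′ (+ x) (+ y))))
        (trans (sumE-cong K (λ ((a , x) , (b , y)) _ → cong (λ p → α (+ a +ℤ + b) *ℤ β p *ℤ γ (+ y +ℤ + x) *ℤ κ (+ x)) (sym (∸-+ (+ a) (+ b)))))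
        (sym (shear-b<a Y⁻ n))))

      Z⁺-x<y : sumE (below sndL sndR Q) Z⁺ ≡ sumE (above fstL fstR Q) M
      Z⁺-x<y = trans (shear-x<y Z⁺ n) (trans (sumE-cong K (λ ((a , x) , (b , y)) _ →
        cong (λ q → α (+ a +ℤ + b) *ℤ β (+ a) *ℤ γ (+ y) *ℤ q) (κ-shift (+ x) (+ y))))
        (sym (shear-b<a M n)))

      Y⁻-a<b : sumE (below fstL fstR Q) Y⁻ ≡ -ℤ sumE (above sndL sndR Q) M
      Y⁻-a<b = trans (shear-a<b Y⁻ n) (trans (sumE-cong K (λ ((a , x) , (b , y)) _ →
        trans (cong (λ p → α (+ a) *ℤ p *ℤ γ (+ x +ℤ + y) *ℤ κ (+ y)) (trans (cong β (neg-∸-+ (+ a) (+ b))) (β-odd (+ b))))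
          (neg-front (α (+ a)) (β (+ b)) (γ (+ x +ℤ + y)) (κ (+ y)))))
        (trans (neg-sum (λ ((a , x) , (b , y)) → M ((a , x + y) , (b , y)))) (cong -ℤ_ (sym (shear-y<x M n)))))

      Y⁺-y<x : sumE (above sndL sndR Q) Y⁺ ≡ sumE (below fstL fstR Q) M
      Y⁺-y<x = trans (shear-y<x Y⁺ n) (trans (sumE-cong K (λ ((a , x) , (b , y)) _ →
        cong (λ q → α (+ a) *ℤ β (+ a +ℤ + b) *ℤ q *ℤ κ (+ y)) (γ-shift′ (+ x) (+ y))))
        (sym (shear-a<b M n)))

      Y⁻-a≡b : sumE (diagonal fstL fstR Q) Y⁻ ≡ 0ℤ
      Y⁻-a≡b = sumE-0 (diagonal fstL fstR Q) (λ where
        ((a , x) , (b , y)) (_ , refl) →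
          trans (cong (λ p → α (+ a) *ℤ p *ℤ γ (+ x +ℤ + y) *ℤ κ (+ y)) (trans (cong β (ℤₚ.+-inverseʳ (+ a))) (odd-at-0 β β-odd)))
            (arith (α (+ a)) (γ (+ x +ℤ + y)) (κ (+ y))))
        where
        arith : ∀ p q r → p *ℤ 0ℤ *ℤ q *ℤ r ≡ 0ℤ
        arith = ℤ-Ring.solve-∀

      Z⁻-a≡b : sumE (diagonal fstL fstR Q) Z⁻ ≡ 0ℤ
      Z⁻-a≡b = sumE-0 (diagonal fstL fstR Q) (λ where
        ((a , x) , (b , y)) (_ , refl) →
          trans (cong (λ p → p *ℤ β (+ b) *ℤ γ (+ x) *ℤ κ (+ x +ℤ + y)) (trans (cong α (ℤₚ.+-inverseʳ (+ a))) (odd-at-0 α α-odd)))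
            (arith (β (+ b)) (γ (+ x)) (κ (+ x +ℤ + y))))
        where
        arith : ∀ p q r → 0ℤ *ℤ p *ℤ q *ℤ r ≡ 0ℤ
        arith = ℤ-Ring.solve-∀

      M₁ M₂ Y₂ Z₂ : ℕ × ℕ → ℤ
      M₁ (d , e) = α (+ d) *ℤ β (+ d) *ℤ conv γ κ e
      M₂ (d , e) = γ (+ d) *ℤ κ (+ d) *ℤ conv α β e
      Y₂ (d , e) = γ 0ℤ *ℤ (κ (+ d) *ℤ (β (+ e) *ℤ conv α one e))
      Z₂ (d , e) = κ 0ℤ *ℤ (γ (+ d) *ℤ (α (+ e) *ℤ conv one β e))

      M-a≡b : sumE (diagonal fstL fstR Q) M ≡ ser Factorisations M₁ n
      M-a≡b = trans (diagonal-a≡b M n) (ser-cong Factorisations (λ (d , e) _ → trans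
        (∑-cong (elems (compositions e)) (λ {xy} _ → ℤₚ.*-assoc (α (+ d) *ℤ β (+ d)) (γ (+ proj₁ xy)) (κ (+ proj₂ xy))))
        (∑-* (α (+ d) *ℤ β (+ d)) (λ xy → γ (+ proj₁ xy) *ℤ κ (+ proj₂ xy)) (elems (compositions e)))) n)

      M-x≡y : sumE (diagonal sndL sndR Q) M ≡ ser Factorisations M₂ n
      M-x≡y = trans (diagonal-x≡y M n) (ser-cong Factorisations (λ (d , e) _ → trans
        (∑-cong (elems (compositions e)) (λ {ab} _ → arith (α (+ proj₁ ab)) (β (+ proj₂ ab)) (γ (+ d)) (κ (+ d))))
        (∑-* (γ (+ d) *ℤ κ (+ d)) (λ ab → α (+ proj₁ ab) *ℤ β (+ proj₂ ab)) (elems (compositions e)))) n)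
        where
        arith : ∀ p q r s → p *ℤ q *ℤ r *ℤ s ≡ r *ℤ s *ℤ (p *ℤ q)
        arith = ℤ-Ring.solve-∀

      γ-double : ∀ x → γ (x +ℤ x) ≡ γ 0ℤ
      γ-double x = trans (cong γ (sym (ℤₚ.+-identityˡ (x +ℤ x)))) (γ-step 0ℤ x)

      κ-double : ∀ x → κ (x +ℤ x) ≡ κ 0ℤ
      κ-double x = trans (cong κ (sym (ℤₚ.+-identityˡ (x +ℤ x)))) (κ-step 0ℤ x)

      regroup : ∀ g k b (f : ℕ × ℕ → ℤ) (E : List (ℕ × ℕ)) → ∑ (λ ab → g *ℤ (k *ℤ (b *ℤ f ab))) E ≡ g *ℤ (k *ℤ (b *ℤ ∑ f E))
      regroup g k b f E = trans (∑-* g (λ ab → k *ℤ (b *ℤ f ab)) E) (cong (g *ℤ_) (trans (∑-* k (λ ab → b *ℤ f ab) E) (cong (k *ℤ_) (∑-* b f E))))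

      Y⁺-x≡y : sumE (diagonal sndL sndR Q) Y⁺ ≡ ser Factorisations Y₂ n
      Y⁺-x≡y = trans (diagonal-x≡y Y⁺ n) (ser-cong Factorisations (λ (d , e) _ → trans
        (sumE-cong (compositions e) (λ where
          (a , b) (refl , _) →
            trans (cong (λ g → α (+ a) *ℤ β (+ a +ℤ + b) *ℤ g *ℤ κ (+ d)) (γ-double (+ d)))
              (arith (α (+ a)) (β (+ a +ℤ + b)) (γ 0ℤ) (κ (+ d)))))
        (regroup (γ 0ℤ) (κ (+ d)) (β (+ e)) (λ ab → α (+ proj₁ ab) *ℤ 1ℤ) (elems (compositions e)))) n)
        where
        arith : ∀ p q r s → p *ℤ q *ℤ r *ℤ s ≡ r *ℤ (s *ℤ (q *ℤ (p *ℤ 1ℤ)))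
        arith = ℤ-Ring.solve-∀

      Z⁺-x≡y : sumE (diagonal sndL sndR Q) Z⁺ ≡ ser Factorisations Z₂ n
      Z⁺-x≡y = trans (diagonal-x≡y Z⁺ n) (ser-cong Factorisations (λ (d , e) _ → trans
        (sumE-cong (compositions e) (λ where
          (a , b) (refl , _) →
            trans (cong₂ (λ p g → α p *ℤ β (+ b) *ℤ γ (+ d) *ℤ g) (ℤₚ.+-comm (+ b) (+ a)) (κ-double (+ d)))
              (arith (α (+ a +ℤ + b)) (β (+ b)) (γ (+ d)) (κ 0ℤ))))
        (regroup (κ 0ℤ) (γ (+ d)) (α (+ e)) (λ ab → 1ℤ *ℤ β (+ proj₂ ab)) (elems (compositions e)))) n)
        where
        arith : ∀ p q r s → p *ℤ q *ℤ r *ℤ s ≡ s *ℤ (r *ℤ (p *ℤ (1ℤ *ℤ q)))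
        arith = ℤ-Ring.solve-∀

      D-sum : ser Factorisations D n ≡ ser Factorisations M₁ n +ℤ ser Factorisations M₂ n -ℤ ser Factorisations Y₂ n -ℤ ser Factorisations Z₂ n
      D-sum = begin
        ser Factorisations D n
          ≡⟨ ser-cong Factorisations (λ p _ → arith (M₁ p) (M₂ p) (Y₂ p) (Z₂ p)) n ⟩
        ser Factorisations (λ p → M₁ p +ℤ M₂ p +ℤ -[1+ 0 ] *ℤ (Y₂ p +ℤ Z₂ p)) n
          ≡⟨ trans (ser-⊞ Factorisations (λ p → M₁ p +ℤ M₂ p) (λ p → -[1+ 0 ] *ℤ (Y₂ p +ℤ Z₂ p)) n)
               (cong₂ _+ℤ_ (ser-⊞ Factorisations M₁ M₂ n)
                 (trans (ser-scale Factorisations -[1+ 0 ] (λ p → Y₂ p +ℤ Z₂ p) n) (cong (-[1+ 0 ] *ℤ_) (ser-⊞ Factorisations Y₂ Z₂ n)))) ⟩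
        ser Factorisations M₁ n +ℤ ser Factorisations M₂ n +ℤ -[1+ 0 ] *ℤ (ser Factorisations Y₂ n +ℤ ser Factorisations Z₂ n)
          ≡⟨ arith (ser Factorisations M₁ n) (ser Factorisations M₂ n) (ser Factorisations Y₂ n) (ser Factorisations Z₂ n) ⟨
        ser Factorisations M₁ n +ℤ ser Factorisations M₂ n -ℤ ser Factorisations Y₂ n -ℤ ser Factorisations Z₂ n ∎
        where
        open ≡-Reasoning
        arith : ∀ a b c d → a +ℤ b -ℤ c -ℤ d ≡ a +ℤ b +ℤ -[1+ 0 ] *ℤ (c +ℤ d)
        arith = ℤ-Ring.solve-∀

    -- One copy of `M` is cut along a = b, the other along x = y. The shears identify the four
    -- pieces off the diagonals with pieces of `Y` and `Z`, with signs from the oddness of `α` and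
    -- `β`; the remaining pieces of `Y` and `Z` match one another. Only diagonals survive.
    liouville : ser Quads M n +ℤ ser Quads M n +ℤ (ser Quads Y⁻ n -ℤ ser Quads Y⁺ n) +ℤ (ser Quads Z⁻ n -ℤ ser Quads Z⁺ n)
      ≡ ser Factorisations D n
    liouville = trans (combine
        (sumE (below fstL fstR Q) M) (sumE (above fstL fstR Q) M) (sumE (below sndL sndR Q) M) (sumE (above sndL sndR Q) M)
        (sumE (above fstL fstR Q) Y⁻) (sumE (below sndL sndR Q) Y⁺)
        (ser Factorisations M₁ n) (ser Factorisations M₂ n) (ser Factorisations Y₂ n) (ser Factorisations Z₂ n)
        (trans (sumE-trichotomy fstL fstR Q M) (cong (λ z → sumE (below fstL fstR Q) M +ℤ (z +ℤ sumE (above fstL fstR Q) M)) M-a≡b))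
        (trans (sumE-trichotomy sndL sndR Q M) (cong (λ z → sumE (below sndL sndR Q) M +ℤ (z +ℤ sumE (above sndL sndR Q) M)) M-x≡y))
        (trans (sumE-trichotomy fstL fstR Q Y⁻) (cong₂ (λ u v → u +ℤ (v +ℤ sumE (above fstL fstR Q) Y⁻)) Y⁻-a<b Y⁻-a≡b))
        (trans (sumE-trichotomy sndL sndR Q Y⁺) (cong₂ (λ u v → sumE (below sndL sndR Q) Y⁺ +ℤ (u +ℤ v)) Y⁺-x≡y Y⁺-y<x))
        (trans (sumE-trichotomy fstL fstR Q Z⁻) (cong₂ _+ℤ_ Z⁻-a<b (cong₂ _+ℤ_ Z⁻-a≡b Z⁻-b<a)))
        (trans (sumE-trichotomy sndL sndR Q Z⁺) (cong₂ _+ℤ_ Z⁺-x<y (cong₂ _+ℤ_ Z⁺-x≡y Z⁺-y<x))))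
      (sym D-sum)
      where
      arith : ∀ p q r s u v m₁ m₂ y₂ z₂ →
        p +ℤ (m₁ +ℤ q) +ℤ (r +ℤ (m₂ +ℤ s)) +ℤ (-ℤ s +ℤ (0ℤ +ℤ u) -ℤ (v +ℤ (y₂ +ℤ p))) +ℤ (v +ℤ (0ℤ +ℤ -ℤ r) -ℤ (q +ℤ (z₂ +ℤ u)))
        ≡ m₁ +ℤ m₂ -ℤ y₂ -ℤ z₂
      arith = ℤ-Ring.solve-∀
      combine : ∀ {m y⁻ y⁺ z⁻ z⁺} p q r s u v m₁ m₂ y₂ z₂ → m ≡ p +ℤ (m₁ +ℤ q) → m ≡ r +ℤ (m₂ +ℤ s) →
        y⁻ ≡ -ℤ s +ℤ (0ℤ +ℤ u) → y⁺ ≡ v +ℤ (y₂ +ℤ p) → z⁻ ≡ v +ℤ (0ℤ +ℤ -ℤ r) → z⁺ ≡ q +ℤ (z₂ +ℤ u) →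
        m +ℤ m +ℤ (y⁻ -ℤ y⁺) +ℤ (z⁻ -ℤ z⁺) ≡ m₁ +ℤ m₂ -ℤ y₂ -ℤ z₂
      combine {m} p q r s u v m₁ m₂ y₂ z₂ eq₁ eq₂ refl refl refl refl = trans
        (cong₂ (λ a b → a +ℤ b +ℤ (-ℤ s +ℤ (0ℤ +ℤ u) -ℤ (v +ℤ (y₂ +ℤ p))) +ℤ (v +ℤ (0ℤ +ℤ -ℤ r) -ℤ (q +ℤ (z₂ +ℤ u)))) eq₁ eq₂)
        (arith p q r s u v m₁ m₂ y₂ z₂)

D[_,_] : (ℤ → ℤ) → (ℤ → ℤ) → Series
D[ φ , ψ ] = ser Factorisations (λ (d , e) → φ (+ d) *ℤ ψ (+ e))

ser-quad : ∀ f g h k → ser Quads (λ ((a , x) , (b , y)) → f (+ a) *ℤ g (+ x) *ℤ (h (+ b) *ℤ k (+ y))) ≈ D[ f , g ] ⊛ D[ h , k ]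
ser-quad f g h k = ser-⊗ Factorisations Factorisations (λ (a , x) → f (+ a) *ℤ g (+ x)) (λ (b , y) → h (+ b) *ℤ k (+ y))

-- If the error of an addition law separates the variables, the corresponding difference in
-- Liouville's identity is again a product of Lambert series.
difference : ∀ (F G : Quad → ℤ) c f g h k →
  (∀ a x b y → F ((a , x) , (b , y)) ≡ G ((a , x) , (b , y)) +ℤ c *ℤ (f (+ a) *ℤ g (+ x) *ℤ (h (+ b) *ℤ k (+ y)))) →
  ∀ n → ser Quads F n -ℤ ser Quads G n ≡ c *ℤ (D[ f , g ] ⊛ D[ h , k ]) n
difference F G c f g h k eq n = begin
  ser Quads F n -ℤ ser Quads G n
    ≡⟨ cong (_-ℤ ser Quads G n) (trans (ser-cong Quads (λ ((a , x) , (b , y)) _ → eq a x b y) n) (ser-⊞ Quads G (λ q → c *ℤ T q) n)) ⟩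
  ser Quads G n +ℤ ser Quads (λ q → c *ℤ T q) n -ℤ ser Quads G n
    ≡⟨ arith (ser Quads G n) _ ⟩
  ser Quads (λ q → c *ℤ T q) n
    ≡⟨ trans (ser-scale Quads c T n) (cong (c *ℤ_) (ser-quad f g h k n)) ⟩
  c *ℤ (D[ f , g ] ⊛ D[ h , k ]) n ∎
  where
  open ≡-Reasoning
  T : Quad → ℤ
  T ((a , x) , (b , y)) = f (+ a) *ℤ g (+ x) *ℤ (h (+ b) *ℤ k (+ y))
  arith : ∀ p q → p +ℤ q -ℤ p ≡ q
  arith = ℤ-Ring.solve-∀

-- Lambert series of quadratic characters

ser-even-right : ∀ (f : ℕ × ℕ → ℤ) → (∀ d k → f (d , suc (k + k)) ≡ 0ℤ) →
  ser Factorisations f ≈ dil (ser Factorisations (λ (d , e) → f (d , e + e)))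
ser-even-right f vanish n = begin
  ser Factorisations f n
    ≡⟨ sumE-split double? (enum Factorisations n) f ⟩
  sumE (filterE double? (enum Factorisations n)) f +ℤ sumE (filterE (¬? ∘ double?) (enum Factorisations n)) f
    ≡⟨ cong₂ _+ℤ_ evens odds ⟩
  ser (dilated Factorisations) (λ (d , e) → f (d , e + e)) n +ℤ 0ℤ
    ≡⟨ trans (ℤₚ.+-identityʳ _) (ser-dilated Factorisations (λ (d , e) → f (d , e + e)) n) ⟩
  dil (ser Factorisations (λ (d , e) → f (d , e + e))) n ∎
  where
  open ≡-Reasoning
  double? : Decidable (λ ((d , e) : ℕ × ℕ) → e ≡ ⌊ e /2⌋ + ⌊ e /2⌋)
  double? (d , e) = e ℕₚ.≟ ⌊ e /2⌋ + ⌊ e /2⌋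
  halve : ∀ e → ⌊ e + e /2⌋ ≡ e
  halve e = sym (ℕₚ.n≡⌊n+n/2⌋ e)
  half>0 : ∀ {e} → 0 < e → e ≡ ⌊ e /2⌋ + ⌊ e /2⌋ → 0 < ⌊ e /2⌋
  half>0 {suc (suc e)} _ _ = s≤s z≤n
  evens : sumE (filterE double? (enum Factorisations n)) f ≡ ser (dilated Factorisations) (λ (d , e) → f (d , e + e)) n
  evens = sym (reindex (enum (dilated Factorisations) n) (filterE double? (enum Factorisations n)) (λ (d , e) → d , e + e) (λ (d , e) → d , ⌊ e /2⌋)
    (λ where
      (d , e) ((d>0 , e>0) , w) →
        (((d>0 , ℕₚ.≤-trans e>0 (ℕₚ.m≤m+n e e)) , trans (ℕₚ.*-distribˡ-+ d e e) w) , sym (cong₂ _+_ (halve e) (halve e))) , cong (d ,_) (halve e))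
    (λ where
      (d , e) (((d>0 , e>0) , w) , eq) →
        ((d>0 , half>0 e>0 eq) , trans (sym (ℕₚ.*-distribˡ-+ d ⌊ e /2⌋ ⌊ e /2⌋)) (trans (cong (d *_) (sym eq)) w)) , cong (d ,_) (sym eq))
    (λ _ _ → refl))
  odds : sumE (filterE (¬? ∘ double?) (enum Factorisations n)) f ≡ 0ℤ
  odds = sumE-0 (filterE (¬? ∘ double?) (enum Factorisations n)) (λ (d , e) (_ , ¬double) → at-odd d e ¬double)
    where
    at-odd : ∀ d e → ¬ (e ≡ ⌊ e /2⌋ + ⌊ e /2⌋) → f (d , e) ≡ 0ℤ
    at-odd d e ¬double with parity e
    ... | even k = ⊥-elim (¬double (sym (cong₂ _+_ (halve k) (halve k))))
    ... | odd k = vanish d k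

D-comm : ∀ φ ψ → D[ φ , ψ ] ≈ D[ ψ , φ ]
D-comm φ ψ = ser-reindex Factorisations Factorisations swap swap swaps swaps (λ (d , e) _ → ℤₚ.*-comm (φ (+ d)) (ψ (+ e)))
  where
  swap : ℕ × ℕ → ℕ × ℕ
  swap (d , e) = e , d
  swaps : ∀ a → Ok Factorisations a → Ok Factorisations (swap a) × wt Factorisations (swap a) ≡ wt Factorisations a × swap (swap a) ≡ a
  swaps (d , e) (d>0 , e>0) = (e>0 , d>0) , ℕₚ.*-comm e d , refl

at-odd-residue : ∀ (f : Table) {_ : True (Finₚ.all? (λ i → f (next (i ⊕ i)) ℤₚ.≟ 0ℤ))} k → f (residue (+ suc (k + k))) ≡ 0ℤ
at-odd-residue f {t} k = trans (cong (f ∘ next) (residue-+ (+ k) (+ k))) (by-cases₁ (λ i → f (next (i ⊕ i)) ℤₚ.≟ 0ℤ) {t} (residue (+ k)))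

D-even : ∀ (φ : ℤ → ℤ) (f g : Table) {_ : True (Finₚ.all? (λ i → f (next (i ⊕ i)) ℤₚ.≟ 0ℤ))} {_ : True (Finₚ.all? (λ i → f (i ⊕ i) ℤₚ.≟ g i))} →
  D[ φ , (λ x → f (residue x)) ] ≈ dil D[ φ , (λ x → g (residue x)) ]
D-even φ f g {t} {s} = ≈-trans
  (ser-even-right (λ (d , e) → φ (+ d) *ℤ f (residue (+ e))) (λ d k → trans (cong (φ (+ d) *ℤ_) (at-odd-residue f {t} k)) (ℤₚ.*-zeroʳ (φ (+ d)))))
  (dil-cong (ser-cong Factorisations (λ (d , e) _ → cong (φ (+ d) *ℤ_)
    (trans (cong f (residue-+ (+ e) (+ e))) (by-cases₁ (λ i → f (i ⊕ i) ℤₚ.≟ g i) {s} (residue (+ e)))))))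

-- The coefficients are the sums of (-4/d) and (-8/d) over the divisors d of n; the superscript
-- restricts to odd n/d.
E₄ E₈ E₄ᵒ E₈ᵒ : Series
E₄ = D[ ε , one ]
E₈ = D[ ω , one ]
E₄ᵒ = D[ ε , o ]
E₈ᵒ = D[ ω , o ]

D-e : ∀ φ → D[ φ , e ] ≈ dil D[ φ , one ]
D-e φ = D-even φ e′ 1′

D-parity : ∀ φ → D[ φ , one ] ≈ dil D[ φ , one ] ⊞ D[ φ , o ]
D-parity φ = ≈-trans (ser-cong Factorisations (λ (d , e) _ → trans (cong (φ (+ d) *ℤ_) (sym (by-cases₁ (λ i → e′ i +ℤ o′ i ℤₚ.≟ 1ℤ) (residue (+ e))))) (ℤₚ.*-distribˡ-+ (φ (+ d)) _ _)))
  (≈-trans (ser-⊞ Factorisations _ _) (⊞-cong (D-e φ) ≈-refl))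

Dη : ∀ ψ → D[ η , ψ ] ≈ dil D[ ε , ψ ]
Dη ψ = ≈-trans (D-comm η ψ) (≈-trans (D-even ψ η′ ε′) (dil-cong (D-comm ψ ε)))

-- Convolutions of functions modulo 8

pos : (ℤ → ℤ) → Series
-- Dropping the value at 0 makes the Cauchy product run over positive x and y only.
pos φ zero = 0ℤ
pos φ (suc n) = φ (+ suc n)

conv-⊛ : ∀ φ ψ n → conv φ ψ n ≡ (pos φ ⊛ pos ψ) n
conv-⊛ φ ψ n = begin
  conv φ ψ n
    ≡⟨ sumE-cong (compositions n) (λ where (suc x , suc y) _ → refl) ⟩
  sumE (compositions n) f
    ≡⟨ ℤₚ.+-identityʳ _ ⟨
  sumE (compositions n) f +ℤ 0ℤ
    ≡⟨ cong (sumE (compositions n) f +ℤ_) (sumE-0 (filterE (¬? ∘ positive?) (antidiagonal n)) zero-term) ⟨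
  sumE (compositions n) f +ℤ sumE (filterE (¬? ∘ positive?) (antidiagonal n)) f
    ≡⟨ sumE-split positive? (antidiagonal n) f ⟨
  sumE (antidiagonal n) f
    ≡⟨ ⊛-antidiagonal (pos φ) (pos ψ) n ⟨
  (pos φ ⊛ pos ψ) n ∎
  where
  open ≡-Reasoning
  f : ℕ × ℕ → ℤ
  f xy = pos φ (proj₁ xy) *ℤ pos ψ (proj₂ xy)
  zero-term : ∀ xy → _ × ¬ (0 < proj₁ xy × 0 < proj₂ xy) → f xy ≡ 0ℤ
  zero-term (zero , y) _ = ℤₚ.*-zeroˡ (pos ψ y)
  zero-term (suc x , zero) _ = ℤₚ.*-zeroʳ (φ (+ suc x))
  zero-term (suc x , suc y) (_ , ¬p) = ⊥-elim (¬p (s≤s z≤n , s≤s z≤n))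

module _ (f g : Table) where
  private
    F G : ℤ → ℤ
    F x = f (residue x)
    G x = g (residue x)

  block : Fin 8 → ℤ
  block i = f (# 1) *ℤ g (next^ 7 i) +ℤ (f (# 2) *ℤ g (next^ 6 i) +ℤ (f (# 3) *ℤ g (next^ 5 i) +ℤ (f (# 4) *ℤ g (next^ 4 i)
    +ℤ (f (# 5) *ℤ g (next^ 3 i) +ℤ (f (# 6) *ℤ g (next^ 2 i) +ℤ f (# 7) *ℤ g (next^ 1 i))))))

  -- The terms of first index 1 to 7 depend on n modulo 8 only, and the rest is the product at n
  -- because `pos F` is periodic; at index 0 the period requires f(0) = 0.
  conv-step : f (# 0) ≡ 0ℤ → ∀ n → (pos F ⊛ pos G) (8 + n) ≡ block (residue (+ n)) +ℤ (pos F ⊛ pos G) n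
  conv-step f0 n = trans (cong (λ z → (0ℤ *ℤ pos G (8 + n)) +ℤ (x₁ +ℤ (x₂ +ℤ (x₃ +ℤ (x₄ +ℤ (x₅ +ℤ (x₆ +ℤ (x₇ +ℤ z)))))))) (⊛-cong period (≈-refl {pos G}) n))
    (arith (pos G (8 + n)) x₁ x₂ x₃ x₄ x₅ x₆ x₇ ((pos F ⊛ pos G) n))
    where
    i = residue (+ n)
    x₁ = f (# 1) *ℤ g (next^ 7 i)
    x₂ = f (# 2) *ℤ g (next^ 6 i)
    x₃ = f (# 3) *ℤ g (next^ 5 i)
    x₄ = f (# 4) *ℤ g (next^ 4 i)
    x₅ = f (# 5) *ℤ g (next^ 3 i)
    x₆ = f (# 6) *ℤ g (next^ 2 i)
    x₇ = f (# 7) *ℤ g (next^ 1 i)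
    period : (λ k → pos F (8 + k)) ≈ pos F
    period zero = f0
    period (suc k) = cong f (by-cases₁ (λ j → next^ 8 j Finₚ.≟ j) (residue (+ suc k)))
    arith : ∀ g a b c d e h k z → 0ℤ *ℤ g +ℤ (a +ℤ (b +ℤ (c +ℤ (d +ℤ (e +ℤ (h +ℤ (k +ℤ z))))))) ≡ (a +ℤ (b +ℤ (c +ℤ (d +ℤ (e +ℤ (h +ℤ k)))))) +ℤ z
    arith = ℤ-Ring.solve-∀

  -- The increment over a period depends on the residue alone, so the convolution is affine in n on
  -- each residue class, and it suffices to check slopes and the values below 8. Doubling keeps
  -- slope and offset integral.
  closed-form : (a b : Table) {_ : True (f (# 0) ℤₚ.≟ 0ℤ)}
    {_ : True (Finₚ.all? (λ i → + 2 *ℤ block i ℤₚ.≟ + 8 *ℤ a i))}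
    {_ : True (Finₚ.all? (λ (i : Fin 8) → + 2 *ℤ (pos F ⊛ pos G) (Fin.toℕ i) ℤₚ.≟ + Fin.toℕ i *ℤ a i +ℤ b i))} →
    ∀ n → + 2 *ℤ conv F G n ≡ + n *ℤ a (residue (+ n)) +ℤ b (residue (+ n))
  closed-form a b {t₀} {t₁} {t₂} n = trans (cong (+ 2 *ℤ_) (conv-⊛ F G n)) (go n)
    where
    go : ∀ n → + 2 *ℤ (pos F ⊛ pos G) n ≡ + n *ℤ a (residue (+ n)) +ℤ b (residue (+ n))
    base : (i : Fin 8) → + 2 *ℤ (pos F ⊛ pos G) (Fin.toℕ i) ≡ + Fin.toℕ i *ℤ a i +ℤ b i
    base = by-cases₁ (λ (i : Fin 8) → + 2 *ℤ (pos F ⊛ pos G) (Fin.toℕ i) ℤₚ.≟ + Fin.toℕ i *ℤ a i +ℤ b i) {t₂}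
    go 0 = base (# 0)
    go 1 = base (# 1)
    go 2 = base (# 2)
    go 3 = base (# 3)
    go 4 = base (# 4)
    go 5 = base (# 5)
    go 6 = base (# 6)
    go 7 = base (# 7)
    go (suc (suc (suc (suc (suc (suc (suc (suc n)))))))) = begin
      + 2 *ℤ (pos F ⊛ pos G) (8 + n)
        ≡⟨ cong (+ 2 *ℤ_) (conv-step (by-cases₀ t₀) n) ⟩
      + 2 *ℤ (block i +ℤ (pos F ⊛ pos G) n)
        ≡⟨ ℤₚ.*-distribˡ-+ (+ 2) (block i) _ ⟩
      + 2 *ℤ block i +ℤ + 2 *ℤ (pos F ⊛ pos G) n
        ≡⟨ cong₂ _+ℤ_ (by-cases₁ (λ i → + 2 *ℤ block i ℤₚ.≟ + 8 *ℤ a i) {t₁} i) (go n) ⟩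
      + 8 *ℤ a i +ℤ (+ n *ℤ a i +ℤ b i)
        ≡⟨ arith (+ n) (a i) (b i) ⟩
      (+ 8 +ℤ + n) *ℤ a i +ℤ b i
        ≡⟨ cong (λ j → (+ 8 +ℤ + n) *ℤ a j +ℤ b j) (by-cases₁ (λ j → next^ 8 j Finₚ.≟ j) i) ⟨
      (+ 8 +ℤ + n) *ℤ a (next^ 8 i) +ℤ b (next^ 8 i) ∎
      where
      open ≡-Reasoning
      i = residue (+ n)
      by-cases₀ : True (f (# 0) ℤₚ.≟ 0ℤ) → f (# 0) ≡ 0ℤ
      by-cases₀ = toWitness
      arith : ∀ n a b → + 8 *ℤ a +ℤ (n *ℤ a +ℤ b) ≡ (+ 8 +ℤ n) *ℤ a +ℤ b
      arith = ℤ-Ring.solve-∀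

conv-oo : ∀ n → + 2 *ℤ conv o o n ≡ + n *ℤ e′ (residue (+ n)) +ℤ 0ℤ
conv-oo = closed-form o′ o′ e′ (λ _ → 0ℤ)

conv-oe : ∀ n → + 2 *ℤ conv o e n ≡ + n *ℤ o′ (residue (+ n)) +ℤ -ℤ o′ (residue (+ n))
conv-oe = closed-form o′ e′ o′ (λ i → -ℤ o′ i)

conv-o1 : ∀ n → + 2 *ℤ conv o one n ≡ + n *ℤ 1ℤ +ℤ -ℤ o′ (residue (+ n))
conv-o1 = closed-form o′ 1′ 1′ (λ i → -ℤ o′ i)

conv-εε : ∀ n → + 2 *ℤ conv ε ε n ≡ + n *ℤ -ℤ σ′ (residue (+ n)) +ℤ 0ℤ
conv-εε = closed-form ε′ ε′ (λ i → -ℤ σ′ i) (λ _ → 0ℤ)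

conv-comm : ∀ φ ψ n → conv φ ψ n ≡ conv ψ φ n
conv-comm φ ψ n = trans (conv-⊛ φ ψ n) (trans (⊛-comm (pos φ) (pos ψ) n) (sym (conv-⊛ ψ φ n)))

-- `partial-ε` and `partial-ω` are twice the sums of `ε` and `ω` over 0 < y < n.
partial-ε partial-ω ωω-slope ωω-offset : Table
partial-ε = table (0ℤ ∷ 0ℤ ∷ + 2 ∷ + 2 ∷ 0ℤ ∷ 0ℤ ∷ + 2 ∷ + 2 ∷ [])
partial-ω = table (0ℤ ∷ 0ℤ ∷ + 2 ∷ + 2 ∷ + 4 ∷ + 4 ∷ + 2 ∷ + 2 ∷ [])
ωω-slope = table (-1ℤ ∷ 0ℤ ∷ 0ℤ ∷ 0ℤ ∷ 1ℤ ∷ 0ℤ ∷ 0ℤ ∷ 0ℤ ∷ [])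
ωω-offset = table (0ℤ ∷ 0ℤ ∷ + 2 ∷ 0ℤ ∷ 0ℤ ∷ 0ℤ ∷ -[1+ 1 ] ∷ 0ℤ ∷ [])

conv-1ε : ∀ n → + 2 *ℤ conv one ε n ≡ + n *ℤ 0ℤ +ℤ partial-ε (residue (+ n))
conv-1ε n = trans (cong (+ 2 *ℤ_) (conv-comm one ε n)) (closed-form ε′ 1′ (λ _ → 0ℤ) partial-ε n)

conv-1ω : ∀ n → + 2 *ℤ conv one ω n ≡ + n *ℤ 0ℤ +ℤ partial-ω (residue (+ n))
conv-1ω n = trans (cong (+ 2 *ℤ_) (conv-comm one ω n)) (closed-form ω′ 1′ (λ _ → 0ℤ) partial-ω n)

conv-ωω : ∀ n → + 2 *ℤ conv ω ω n ≡ + n *ℤ ωω-slope (residue (+ n)) +ℤ ωω-offset (residue (+ n))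
conv-ωω = closed-form ω′ ω′ ωω-slope ωω-offset

halve-≡ : ∀ {x y} → + 2 *ℤ x ≡ + 2 *ℤ y → x ≡ y
halve-≡ {x} {y} = ℤₚ.*-cancelˡ-≡ (+ 2) x y

oo+εε : ℕ → ℤ
oo+εε n = conv o o n +ℤ conv ε ε n

oo+ωω : ℕ → ℤ
oo+ωω n = conv o o n +ℤ conv ω ω n

private
  double-sum : ∀ {p q} (n a b c d : ℤ) → + 2 *ℤ p ≡ n *ℤ a +ℤ b → + 2 *ℤ q ≡ n *ℤ c +ℤ d → + 2 *ℤ (p +ℤ q) ≡ n *ℤ (a +ℤ c) +ℤ (b +ℤ d)
  double-sum {p} {q} n a b c d eq₁ eq₂ = trans (ℤₚ.*-distribˡ-+ (+ 2) p q) (trans (cong₂ _+ℤ_ eq₁ eq₂) (arith n a b c d))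
    where
    arith : ∀ n a b c d → n *ℤ a +ℤ b +ℤ (n *ℤ c +ℤ d) ≡ n *ℤ (a +ℤ c) +ℤ (b +ℤ d)
    arith = ℤ-Ring.solve-∀

  double-times : ∀ {p} (c n b : ℤ) → + 2 *ℤ p ≡ n *ℤ 0ℤ +ℤ b → + 2 *ℤ (c *ℤ p) ≡ c *ℤ b
  double-times {p} c n b eq = trans (arith c p) (trans (cong (c *ℤ_) eq) (arith₂ c n b))
    where
    arith : ∀ c p → + 2 *ℤ (c *ℤ p) ≡ c *ℤ (+ 2 *ℤ p)
    arith = ℤ-Ring.solve-∀
    arith₂ : ∀ c n b → c *ℤ (n *ℤ 0ℤ +ℤ b) ≡ c *ℤ b
    arith₂ = ℤ-Ring.solve-∀

double-oo+εε : ∀ n → + 2 *ℤ oo+εε n ≡ + n *ℤ (e′ (residue (+ n)) +ℤ -ℤ σ′ (residue (+ n))) +ℤ (0ℤ +ℤ 0ℤ)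
double-oo+εε n = double-sum {conv o o n} {conv ε ε n} (+ n) _ _ _ _ (conv-oo n) (conv-εε n)

double-oo+ωω : ∀ n → + 2 *ℤ oo+ωω n ≡ + n *ℤ (e′ (residue (+ n)) +ℤ ωω-slope (residue (+ n))) +ℤ (0ℤ +ℤ ωω-offset (residue (+ n)))
double-oo+ωω n = double-sum {conv o o n} {conv ω ω n} (+ n) _ _ _ _ (conv-oo n) (conv-ωω n)

oo+εε-odd : ∀ k → oo+εε (suc (k + k)) ≡ 0ℤ
oo+εε-odd k = halve-≡ (trans (double-oo+εε n) (trans (cong (λ z → + n *ℤ z +ℤ 0ℤ) (at-odd-residue (λ i → e′ i +ℤ -ℤ σ′ i) k)) (cong (_+ℤ 0ℤ) (ℤₚ.*-zeroʳ (+ n)))))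
  where n = suc (k + k)

oo+ωω-odd : ∀ k → oo+ωω (suc (k + k)) ≡ 0ℤ
oo+ωω-odd k = halve-≡ (trans (double-oo+ωω n) (trans (cong₂ (λ y z → + n *ℤ y +ℤ z) (at-odd-residue (λ i → e′ i +ℤ ωω-slope i) k) (at-odd-residue (λ i → 0ℤ +ℤ ωω-offset i) k)) (cong (_+ℤ 0ℤ) (ℤₚ.*-zeroʳ (+ n)))))
  where n = suc (k + k)

-- The weights that Liouville's identities assign to 2 E₄ᵒ E₄(q²) and 2 E₄ᵒ E₄. The two doubling
-- formulas are what `b₄-square` and `a₈-square` demand of the weights.
t₁ t₂ : ℕ → ℤ
t₁ n = conv o e n -ℤ ε (+ n) *ℤ conv one ε n
t₂ n = conv o one n +ℤ conv ε ε n -ℤ ε (+ n) *ℤ conv one ε n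

-- Both sides are affine in n with coefficients depending on n modulo 8, so only tables are compared.
oo+εε-double : ∀ n → oo+εε (n + n) ≡ ε (+ n) +ℤ ε (+ n) +ℤ (t₁ n +ℤ t₁ n +ℤ (t₁ n +ℤ t₁ n))
oo+εε-double n = halve-≡ (begin
  + 2 *ℤ oo+εε (n + n)
    ≡⟨ double-oo+εε (n + n) ⟩
  + (n + n) *ℤ (e′ (residue (+ (n + n))) +ℤ -ℤ σ′ (residue (+ (n + n)))) +ℤ 0ℤ
    ≡⟨ cong (λ j → (+ n +ℤ + n) *ℤ (e′ j +ℤ -ℤ σ′ j) +ℤ 0ℤ) (residue-+ (+ n) (+ n)) ⟩
  (+ n +ℤ + n) *ℤ (e′ (i ⊕ i) +ℤ -ℤ σ′ (i ⊕ i)) +ℤ 0ℤ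
    ≡⟨ cong (λ z → (+ n +ℤ + n) *ℤ z +ℤ 0ℤ) (by-cases₁ (λ i → e′ (i ⊕ i) +ℤ -ℤ σ′ (i ⊕ i) ℤₚ.≟ + 2 *ℤ o′ i) i) ⟩
  (+ n +ℤ + n) *ℤ (+ 2 *ℤ o′ i) +ℤ 0ℤ
    ≡⟨ arith (+ n) (o′ i) ⟩
  + 4 *ℤ (+ n *ℤ o′ i) +ℤ 0ℤ
    ≡⟨ cong (λ z → + 4 *ℤ (+ n *ℤ o′ i) +ℤ z) (by-cases₁ (λ i → + 4 *ℤ ε′ i -ℤ + 4 *ℤ o′ i -ℤ + 4 *ℤ (ε′ i *ℤ partial-ε i) ℤₚ.≟ 0ℤ) i) ⟨
  + 4 *ℤ (+ n *ℤ o′ i) +ℤ (+ 4 *ℤ ε′ i -ℤ + 4 *ℤ o′ i -ℤ + 4 *ℤ (ε′ i *ℤ partial-ε i))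
    ≡⟨ arith₂ (+ n *ℤ o′ i) (ε′ i) (o′ i) (ε′ i *ℤ partial-ε i) ⟩
  + 4 *ℤ ε′ i +ℤ + 4 *ℤ ((+ n *ℤ o′ i +ℤ -ℤ o′ i) -ℤ ε′ i *ℤ partial-ε i)
    ≡⟨ cong₂ (λ x y → + 4 *ℤ ε′ i +ℤ + 4 *ℤ (x -ℤ y)) (conv-oe n) (double-times (ε (+ n)) (+ n) (partial-ε i) (conv-1ε n)) ⟨
  + 4 *ℤ ε′ i +ℤ + 4 *ℤ (+ 2 *ℤ conv o e n -ℤ + 2 *ℤ (ε (+ n) *ℤ conv one ε n))
    ≡⟨ arith₃ (ε (+ n)) (conv o e n) (ε (+ n) *ℤ conv one ε n) ⟩
  + 2 *ℤ (ε (+ n) +ℤ ε (+ n) +ℤ (t₁ n +ℤ t₁ n +ℤ (t₁ n +ℤ t₁ n))) ∎)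
  where
  open ≡-Reasoning
  i = residue (+ n)
  arith : ∀ n a → (n +ℤ n) *ℤ (+ 2 *ℤ a) +ℤ 0ℤ ≡ + 4 *ℤ (n *ℤ a) +ℤ 0ℤ
  arith = ℤ-Ring.solve-∀
  arith₂ : ∀ x a b c → + 4 *ℤ x +ℤ (+ 4 *ℤ a -ℤ + 4 *ℤ b -ℤ + 4 *ℤ c) ≡ + 4 *ℤ a +ℤ + 4 *ℤ ((x +ℤ -ℤ b) -ℤ c)
  arith₂ = ℤ-Ring.solve-∀
  arith₃ : ∀ a b c → + 4 *ℤ a +ℤ + 4 *ℤ (+ 2 *ℤ b -ℤ + 2 *ℤ c) ≡ + 2 *ℤ (a +ℤ a +ℤ (b -ℤ c +ℤ (b -ℤ c) +ℤ (b -ℤ c +ℤ (b -ℤ c))))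
  arith₃ = ℤ-Ring.solve-∀

oo+ωω-double : ∀ n → oo+ωω (n + n) ≡ ε (+ n) +ℤ ε (+ n) +ℤ (t₂ n +ℤ t₂ n)
oo+ωω-double n = halve-≡ (begin
  + 2 *ℤ oo+ωω (n + n)
    ≡⟨ double-oo+ωω (n + n) ⟩
  + (n + n) *ℤ (e′ (residue (+ (n + n))) +ℤ ωω-slope (residue (+ (n + n)))) +ℤ (0ℤ +ℤ ωω-offset (residue (+ (n + n))))
    ≡⟨ cong (λ j → (+ n +ℤ + n) *ℤ (e′ j +ℤ ωω-slope j) +ℤ (0ℤ +ℤ ωω-offset j)) (residue-+ (+ n) (+ n)) ⟩
  (+ n +ℤ + n) *ℤ (e′ (i ⊕ i) +ℤ ωω-slope (i ⊕ i)) +ℤ (0ℤ +ℤ ωω-offset (i ⊕ i))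
    ≡⟨ cong₂ (λ z w → (+ n +ℤ + n) *ℤ z +ℤ w) (by-cases₁ (λ i → e′ (i ⊕ i) +ℤ ωω-slope (i ⊕ i) ℤₚ.≟ 1ℤ -ℤ σ′ i) i)
         (by-cases₁ (λ i → 0ℤ +ℤ ωω-offset (i ⊕ i) ℤₚ.≟ + 4 *ℤ ε′ i -ℤ + 2 *ℤ o′ i -ℤ + 2 *ℤ (ε′ i *ℤ partial-ε i)) i) ⟩
  (+ n +ℤ + n) *ℤ (1ℤ -ℤ σ′ i) +ℤ (+ 4 *ℤ ε′ i -ℤ + 2 *ℤ o′ i -ℤ + 2 *ℤ (ε′ i *ℤ partial-ε i))
    ≡⟨ arith₂ (+ n) (σ′ i) (ε′ i) (o′ i) (ε′ i *ℤ partial-ε i) ⟩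
  + 4 *ℤ ε′ i +ℤ + 2 *ℤ ((+ n *ℤ 1ℤ +ℤ -ℤ o′ i) +ℤ (+ n *ℤ -ℤ σ′ i +ℤ 0ℤ) -ℤ ε′ i *ℤ partial-ε i)
    ≡⟨ cong₂ (λ x y → + 4 *ℤ ε′ i +ℤ + 2 *ℤ (x -ℤ y)) (cong₂ _+ℤ_ (conv-o1 n) (conv-εε n)) (double-times (ε (+ n)) (+ n) (partial-ε i) (conv-1ε n)) ⟨
  + 4 *ℤ ε′ i +ℤ + 2 *ℤ (+ 2 *ℤ conv o one n +ℤ + 2 *ℤ conv ε ε n -ℤ + 2 *ℤ (ε (+ n) *ℤ conv one ε n))
    ≡⟨ arith₃ (ε (+ n)) (conv o one n) (conv ε ε n) (ε (+ n) *ℤ conv one ε n) ⟩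
  + 2 *ℤ (ε (+ n) +ℤ ε (+ n) +ℤ (t₂ n +ℤ t₂ n)) ∎)
  where
  open ≡-Reasoning
  i = residue (+ n)
  arith₂ : ∀ n s a b c → (n +ℤ n) *ℤ (1ℤ -ℤ s) +ℤ (+ 4 *ℤ a -ℤ + 2 *ℤ b -ℤ + 2 *ℤ c)
    ≡ + 4 *ℤ a +ℤ + 2 *ℤ ((n *ℤ 1ℤ +ℤ -ℤ b) +ℤ (n *ℤ -ℤ s +ℤ 0ℤ) -ℤ c)
  arith₂ = ℤ-Ring.solve-∀
  arith₃ : ∀ a b b′ c → + 4 *ℤ a +ℤ + 2 *ℤ (+ 2 *ℤ b +ℤ + 2 *ℤ b′ -ℤ + 2 *ℤ c) ≡ + 2 *ℤ (a +ℤ a +ℤ (b +ℤ b′ -ℤ c +ℤ (b +ℤ b′ -ℤ c)))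
  arith₃ = ℤ-Ring.solve-∀

-- Liouville's identities for the characters modulo 4 and 8

o-step : ∀ x y → o (x +ℤ (y +ℤ y)) ≡ o x
o-step x y = trans (table-+ o′ x (y +ℤ y)) (trans (cong (λ j → o′ (residue x ⊕ j)) (residue-+ y y))
  (by-cases₂ (λ i j → o′ (i ⊕ (j ⊕ j)) ℤₚ.≟ o′ i) (residue x) (residue y)))

e-step : ∀ x y → e (x +ℤ (y +ℤ y)) ≡ e x
e-step x y = trans (table-+ e′ x (y +ℤ y)) (trans (cong (λ j → e′ (residue x ⊕ j)) (residue-+ y y))
  (by-cases₂ (λ i j → e′ (i ⊕ (j ⊕ j)) ℤₚ.≟ e′ i) (residue x) (residue y)))

module εεoo = Liouville ε ε o o ε-odd ε-odd o-step o-step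
module εεoe = Liouville ε ε o e ε-odd ε-odd o-step e-step
module εεo1 = Liouville ε ε o one ε-odd ε-odd o-step (λ _ _ → refl)
module ωωoo = Liouville ω ω o o ω-odd ω-odd o-step o-step
module εωoe = Liouville ε ω o e ε-odd ω-odd o-step e-step

module _ (α β γ κ : ℤ → ℤ) where
  M-series : ser Quads (λ ((a , x) , (b , y)) → α (+ a) *ℤ β (+ b) *ℤ γ (+ x) *ℤ κ (+ y)) ≈ D[ α , γ ] ⊛ D[ β , κ ]
  M-series = ≈-trans (ser-cong Quads (λ ((a , x) , (b , y)) _ → arith (α (+ a)) (β (+ b)) (γ (+ x)) (κ (+ y)))) (ser-quad α γ β κ)
    where
    arith : ∀ p q r s → p *ℤ q *ℤ r *ℤ s ≡ p *ℤ r *ℤ (q *ℤ s)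
    arith = ℤ-Ring.solve-∀

-- sin x sin (x + y) - sin x sin (x - y) = 2 sin x cos x sin y, and sin x cos x vanishes at
-- multiples of π/2. Hence the `Y` and `Z` sums cancel for α = β = `ε`.
ε-reflectʳ : ∀ x y → ε x *ℤ ε (x -ℤ y) ≡ ε x *ℤ ε (x +ℤ y)
ε-reflectʳ x y = trans (cong (ε x *ℤ_) (table-- ε′ x y)) (trans (by-cases₂ (λ i j → ε′ i *ℤ ε′ (i ⊕ opposite j) ℤₚ.≟ ε′ i *ℤ ε′ (i ⊕ j)) (residue x) (residue y))
  (cong (ε x *ℤ_) (sym (table-+ ε′ x y))))

ε-reflectˡ : ∀ x y → ε (y -ℤ x) *ℤ ε y ≡ ε (y +ℤ x) *ℤ ε y
ε-reflectˡ x y = trans (ℤₚ.*-comm (ε (y -ℤ x)) (ε y)) (trans (ε-reflectʳ y x) (ℤₚ.*-comm (ε y) (ε (y +ℤ x))))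

cancel-equal : ∀ {y y′ z z′ d} m → m +ℤ m +ℤ (y -ℤ y′) +ℤ (z -ℤ z′) ≡ d → y ≡ y′ → z ≡ z′ → m +ℤ m ≡ d
cancel-equal {y} {_} {z} m eq refl refl = trans (arith m y z) eq
  where
  arith : ∀ m y z → m +ℤ m ≡ m +ℤ m +ℤ (y -ℤ y) +ℤ (z -ℤ z)
  arith = ℤ-Ring.solve-∀

weighted : (ℕ → ℤ) → Series
weighted w = ser Factorisations (λ (d , e) → o (+ d) *ℤ w e)

ε²≡o : ∀ x → ε x *ℤ ε x ≡ o x
ε²≡o x = by-cases₁ (λ i → ε′ i *ℤ ε′ i ℤₚ.≟ o′ i) (residue x)

o²≡o : ∀ x → o x *ℤ o x ≡ o x
o²≡o x = by-cases₁ (λ i → o′ i *ℤ o′ i ℤₚ.≟ o′ i) (residue x)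

weighted-double : ∀ w → (∀ k → w (suc (k + k)) ≡ 0ℤ) → weighted w ≈ dil (weighted (λ k → w (k + k)))
weighted-double w vanish = ser-even-right (λ (d , e) → o (+ d) *ℤ w e) (λ d k → trans (cong (o (+ d) *ℤ_) (vanish k)) (ℤₚ.*-zeroʳ (o (+ d))))

-- Here γ and κ are `o`, which vanishes at 0, so only the first two terms of `D` survive; both carry
-- the factor `o` of d, because `ε` and `o` square to `o`.
E₄ᵒ² : E₄ᵒ ⊛ E₄ᵒ ⊞ E₄ᵒ ⊛ E₄ᵒ ≈ dil (weighted (λ k → oo+εε (k + k)))
E₄ᵒ² = ≈-trans liou (weighted-double oo+εε oo+εε-odd)
  where
  liou : E₄ᵒ ⊛ E₄ᵒ ⊞ E₄ᵒ ⊛ E₄ᵒ ≈ weighted oo+εε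
  liou n = begin
    (E₄ᵒ ⊛ E₄ᵒ) n +ℤ (E₄ᵒ ⊛ E₄ᵒ) n
      ≡⟨ cong₂ _+ℤ_ (M-series ε ε o o n) (M-series ε ε o o n) ⟨
    ser Quads εεoo.M n +ℤ ser Quads εεoo.M n
      ≡⟨ cancel-equal (ser Quads εεoo.M n) (εεoo.liouville n)
           (ser-cong Quads {εεoo.Y⁻} {εεoo.Y⁺} (λ ((a , x) , (b , y)) _ → cong (λ z → z *ℤ o (+ x +ℤ + y) *ℤ o (+ y)) (ε-reflectʳ (+ a) (+ b))) n)
           (ser-cong Quads {εεoo.Z⁻} {εεoo.Z⁺} (λ ((a , x) , (b , y)) _ → cong (λ z → z *ℤ o (+ x) *ℤ o (+ x +ℤ + y)) (ε-reflectˡ (+ a) (+ b))) n) ⟩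
    ser Factorisations εεoo.D n
      ≡⟨ ser-cong Factorisations (λ (d , e) _ → trans (arith (ε (+ d) *ℤ ε (+ d)) (o (+ d) *ℤ o (+ d)) (conv o o e) (conv ε ε e) (o (+ d) *ℤ (ε (+ e) *ℤ conv ε one e)) (o (+ d) *ℤ (ε (+ e) *ℤ conv one ε e)))
           (trans (cong₂ (λ p q → p *ℤ conv o o e +ℤ q *ℤ conv ε ε e) (ε²≡o (+ d)) (o²≡o (+ d))) (sym (ℤₚ.*-distribˡ-+ (o (+ d)) (conv o o e) (conv ε ε e))))) n ⟩
    weighted oo+εε n ∎
    where
    open ≡-Reasoning
    arith : ∀ p q x y r s → p *ℤ x +ℤ q *ℤ y -ℤ 0ℤ *ℤ r -ℤ 0ℤ *ℤ s ≡ p *ℤ x +ℤ q *ℤ y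
    arith = ℤ-Ring.solve-∀

-- With κ = `e` the product of `o` and `e` kills the second term of `D`, while the value 1 of `e` at
-- 0 keeps the fourth.
E₄ᵒ-dilE₄ : E₄ᵒ ⊛ dil E₄ ⊞ E₄ᵒ ⊛ dil E₄ ≈ weighted t₁
E₄ᵒ-dilE₄ n = begin
  (E₄ᵒ ⊛ dil E₄) n +ℤ (E₄ᵒ ⊛ dil E₄) n
    ≡⟨ cong₂ _+ℤ_ M-eq M-eq ⟨
  ser Quads εεoe.M n +ℤ ser Quads εεoe.M n
    ≡⟨ cancel-equal (ser Quads εεoe.M n) (εεoe.liouville n)
         (ser-cong Quads {εεoe.Y⁻} {εεoe.Y⁺} (λ ((a , x) , (b , y)) _ → cong (λ z → z *ℤ o (+ x +ℤ + y) *ℤ e (+ y)) (ε-reflectʳ (+ a) (+ b))) n)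
         (ser-cong Quads {εεoe.Z⁻} {εεoe.Z⁺} (λ ((a , x) , (b , y)) _ → cong (λ z → z *ℤ o (+ x) *ℤ e (+ x +ℤ + y)) (ε-reflectˡ (+ a) (+ b))) n) ⟩
  ser Factorisations εεoe.D n
    ≡⟨ ser-cong Factorisations (λ (d , k) _ → trans
         (cong₂ (λ p q → p *ℤ conv o e k +ℤ q *ℤ conv ε ε k -ℤ 0ℤ *ℤ (e (+ d) *ℤ (ε (+ k) *ℤ conv ε one k)) -ℤ 1ℤ *ℤ (o (+ d) *ℤ (ε (+ k) *ℤ conv one ε k)))
           (ε²≡o (+ d)) (by-cases₁ (λ i → o′ i *ℤ e′ i ℤₚ.≟ 0ℤ) (residue (+ d))))
         (arith (o (+ d)) (conv o e k) (conv ε ε k) (e (+ d) *ℤ (ε (+ k) *ℤ conv ε one k)) (ε (+ k) *ℤ conv one ε k))) n ⟩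
  weighted t₁ n ∎
  where
  open ≡-Reasoning
  M-eq : ser Quads εεoe.M n ≡ (E₄ᵒ ⊛ dil E₄) n
  M-eq = trans (M-series ε ε o e n) (⊛-congˡ E₄ᵒ (D-e ε) n)
  arith : ∀ p x y r s → p *ℤ x +ℤ 0ℤ *ℤ y -ℤ 0ℤ *ℤ r -ℤ 1ℤ *ℤ (p *ℤ s) ≡ p *ℤ (x -ℤ s)
  arith = ℤ-Ring.solve-∀

E₄ᵒ-E₄ : E₄ᵒ ⊛ E₄ ⊞ E₄ᵒ ⊛ E₄ ≈ weighted t₂
E₄ᵒ-E₄ n = begin
  (E₄ᵒ ⊛ E₄) n +ℤ (E₄ᵒ ⊛ E₄) n
    ≡⟨ cong₂ _+ℤ_ (M-series ε ε o one n) (M-series ε ε o one n) ⟨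
  ser Quads εεo1.M n +ℤ ser Quads εεo1.M n
    ≡⟨ cancel-equal (ser Quads εεo1.M n) (εεo1.liouville n)
         (ser-cong Quads {εεo1.Y⁻} {εεo1.Y⁺} (λ ((a , x) , (b , y)) _ → cong (λ z → z *ℤ o (+ x +ℤ + y) *ℤ 1ℤ) (ε-reflectʳ (+ a) (+ b))) n)
         (ser-cong Quads {εεo1.Z⁻} {εεo1.Z⁺} (λ ((a , x) , (b , y)) _ → cong (λ z → z *ℤ o (+ x) *ℤ 1ℤ) (ε-reflectˡ (+ a) (+ b))) n) ⟩
  ser Factorisations εεo1.D n
    ≡⟨ ser-cong Factorisations (λ (d , k) _ → trans
         (cong (λ p → p *ℤ conv o one k +ℤ o (+ d) *ℤ 1ℤ *ℤ conv ε ε k -ℤ 0ℤ *ℤ (1ℤ *ℤ (ε (+ k) *ℤ conv ε one k)) -ℤ 1ℤ *ℤ (o (+ d) *ℤ (ε (+ k) *ℤ conv one ε k))) (ε²≡o (+ d)))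
         (arith (o (+ d)) (conv o one k) (conv ε ε k) (ε (+ k) *ℤ conv ε one k) (ε (+ k) *ℤ conv one ε k))) n ⟩
  weighted t₂ n ∎
  where
  open ≡-Reasoning
  arith : ∀ p x y r s → p *ℤ x +ℤ p *ℤ 1ℤ *ℤ y -ℤ 0ℤ *ℤ (1ℤ *ℤ r) -ℤ 1ℤ *ℤ (p *ℤ s) ≡ p *ℤ (x +ℤ y -ℤ s)
  arith = ℤ-Ring.solve-∀

-- For odd x the reflection y ↦ -y changes the value exactly when y ≡ 2 (mod 4). The error is a
-- function of x times a function of y, as `difference` requires.
ω-reflectʳ : ∀ x y → ω x *ℤ ω (x -ℤ y) ≡ ω x *ℤ ω (x +ℤ y) +ℤ -[1+ 1 ] *ℤ (ε x *ℤ η y)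
ω-reflectʳ x y = trans (cong (ω x *ℤ_) (table-- ω′ x y)) (trans (by-cases₂ (λ i j → ω′ i *ℤ ω′ (i ⊕ opposite j) ℤₚ.≟ ω′ i *ℤ ω′ (i ⊕ j) +ℤ -[1+ 1 ] *ℤ (ε′ i *ℤ η′ j)) (residue x) (residue y))
  (cong (λ z → ω x *ℤ z +ℤ -[1+ 1 ] *ℤ (ε x *ℤ η y)) (sym (table-+ ω′ x y))))

εω-reflectʳ : ∀ x y → ε x *ℤ ω (x -ℤ y) ≡ ε x *ℤ ω (x +ℤ y) +ℤ -[1+ 1 ] *ℤ (ω x *ℤ η y)
εω-reflectʳ x y = trans (cong (ε x *ℤ_) (table-- ω′ x y)) (trans (by-cases₂ (λ i j → ε′ i *ℤ ω′ (i ⊕ opposite j) ℤₚ.≟ ε′ i *ℤ ω′ (i ⊕ j) +ℤ -[1+ 1 ] *ℤ (ω′ i *ℤ η′ j)) (residue x) (residue y))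
  (cong (λ z → ε x *ℤ z +ℤ -[1+ 1 ] *ℤ (ω x *ℤ η y)) (sym (table-+ ω′ x y))))

εω-reflectˡ : ∀ x y → ε (y -ℤ x) *ℤ ω y ≡ ε (y +ℤ x) *ℤ ω y
εω-reflectˡ x y = trans (cong (_*ℤ ω y) (table-- ε′ y x)) (trans (by-cases₂ (λ i j → ε′ (i ⊕ opposite j) *ℤ ω′ i ℤₚ.≟ ε′ (i ⊕ j) *ℤ ω′ i) (residue y) (residue x))
  (cong (_*ℤ ω y) (sym (table-+ ε′ y x))))

oo-sum : ∀ x y → o (x +ℤ y) *ℤ o y ≡ e x *ℤ o y
oo-sum x y = trans (cong (_*ℤ o y) (table-+ o′ x y)) (by-cases₂ (λ i j → o′ (i ⊕ j) *ℤ o′ j ℤₚ.≟ e′ i *ℤ o′ j) (residue x) (residue y))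

oe-sum : ∀ x y → o (x +ℤ y) *ℤ e y ≡ o x *ℤ e y
oe-sum x y = trans (cong (_*ℤ e y) (table-+ o′ x y)) (by-cases₂ (λ i j → o′ (i ⊕ j) *ℤ e′ j ℤₚ.≟ o′ i *ℤ e′ j) (residue x) (residue y))

reflect-term : ∀ {p} q c f h g k r s → p ≡ q +ℤ c *ℤ (f *ℤ h) → r *ℤ s ≡ g *ℤ k → p *ℤ r *ℤ s ≡ q *ℤ r *ℤ s +ℤ c *ℤ (f *ℤ g *ℤ (h *ℤ k))
reflect-term q c f h g k r s refl eq = trans (arith q c f h r s) (trans (cong (λ z → q *ℤ r *ℤ s +ℤ c *ℤ (f *ℤ h *ℤ z)) eq) (arith₂ (q *ℤ r *ℤ s) c f h g k))
  where
  arith : ∀ q c f h r s → (q +ℤ c *ℤ (f *ℤ h)) *ℤ r *ℤ s ≡ q *ℤ r *ℤ s +ℤ c *ℤ (f *ℤ h *ℤ (r *ℤ s))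
  arith = ℤ-Ring.solve-∀
  arith₂ : ∀ q c f h g k → q +ℤ c *ℤ (f *ℤ h *ℤ (g *ℤ k)) ≡ q +ℤ c *ℤ (f *ℤ g *ℤ (h *ℤ k))
  arith₂ = ℤ-Ring.solve-∀

replace-differences : ∀ {y z d} m p q → m +ℤ m +ℤ y +ℤ z ≡ d → y ≡ p → z ≡ q → m +ℤ m ≡ d -ℤ p -ℤ q
replace-differences {y} {z} m p q refl refl refl = arith m y z
  where
  arith : ∀ m p q → m +ℤ m ≡ m +ℤ m +ℤ p +ℤ q -ℤ p -ℤ q
  arith = ℤ-Ring.solve-∀

-- Each of Y⁻ - Y⁺ and Z⁻ - Z⁺ contributes -2 E₄(q²) E₄ᵒ(q²); moved to the other side, they account
-- for the four copies of `E₄ ⊛ E₄ᵒ`.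
E₈ᵒ² : E₈ᵒ ⊛ E₈ᵒ ⊞ E₈ᵒ ⊛ E₈ᵒ ≈ dil (weighted (λ k → oo+ωω (k + k)) ⊞ (E₄ ⊛ E₄ᵒ ⊞ E₄ ⊛ E₄ᵒ ⊞ (E₄ ⊛ E₄ᵒ ⊞ E₄ ⊛ E₄ᵒ)))
E₈ᵒ² n = begin
  (E₈ᵒ ⊛ E₈ᵒ) n +ℤ (E₈ᵒ ⊛ E₈ᵒ) n
    ≡⟨ cong₂ _+ℤ_ (M-series ω ω o o n) (M-series ω ω o o n) ⟨
  ser Quads ωωoo.M n +ℤ ser Quads ωωoo.M n
    ≡⟨ replace-differences (ser Quads ωωoo.M n) (-[1+ 1 ] *ℤ dil (E₄ ⊛ E₄ᵒ) n) (-[1+ 1 ] *ℤ dil (E₄ ⊛ E₄ᵒ) n) (ωωoo.liouville n)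
         (trans (difference ωωoo.Y⁻ ωωoo.Y⁺ -[1+ 1 ] ε e η o (λ a x b y →
                   reflect-term (ω (+ a) *ℤ ω (+ a +ℤ + b)) -[1+ 1 ] (ε (+ a)) (η (+ b)) (e (+ x)) (o (+ y)) (o (+ x +ℤ + y)) (o (+ y)) (ω-reflectʳ (+ a) (+ b)) (oo-sum (+ x) (+ y))) n)
           (cong (-[1+ 1 ] *ℤ_) (trans (⊛-cong (D-e ε) (Dη o) n) (sym (dil-⊛ E₄ E₄ᵒ n)))))
         (trans (difference ωωoo.Z⁻ ωωoo.Z⁺ -[1+ 1 ] η o ε e (λ a x b y → begin
                   ω (+ b -ℤ + a) *ℤ ω (+ b) *ℤ o (+ x) *ℤ o (+ x +ℤ + y)
                     ≡⟨ cong₂ (λ p q → p *ℤ o (+ x) *ℤ o q) (ℤₚ.*-comm (ω (+ b -ℤ + a)) (ω (+ b))) (ℤₚ.+-comm (+ x) (+ y)) ⟩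
                   ω (+ b) *ℤ ω (+ b -ℤ + a) *ℤ o (+ x) *ℤ o (+ y +ℤ + x)
                     ≡⟨ reflect-term (ω (+ b) *ℤ ω (+ b +ℤ + a)) -[1+ 1 ] (ε (+ b)) (η (+ a)) (o (+ x)) (e (+ y)) (o (+ x)) (o (+ y +ℤ + x)) (ω-reflectʳ (+ b) (+ a))
                          (trans (ℤₚ.*-comm (o (+ x)) _) (trans (oo-sum (+ y) (+ x)) (ℤₚ.*-comm (e (+ y)) (o (+ x))))) ⟩
                   ω (+ b) *ℤ ω (+ b +ℤ + a) *ℤ o (+ x) *ℤ o (+ y +ℤ + x) +ℤ -[1+ 1 ] *ℤ (ε (+ b) *ℤ o (+ x) *ℤ (η (+ a) *ℤ e (+ y)))
                     ≡⟨ cong₂ _+ℤ_ (cong₂ (λ p q → p *ℤ o (+ x) *ℤ o q) (ℤₚ.*-comm (ω (+ b)) (ω (+ b +ℤ + a))) (ℤₚ.+-comm (+ y) (+ x)))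
                          (cong (-[1+ 1 ] *ℤ_) (swap (ε (+ b)) (o (+ x)) (η (+ a)) (e (+ y)))) ⟩
                   ω (+ b +ℤ + a) *ℤ ω (+ b) *ℤ o (+ x) *ℤ o (+ x +ℤ + y) +ℤ -[1+ 1 ] *ℤ (η (+ a) *ℤ o (+ x) *ℤ (ε (+ b) *ℤ e (+ y))) ∎) n)
           (cong (-[1+ 1 ] *ℤ_) (trans (⊛-cong (Dη o) (D-e ε) n) (trans (⊛-comm (dil E₄ᵒ) (dil E₄) n) (sym (dil-⊛ E₄ E₄ᵒ n)))))) ⟩
  ser Factorisations ωωoo.D n -ℤ -[1+ 1 ] *ℤ dil (E₄ ⊛ E₄ᵒ) n -ℤ -[1+ 1 ] *ℤ dil (E₄ ⊛ E₄ᵒ) n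
    ≡⟨ arith₂ (ser Factorisations ωωoo.D n) (dil (E₄ ⊛ E₄ᵒ) n) ⟩
  ser Factorisations ωωoo.D n +ℤ (dil (E₄ ⊛ E₄ᵒ) n +ℤ dil (E₄ ⊛ E₄ᵒ) n +ℤ (dil (E₄ ⊛ E₄ᵒ) n +ℤ dil (E₄ ⊛ E₄ᵒ) n))
    ≡⟨ cong (_+ℤ (dil (E₄ ⊛ E₄ᵒ) n +ℤ dil (E₄ ⊛ E₄ᵒ) n +ℤ (dil (E₄ ⊛ E₄ᵒ) n +ℤ dil (E₄ ⊛ E₄ᵒ) n))) (trans
         (ser-cong Factorisations (λ (d , e) _ → trans (arith (ω (+ d) *ℤ ω (+ d)) (o (+ d) *ℤ o (+ d)) (conv o o e) (conv ω ω e) (o (+ d) *ℤ (ω (+ e) *ℤ conv ω one e)) (o (+ d) *ℤ (ω (+ e) *ℤ conv one ω e)))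
           (trans (cong₂ (λ p q → p *ℤ conv o o e +ℤ q *ℤ conv ω ω e) (by-cases₁ (λ i → ω′ i *ℤ ω′ i ℤₚ.≟ o′ i) (residue (+ d))) (o²≡o (+ d)))
             (sym (ℤₚ.*-distribˡ-+ (o (+ d)) (conv o o e) (conv ω ω e))))) n)
         (weighted-double oo+ωω oo+ωω-odd n)) ⟩
  dil W n +ℤ (dil (E₄ ⊛ E₄ᵒ) n +ℤ dil (E₄ ⊛ E₄ᵒ) n +ℤ (dil (E₄ ⊛ E₄ᵒ) n +ℤ dil (E₄ ⊛ E₄ᵒ) n))
    ≡⟨ cong (dil W n +ℤ_) (trans (cong₂ _+ℤ_ (dil-⊞ (E₄ ⊛ E₄ᵒ) (E₄ ⊛ E₄ᵒ) n) (dil-⊞ (E₄ ⊛ E₄ᵒ) (E₄ ⊛ E₄ᵒ) n)) refl) ⟨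
  dil W n +ℤ (dil (E₄ ⊛ E₄ᵒ ⊞ E₄ ⊛ E₄ᵒ) n +ℤ dil (E₄ ⊛ E₄ᵒ ⊞ E₄ ⊛ E₄ᵒ) n)
    ≡⟨ trans (dil-⊞ W (E₄ ⊛ E₄ᵒ ⊞ E₄ ⊛ E₄ᵒ ⊞ (E₄ ⊛ E₄ᵒ ⊞ E₄ ⊛ E₄ᵒ)) n) (cong (dil W n +ℤ_) (dil-⊞ (E₄ ⊛ E₄ᵒ ⊞ E₄ ⊛ E₄ᵒ) (E₄ ⊛ E₄ᵒ ⊞ E₄ ⊛ E₄ᵒ) n)) ⟨
  dil (W ⊞ (E₄ ⊛ E₄ᵒ ⊞ E₄ ⊛ E₄ᵒ ⊞ (E₄ ⊛ E₄ᵒ ⊞ E₄ ⊛ E₄ᵒ))) n ∎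
  where
  open ≡-Reasoning
  W = weighted (λ k → oo+ωω (k + k))
  swap : ∀ p q r s → p *ℤ q *ℤ (r *ℤ s) ≡ r *ℤ q *ℤ (p *ℤ s)
  swap = ℤ-Ring.solve-∀
  arith : ∀ p q x y r s → p *ℤ x +ℤ q *ℤ y -ℤ 0ℤ *ℤ r -ℤ 0ℤ *ℤ s ≡ p *ℤ x +ℤ q *ℤ y
  arith = ℤ-Ring.solve-∀
  arith₂ : ∀ d p → d -ℤ -[1+ 1 ] *ℤ p -ℤ -[1+ 1 ] *ℤ p ≡ d +ℤ (p +ℤ p +ℤ (p +ℤ p))
  arith₂ = ℤ-Ring.solve-∀

-- Theta series as Lambert series

lowest-coefficient : ∀ d s n → (∀ i → i < n → d i ≡ 0ℤ) → s 0 ≡ 0ℤ → (d ⊛ s) (suc n) ≡ d n *ℤ s 1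
lowest-coefficient d s zero _ s0 = trans (cong (λ z → d 0 *ℤ s 1 +ℤ d 1 *ℤ z) s0) (arith (d 0 *ℤ s 1) (d 1))
  where
  arith : ∀ p q → p +ℤ q *ℤ 0ℤ ≡ p
  arith = ℤ-Ring.solve-∀
lowest-coefficient d s (suc n) below s0 = trans (cong (λ z → z *ℤ s (2 + n) +ℤ (tail d ⊛ s) (suc n)) (below 0 (s≤s z≤n)))
  (trans (arith (s (2 + n)) _) (lowest-coefficient (tail d) s n (λ i i<n → below (suc i) (s≤s i<n)) s0))
  where
  arith : ∀ p q → 0ℤ *ℤ p +ℤ q ≡ q
  arith = ℤ-Ring.solve-∀

⊛-agree : ∀ {f f′ g g′} n → (∀ i → i ≤ n → f i ≡ f′ i) → (∀ i → i ≤ n → g i ≡ g′ i) → (f ⊛ g) n ≡ (f′ ⊛ g′) n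
⊛-agree zero p q = cong₂ _*ℤ_ (p 0 z≤n) (q 0 z≤n)
⊛-agree (suc n) p q = cong₂ _+ℤ_ (cong₂ _*ℤ_ (p 0 z≤n) (q (suc n) ℕₚ.≤-refl))
  (⊛-agree n (λ i i≤n → p (suc i) (s≤s i≤n)) (λ i i≤n → q i (ℕₚ.m≤n⇒m≤1+n i≤n)))

dil-agree : ∀ {f f′} n → (∀ i → i + i ≤ n → f i ≡ f′ i) → dil f n ≡ dil f′ n
dil-agree {f} {f′} n p with parity n
... | even k = trans (dil-double f k) (trans (p k ℕₚ.≤-refl) (sym (dil-double f′ k)))
... | odd k = trans (dil-odd f k) (sym (dil-odd f′ k))

dil-injective : ∀ {f g} → dil f ≈ dil g → f ≈ g
dil-injective {f} {g} p n = trans (sym (dil-double f n)) (trans (p (n + n)) (dil-double g n))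

-- Coefficient n + 3 of a dilated series reaches index (n + 3)/2 at most, strictly below the index n
-- + 2 being determined. The inequality fails for the first two indices, which therefore serve as
-- initial data.
half-below : ∀ {k n} → k + k ≤ 3 + n → k < 2 + n
half-below {k} {n} k+k≤ with k ℕₚ.<? 2 + n
... | yes k< = k<
... | no k≮ = ⊥-elim (ℕₚ.<⇒≱ (ℕₚ.≤-trans (ℕₚ.≤-trans (ℕₚ.≤-reflexive (ℕₚ.+-comm 2 (2 + n))) (ℕₚ.+-monoʳ-≤ (2 + n) (ℕₚ.m≤m+n 2 n)))
    (ℕₚ.+-mono-≤ (ℕₚ.≮⇒≥ k≮) (ℕₚ.≮⇒≥ k≮))) k+k≤)

-- Cancellation one coefficient at a time: if f and f′ agree below n, the lowest possible term of (f
-- - f′) s sits at n + 1 and is (f - f′)(n) times the nonzero s(1).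
cancel-coefficient : ∀ {f f′ s} n m → s 1 ≡ + suc m → s 0 ≡ 0ℤ → (∀ i → i < n → f i ≡ f′ i) →
  (f ⊛ s) (suc n) ≡ (f′ ⊛ s) (suc n) → f n ≡ f′ n
cancel-coefficient {f} {f′} {s} n m s1 s0 below eq = ℤₚ.i-j≡0⇒i≡j (f n) (f′ n) (ℤₚ.*-cancelʳ-≡ _ 0ℤ (+ suc m) (begin
  (f n -ℤ f′ n) *ℤ + suc m              ≡⟨ cong ((f n -ℤ f′ n) *ℤ_) s1 ⟨
  (f ⊞ ⊟ f′) n *ℤ s 1                   ≡⟨ lowest-coefficient (f ⊞ ⊟ f′) s n (λ i i<n → trans (cong (_-ℤ f′ i) (below i i<n)) (ℤₚ.+-inverseʳ (f′ i))) s0 ⟨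
  ((f ⊞ ⊟ f′) ⊛ s) (suc n)              ≡⟨ solve 3 (λ f f′ s → (f :- f′) :* s := f :* s :- f′ :* s) (λ _ → refl) f f′ s (suc n) ⟩
  (f ⊛ s) (suc n) -ℤ (f′ ⊛ s) (suc n)   ≡⟨ cong (_-ℤ (f′ ⊛ s) (suc n)) eq ⟩
  (f′ ⊛ s) (suc n) -ℤ (f′ ⊛ s) (suc n)  ≡⟨ ℤₚ.+-inverseʳ ((f′ ⊛ s) (suc n)) ⟩
  0ℤ                                    ∎))
  where open ≡-Reasoning

-- f² - f′² = (f - f′)(f + f′), and the second factor starts with 2 (m + 1) q. The common positive
-- leading coefficient fixes the choice of root.
sqrt-coefficient : ∀ {f f′} n m → f 0 ≡ 0ℤ → f′ 0 ≡ 0ℤ → f 1 ≡ + suc m → f′ 1 ≡ + suc m → (∀ i → i < n → f i ≡ f′ i) →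
  (f ⊛ f) (suc n) ≡ (f′ ⊛ f′) (suc n) → f n ≡ f′ n
sqrt-coefficient {f} {f′} n m f0 f′0 f1 f′1 below eq = cancel-coefficient {f} {f′} {f ⊞ f′} n (m + suc m) (cong₂ _+ℤ_ f1 f′1) (cong₂ _+ℤ_ f0 f′0) below (begin
  (f ⊛ (f ⊞ f′)) (suc n)                   ≡⟨ solve 2 (λ f f′ → f :* (f :+ f′) := f :* f :+ f :* f′) (λ _ → refl) f f′ (suc n) ⟩
  (f ⊛ f) (suc n) +ℤ (f ⊛ f′) (suc n)      ≡⟨ cong (_+ℤ (f ⊛ f′) (suc n)) eq ⟩
  (f′ ⊛ f′) (suc n) +ℤ (f ⊛ f′) (suc n)    ≡⟨ solve 2 (λ f f′ → f′ :* f′ :+ f :* f′ := f′ :* (f :+ f′)) (λ _ → refl) f f′ (suc n) ⟩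
  (f′ ⊛ (f ⊞ f′)) (suc n)                  ∎)
  where open ≡-Reasoning

by-coefficients : ∀ {f f′ : Series} → f 0 ≡ f′ 0 → f 1 ≡ f′ 1 → (∀ n → (∀ i → i < 2 + n → f i ≡ f′ i) → f (2 + n) ≡ f′ (2 + n)) → f ≈ f′
by-coefficients {f} {f′} p0 p1 step = <-rec (λ n → f n ≡ f′ n) λ where
  zero _ → p0
  (suc zero) _ → p1
  (suc (suc n)) rec → step n (λ i i< → rec i<)

-- For n > 0 coefficient n of `dil u` is 0 or the value of u at n/2, so u is determined by u(0) and
-- b. The agreement of b and b′ is asked only up to n, since `AGM` uses this inside its own
-- induction.
dil-unique : ∀ {u u′ b b′} → u ≈ dil u ⊞ b → u′ ≈ dil u′ ⊞ b′ → u 0 ≡ u′ 0 → ∀ n → (∀ i → i ≤ n → b i ≡ b′ i) → u n ≡ u′ n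
dil-unique {u} {u′} {b} {b′} eq eq′ u0 = <-rec (λ n → (∀ i → i ≤ n → b i ≡ b′ i) → u n ≡ u′ n) step
  where
  step : ∀ n → (∀ {k} → k < n → (∀ i → i ≤ k → b i ≡ b′ i) → u k ≡ u′ k) → (∀ i → i ≤ n → b i ≡ b′ i) → u n ≡ u′ n
  step zero rec agree = u0
  step (suc n) rec agree = trans (eq (suc n)) (trans (cong₂ _+ℤ_ (dil-agree (suc n) halves) (agree (suc n) ℕₚ.≤-refl)) (sym (eq′ (suc n))))
    where
    halves : ∀ i → i + i ≤ suc n → u i ≡ u′ i
    halves zero _ = u0
    halves (suc i) i+i≤ = rec i< (λ j j≤ → agree j (ℕₚ.≤-trans j≤ (ℕₚ.<⇒≤ i<)))
      where
      i< : suc i < suc n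
      i< = ℕₚ.≤-trans (ℕₚ.+-monoʳ-≤ 1 (ℕₚ.m≤n+m (suc i) i)) i+i≤

-- The relations are those of the arithmetic-geometric mean: with u = θ(q)² and b the odd part of u / 2,
-- u(q) + u(-q) = 2 u(q²) and u(q) u(-q) = u(-q²)².
module AGM {u u′ b b′ : Series} (mean : u ≈ dil u ⊞ (b ⊞ b)) (mean′ : u′ ≈ dil u′ ⊞ (b′ ⊞ b′)) (u0 : u 0 ≡ u′ 0)
  (square : b ⊛ b ≈ dil (b ⊛ dil u ⊞ b ⊛ dil u)) (square′ : b′ ⊛ b′ ≈ dil (b′ ⊛ dil u′ ⊞ b′ ⊛ dil u′))
  (b0 : b 0 ≡ 0ℤ) (b′0 : b′ 0 ≡ 0ℤ) (b1 : b 1 ≡ + 2) (b′1 : b′ 1 ≡ + 2) where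

  b≈b′ : b ≈ b′
  b≈b′ = by-coefficients (trans b0 (sym b′0)) (trans b1 (sym b′1)) λ n below →
    sqrt-coefficient {b} {b′} (2 + n) 1 b0 b′0 b1 b′1 below (trans (square (3 + n)) (trans (dil-agree (3 + n) λ k k+k≤ →
      let bs : ∀ i → i ≤ k → b i ≡ b′ i
          bs i i≤k = below i (ℕₚ.≤-<-trans i≤k (half-below k+k≤))
          us : ∀ i → i ≤ k → u i ≡ u′ i
          us i i≤k = dil-unique mean mean′ u0 i (λ j j≤i → cong₂ _+ℤ_ (bs j (ℕₚ.≤-trans j≤i i≤k)) (bs j (ℕₚ.≤-trans j≤i i≤k)))
          products : (b ⊛ dil u) k ≡ (b′ ⊛ dil u′) k
          products = ⊛-agree k bs (λ i i≤k → dil-agree i (λ j j+j≤i → us j (ℕₚ.≤-trans (ℕₚ.m≤m+n j j) (ℕₚ.≤-trans j+j≤i i≤k))))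
      in cong₂ _+ℤ_ products products) (sym (square′ (3 + n)))))

  u≈u′ : u ≈ u′
  u≈u′ n = dil-unique mean mean′ u0 n (λ i _ → cong₂ _+ℤ_ (b≈b′ i) (b≈b′ i))

sqrt-unique : ∀ {a a′} → a 0 ≡ 0ℤ → a′ 0 ≡ 0ℤ → a 1 ≡ + 2 → a′ 1 ≡ + 2 → a ⊛ a ≈ a′ ⊛ a′ → a ≈ a′
sqrt-unique {a} {a′} a0 a′0 a1 a′1 eq = by-coefficients (trans a0 (sym a′0)) (trans a1 (sym a′1)) λ n below →
  sqrt-coefficient {a} {a′} (2 + n) 1 a0 a′0 a1 a′1 below (eq (3 + n))

-- θ₁′ = θ₂ θ₃ θ₄: both sides satisfy the same Landen relation.
jacobi : θ₁′ ≈ θo ⊛ θe ⊛ θs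
jacobi = by-coefficients refl refl λ n below →
  cancel-coefficient {θ₁′} {G} {θo} (2 + n) 1 refl refl below (trans (θ₁′θo (3 + n)) (trans (dil-agree (3 + n) λ k k+k≤ →
    cong₂ _+ℤ_ (⊛-agree {g = θs} k (λ i i≤k → below i (ℕₚ.≤-<-trans i≤k (half-below k+k≤))) (λ _ _ → refl))
      (⊛-agree {θs} k (λ _ _ → refl) (λ i i≤k → below i (ℕₚ.≤-<-trans i≤k (half-below k+k≤))))) (sym (Gθo (3 + n)))))
  where
  G = θo ⊛ θe ⊛ θs
  -- The Landen relation of the right side is the product of those for θ₂² and θ₃ θ₄.
  Gθo : G ⊛ θo ≈ dil (G ⊛ θs ⊞ θs ⊛ G)
  Gθo = begin
    G ⊛ θo                                          ≈⟨ solve 3 (λ o e s → o :* e :* s :* o := o :* o :* (e :* s)) (λ _ → refl) θo θe θs ⟩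
    (θo ⊛ θo) ⊛ (θe ⊛ θs)                           ≈⟨ ⊛-cong θo² θeθs ⟩
    dil (θo ⊛ θe ⊞ θe ⊛ θo) ⊛ dil (θs ⊛ θs)         ≈⟨ dil-⊛ (θo ⊛ θe ⊞ θe ⊛ θo) (θs ⊛ θs) ⟨
    dil ((θo ⊛ θe ⊞ θe ⊛ θo) ⊛ (θs ⊛ θs))           ≈⟨ dil-cong (solve 3 (λ o e s → (o :* e :+ e :* o) :* (s :* s) := o :* e :* s :* s :+ s :* (o :* e :* s)) (λ _ → refl) θo θe θs) ⟩
    dil (G ⊛ θs ⊞ θs ⊛ G)                           ∎
    where open SetoidReasoning seriesSetoid

-- Products of theta series and their Lambert counterparts

θoθe θθ θodilθ θdilθ : Series
θoθe = θo ⊛ θe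
θθ = θ ⊛ θ
θodilθ = θo ⊛ dil θ
θdilθ = θ ⊛ dil θ

dil-square : ∀ f → dil f ⊛ dil f ≈ dil (f ⊛ f)
dil-square f = ≈-sym (dil-⊛ f f)

θe²-dil : θe ⊛ θe ≈ dil (dil θθ)
θe²-dil = begin
  θe ⊛ θe                           ≈⟨ ⊛-cong θe-dil θe-dil ⟩
  dil (dil θ) ⊛ dil (dil θ)         ≈⟨ dil-square (dil θ) ⟩
  dil (dil θ ⊛ dil θ)               ≈⟨ dil-cong (dil-square θ) ⟩
  dil (dil θθ)                       ∎
  where open SetoidReasoning seriesSetoid

θθ-mean : θθ ≈ dil θθ ⊞ (θoθe ⊞ θoθe)
θθ-mean = begin
  θ ⊛ θ                                  ≈⟨ ⊛-cong θ-split θ-split ⟩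
  (θe ⊞ θo) ⊛ (θe ⊞ θo)                  ≈⟨ solve 2 (λ e o → (e :+ o) :* (e :+ o) := e :* e :+ o :* o :+ (o :* e :+ o :* e)) (λ _ → refl) θe θo ⟩
  -- `θe²` and `θe²-dil` give θe² as the dilation of θe² + θo² and as that of `dil θθ`; dilation is
  -- injective.
  θe ⊛ θe ⊞ θo ⊛ θo ⊞ (θoθe ⊞ θoθe)            ≈⟨ ⊞-cong (dil-injective (≈-trans (≈-sym θe²) θe²-dil)) (≈-refl {θoθe ⊞ θoθe}) ⟩
  dil θθ ⊞ (θoθe ⊞ θoθe)                        ∎
  where open SetoidReasoning seriesSetoid

θoθe-square : θoθe ⊛ θoθe ≈ dil (θoθe ⊛ dil θθ ⊞ θoθe ⊛ dil θθ)
θoθe-square = begin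
  θoθe ⊛ θoθe                                    ≈⟨ solve 2 (λ o e → (o :* e) :* (o :* e) := (o :* o) :* (e :* e)) (λ _ → refl) θo θe ⟩
  (θo ⊛ θo) ⊛ (θe ⊛ θe)                    ≈⟨ ⊛-cong θo² θe²-dil ⟩
  dil (θo ⊛ θe ⊞ θe ⊛ θo) ⊛ dil (dil θθ)    ≈⟨ dil-⊛ (θo ⊛ θe ⊞ θe ⊛ θo) (dil θθ) ⟨
  dil ((θo ⊛ θe ⊞ θe ⊛ θo) ⊛ dil θθ)        ≈⟨ dil-cong (solve 3 (λ o e w → (o :* e :+ e :* o) :* w := o :* e :* w :+ o :* e :* w) (λ _ → refl) θo θe (dil θθ)) ⟩
  dil (θoθe ⊛ dil θθ ⊞ θoθe ⊛ dil θθ)              ∎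
  where open SetoidReasoning seriesSetoid

θdilθ-mean : θdilθ ≈ dil θdilθ ⊞ θodilθ
θdilθ-mean = begin
  θ ⊛ dil θ                                ≈⟨ ⊛-congʳ (dil θ) θ-split ⟩
  (θe ⊞ θo) ⊛ dil θ                        ≈⟨ ⊛-distribʳ (dil θ) θe θo ⟩
  θe ⊛ dil θ ⊞ θodilθ                           ≈⟨ ⊞-cong (≈-trans (⊛-congʳ (dil θ) θe-dil) (≈-trans (≈-sym (dil-⊛ (dil θ) θ)) (dil-cong (⊛-comm (dil θ) θ)))) (≈-refl {θodilθ}) ⟩
  dil θdilθ ⊞ θodilθ                                ∎
  where open SetoidReasoning seriesSetoid

θodilθ-square : θodilθ ⊛ θodilθ ≈ dil (θoθe ⊛ θθ ⊞ θoθe ⊛ θθ)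
θodilθ-square = begin
  θodilθ ⊛ θodilθ                                    ≈⟨ solve 2 (λ o t → (o :* t) :* (o :* t) := (o :* o) :* (t :* t)) (λ _ → refl) θo (dil θ) ⟩
  (θo ⊛ θo) ⊛ (dil θ ⊛ dil θ)              ≈⟨ ⊛-cong θo² (dil-square θ) ⟩
  dil (θo ⊛ θe ⊞ θe ⊛ θo) ⊛ dil θθ          ≈⟨ dil-⊛ (θo ⊛ θe ⊞ θe ⊛ θo) θθ ⟨
  dil ((θo ⊛ θe ⊞ θe ⊛ θo) ⊛ θθ)            ≈⟨ dil-cong (solve 3 (λ o e w → (o :* e :+ e :* o) :* w := o :* e :* w :+ o :* e :* w) (λ _ → refl) θo θe θθ) ⟩
  dil (θoθe ⊛ θθ ⊞ θoθe ⊛ θθ)                      ∎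
  where open SetoidReasoning seriesSetoid

b₄ u₄ a₈ v₈ : Series
b₄ = E₄ᵒ ⊞ E₄ᵒ
u₄ = 𝟙 ⊞ (E₄ ⊞ E₄ ⊞ (E₄ ⊞ E₄))
a₈ = E₈ᵒ ⊞ E₈ᵒ
v₈ = 𝟙 ⊞ (E₈ ⊞ E₈)

dil-u₄ : dil u₄ ≈ 𝟙 ⊞ (dil E₄ ⊞ dil E₄ ⊞ (dil E₄ ⊞ dil E₄))
dil-u₄ = begin
  dil u₄                                                 ≈⟨ dil-⊞ 𝟙 (E₄ ⊞ E₄ ⊞ (E₄ ⊞ E₄)) ⟩
  dil 𝟙 ⊞ dil (E₄ ⊞ E₄ ⊞ (E₄ ⊞ E₄))                         ≈⟨ ⊞-cong dil-𝟙 (dil-⊞ (E₄ ⊞ E₄) (E₄ ⊞ E₄)) ⟩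
  𝟙 ⊞ (dil (E₄ ⊞ E₄) ⊞ dil (E₄ ⊞ E₄))                       ≈⟨ ⊞-congˡ 𝟙 (⊞-cong (dil-⊞ E₄ E₄) (dil-⊞ E₄ E₄)) ⟩
  𝟙 ⊞ (dil E₄ ⊞ dil E₄ ⊞ (dil E₄ ⊞ dil E₄))                 ∎
  where open SetoidReasoning seriesSetoid

dil-v₈ : dil v₈ ≈ 𝟙 ⊞ (dil E₈ ⊞ dil E₈)
dil-v₈ = ≈-trans (dil-⊞ 𝟙 (E₈ ⊞ E₈)) (⊞-cong dil-𝟙 (dil-⊞ E₈ E₈))

u₄-mean : u₄ ≈ dil u₄ ⊞ (b₄ ⊞ b₄)
u₄-mean = begin
  𝟙 ⊞ (E₄ ⊞ E₄ ⊞ (E₄ ⊞ E₄))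
    ≈⟨ ⊞-congˡ 𝟙 (⊞-cong (⊞-cong (D-parity ε) (D-parity ε)) (⊞-cong (D-parity ε) (D-parity ε))) ⟩
  𝟙 ⊞ (dil E₄ ⊞ E₄ᵒ ⊞ (dil E₄ ⊞ E₄ᵒ) ⊞ (dil E₄ ⊞ E₄ᵒ ⊞ (dil E₄ ⊞ E₄ᵒ)))
    ≈⟨ solve 3 (λ i x y → i :+ (x :+ y :+ (x :+ y) :+ (x :+ y :+ (x :+ y))) := i :+ (x :+ x :+ (x :+ x)) :+ (y :+ y :+ (y :+ y))) (λ _ → refl) 𝟙 (dil E₄) E₄ᵒ ⟩
  𝟙 ⊞ (dil E₄ ⊞ dil E₄ ⊞ (dil E₄ ⊞ dil E₄)) ⊞ (b₄ ⊞ b₄)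
    ≈⟨ ⊞-cong dil-u₄ (≈-refl {b₄ ⊞ b₄}) ⟨
  dil u₄ ⊞ (b₄ ⊞ b₄) ∎
  where open SetoidReasoning seriesSetoid

v₈-mean : v₈ ≈ dil v₈ ⊞ a₈
v₈-mean = begin
  𝟙 ⊞ (E₈ ⊞ E₈)
    ≈⟨ ⊞-congˡ 𝟙 (⊞-cong (D-parity ω) (D-parity ω)) ⟩
  𝟙 ⊞ (dil E₈ ⊞ E₈ᵒ ⊞ (dil E₈ ⊞ E₈ᵒ))
    ≈⟨ solve 3 (λ i x y → i :+ (x :+ y :+ (x :+ y)) := i :+ (x :+ x) :+ (y :+ y)) (λ _ → refl) 𝟙 (dil E₈) E₈ᵒ ⟩
  𝟙 ⊞ (dil E₈ ⊞ dil E₈) ⊞ a₈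
    ≈⟨ ⊞-cong dil-v₈ (≈-refl {a₈}) ⟨
  dil v₈ ⊞ a₈ ∎
  where open SetoidReasoning seriesSetoid

weighted-expand₁ : weighted (λ k → oo+εε (k + k)) ≈ E₄ᵒ ⊞ E₄ᵒ ⊞ (weighted t₁ ⊞ weighted t₁ ⊞ (weighted t₁ ⊞ weighted t₁))
weighted-expand₁ = begin
  weighted (λ k → oo+εε (k + k))
    ≈⟨ ser-cong Factorisations (λ (d , k) _ → trans (cong (o (+ d) *ℤ_) (oo+εε-double k)) (arith (o (+ d)) (ε (+ k)) (t₁ k))) ⟩
  ser Factorisations (λ p → E p +ℤ E p +ℤ (T p +ℤ T p +ℤ (T p +ℤ T p)))
    ≈⟨ ≈-trans (ser-⊞ Factorisations (λ p → E p +ℤ E p) (λ p → T p +ℤ T p +ℤ (T p +ℤ T p))) (⊞-cong (ser-⊞ Factorisations E E)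
         (≈-trans (ser-⊞ Factorisations (λ p → T p +ℤ T p) (λ p → T p +ℤ T p)) (⊞-cong (ser-⊞ Factorisations T T) (ser-⊞ Factorisations T T)))) ⟩
  D[ o , ε ] ⊞ D[ o , ε ] ⊞ (weighted t₁ ⊞ weighted t₁ ⊞ (weighted t₁ ⊞ weighted t₁))
    ≈⟨ ⊞-cong (⊞-cong (D-comm o ε) (D-comm o ε)) (≈-refl {weighted t₁ ⊞ weighted t₁ ⊞ (weighted t₁ ⊞ weighted t₁)}) ⟩
  E₄ᵒ ⊞ E₄ᵒ ⊞ (weighted t₁ ⊞ weighted t₁ ⊞ (weighted t₁ ⊞ weighted t₁)) ∎
  where
  open SetoidReasoning seriesSetoid
  E T : ℕ × ℕ → ℤ
  E (d , k) = o (+ d) *ℤ ε (+ k)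
  T (d , k) = o (+ d) *ℤ t₁ k
  arith : ∀ p e t → p *ℤ (e +ℤ e +ℤ (t +ℤ t +ℤ (t +ℤ t))) ≡ p *ℤ e +ℤ p *ℤ e +ℤ (p *ℤ t +ℤ p *ℤ t +ℤ (p *ℤ t +ℤ p *ℤ t))
  arith = ℤ-Ring.solve-∀

weighted-expand₂ : weighted (λ k → oo+ωω (k + k)) ≈ E₄ᵒ ⊞ E₄ᵒ ⊞ (weighted t₂ ⊞ weighted t₂)
weighted-expand₂ = begin
  weighted (λ k → oo+ωω (k + k))
    ≈⟨ ser-cong Factorisations (λ (d , k) _ → trans (cong (o (+ d) *ℤ_) (oo+ωω-double k)) (arith (o (+ d)) (ε (+ k)) (t₂ k))) ⟩
  ser Factorisations (λ p → E p +ℤ E p +ℤ (T p +ℤ T p))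
    ≈⟨ ≈-trans (ser-⊞ Factorisations (λ p → E p +ℤ E p) (λ p → T p +ℤ T p)) (⊞-cong (ser-⊞ Factorisations E E) (ser-⊞ Factorisations T T)) ⟩
  D[ o , ε ] ⊞ D[ o , ε ] ⊞ (weighted t₂ ⊞ weighted t₂)
    ≈⟨ ⊞-cong (⊞-cong (D-comm o ε) (D-comm o ε)) (≈-refl {weighted t₂ ⊞ weighted t₂}) ⟩
  E₄ᵒ ⊞ E₄ᵒ ⊞ (weighted t₂ ⊞ weighted t₂) ∎
  where
  open SetoidReasoning seriesSetoid
  E T : ℕ × ℕ → ℤ
  E (d , k) = o (+ d) *ℤ ε (+ k)
  T (d , k) = o (+ d) *ℤ t₂ k
  arith : ∀ p e t → p *ℤ (e +ℤ e +ℤ (t +ℤ t)) ≡ p *ℤ e +ℤ p *ℤ e +ℤ (p *ℤ t +ℤ p *ℤ t)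
  arith = ℤ-Ring.solve-∀

b₄-square : b₄ ⊛ b₄ ≈ dil (b₄ ⊛ dil u₄ ⊞ b₄ ⊛ dil u₄)
b₄-square = begin
  b₄ ⊛ b₄
    ≈⟨ solve 1 (λ x → (x :+ x) :* (x :+ x) := (x :* x :+ x :* x) :+ (x :* x :+ x :* x)) (λ _ → refl) E₄ᵒ ⟩
  (E₄ᵒ ⊛ E₄ᵒ ⊞ E₄ᵒ ⊛ E₄ᵒ) ⊞ (E₄ᵒ ⊛ E₄ᵒ ⊞ E₄ᵒ ⊛ E₄ᵒ)
    ≈⟨ ⊞-cong E₄ᵒ² E₄ᵒ² ⟩
  dil W ⊞ dil W
    ≈⟨ dil-⊞ W W ⟨
  dil (W ⊞ W)
    ≈⟨ dil-cong (⊞-cong W-eq W-eq) ⟩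
  dil (W′ ⊞ W′)
    ≈⟨ dil-cong (solve 2 (λ x y → let w = x :+ x :+ (x :* y :+ x :* y :+ (x :* y :+ x :* y) :+ (x :* y :+ x :* y :+ (x :* y :+ x :* y)))
                                      z = (x :+ x) :* (con 1ℤ :+ (y :+ y :+ (y :+ y))) in w :+ w := z :+ z) (λ _ → refl) E₄ᵒ (dil E₄)) ⟩
  dil (b₄ ⊛ (constant 1ℤ ⊞ (dil E₄ ⊞ dil E₄ ⊞ (dil E₄ ⊞ dil E₄))) ⊞ b₄ ⊛ (constant 1ℤ ⊞ (dil E₄ ⊞ dil E₄ ⊞ (dil E₄ ⊞ dil E₄))))
    ≈⟨ dil-cong (⊞-cong (⊛-congˡ b₄ u-eq) (⊛-congˡ b₄ u-eq)) ⟩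
  dil (b₄ ⊛ dil u₄ ⊞ b₄ ⊛ dil u₄) ∎
  where
  open SetoidReasoning seriesSetoid
  W W′ X : Series
  W = weighted (λ k → oo+εε (k + k))
  X = E₄ᵒ ⊛ dil E₄ ⊞ E₄ᵒ ⊛ dil E₄
  W′ = E₄ᵒ ⊞ E₄ᵒ ⊞ (X ⊞ X ⊞ (X ⊞ X))
  X-eq : weighted t₁ ≈ X
  X-eq = ≈-sym E₄ᵒ-dilE₄
  W-eq : W ≈ W′
  W-eq = ≈-trans weighted-expand₁ (⊞-congˡ (E₄ᵒ ⊞ E₄ᵒ) (⊞-cong (⊞-cong X-eq X-eq) (⊞-cong X-eq X-eq)))
  u-eq : constant 1ℤ ⊞ (dil E₄ ⊞ dil E₄ ⊞ (dil E₄ ⊞ dil E₄)) ≈ dil u₄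
  u-eq = ≈-trans (⊞-cong (λ n → ℤₚ.*-identityˡ (𝟙 n)) (≈-refl {dil E₄ ⊞ dil E₄ ⊞ (dil E₄ ⊞ dil E₄)})) (≈-sym dil-u₄)

a₈-square : a₈ ⊛ a₈ ≈ dil (b₄ ⊛ u₄ ⊞ b₄ ⊛ u₄)
a₈-square = begin
  a₈ ⊛ a₈
    ≈⟨ solve 1 (λ x → (x :+ x) :* (x :+ x) := (x :* x :+ x :* x) :+ (x :* x :+ x :* x)) (λ _ → refl) E₈ᵒ ⟩
  (E₈ᵒ ⊛ E₈ᵒ ⊞ E₈ᵒ ⊛ E₈ᵒ) ⊞ (E₈ᵒ ⊛ E₈ᵒ ⊞ E₈ᵒ ⊛ E₈ᵒ)
    ≈⟨ ⊞-cong E₈ᵒ² E₈ᵒ² ⟩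
  dil W ⊞ dil W
    ≈⟨ dil-⊞ W W ⟨
  dil (W ⊞ W)
    ≈⟨ dil-cong (⊞-cong W-eq W-eq) ⟩
  dil (W′ ⊞ W′)
    ≈⟨ dil-cong (solve 2 (λ x y → let w = x :+ x :+ (x :* y :+ x :* y :+ (x :* y :+ x :* y)) :+ (y :* x :+ y :* x :+ (y :* x :+ y :* x))
                                      z = (x :+ x) :* (con 1ℤ :+ (y :+ y :+ (y :+ y))) in w :+ w := z :+ z) (λ _ → refl) E₄ᵒ E₄) ⟩
  dil (b₄ ⊛ (constant 1ℤ ⊞ (E₄ ⊞ E₄ ⊞ (E₄ ⊞ E₄))) ⊞ b₄ ⊛ (constant 1ℤ ⊞ (E₄ ⊞ E₄ ⊞ (E₄ ⊞ E₄))))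
    ≈⟨ dil-cong (⊞-cong (⊛-congˡ b₄ u-eq) (⊛-congˡ b₄ u-eq)) ⟩
  dil (b₄ ⊛ u₄ ⊞ b₄ ⊛ u₄) ∎
  where
  open SetoidReasoning seriesSetoid
  Y W W′ X : Series
  Y = E₄ ⊛ E₄ᵒ ⊞ E₄ ⊛ E₄ᵒ ⊞ (E₄ ⊛ E₄ᵒ ⊞ E₄ ⊛ E₄ᵒ)
  W = weighted (λ k → oo+ωω (k + k)) ⊞ Y
  X = E₄ᵒ ⊛ E₄ ⊞ E₄ᵒ ⊛ E₄
  W′ = E₄ᵒ ⊞ E₄ᵒ ⊞ (X ⊞ X) ⊞ Y
  X-eq : weighted t₂ ≈ X
  X-eq = ≈-sym E₄ᵒ-E₄
  W-eq : W ≈ W′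
  W-eq = ⊞-cong (≈-trans weighted-expand₂ (⊞-congˡ (E₄ᵒ ⊞ E₄ᵒ) (⊞-cong X-eq X-eq))) (≈-refl {Y})
  u-eq : constant 1ℤ ⊞ (E₄ ⊞ E₄ ⊞ (E₄ ⊞ E₄)) ≈ u₄
  u-eq = ⊞-cong (λ n → ℤₚ.*-identityˡ (𝟙 n)) (≈-refl {E₄ ⊞ E₄ ⊞ (E₄ ⊞ E₄)})

module TwoSquares = AGM {u₄} {θθ} {b₄} {θoθe} u₄-mean θθ-mean refl b₄-square θoθe-square refl refl refl refl

-- Jacobi's two-square theorem: n > 0 is a sum of two squares in 4 Σ (-4/d) ways.
u₄≈θθ : u₄ ≈ θθ
u₄≈θθ = TwoSquares.u≈u′

b₄≈θoθe : b₄ ≈ θoθe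
b₄≈θoθe = TwoSquares.b≈b′

-- The squares agree by the two-square theorem and its odd part; the leading coefficient 2 selects
-- the root.
a₈≈θodilθ : a₈ ≈ θodilθ
a₈≈θodilθ = sqrt-unique refl refl refl refl (≈-trans a₈-square (≈-trans (dil-cong (⊞-cong (⊛-cong b₄≈θoθe u₄≈θθ) (⊛-cong b₄≈θoθe u₄≈θθ))) (≈-sym θodilθ-square)))

-- Dirichlet's formula for x² + 2 y²: n > 0 has 2 Σ (-8/d) representations.
v₈≈θdilθ : v₈ ≈ θdilθ
v₈≈θdilθ n = dil-unique v₈-mean θdilθ-mean refl n (λ i _ → a₈≈θodilθ i)

-- The generating function of the number of (x , y , z , w) with x odd, weight x² + 2 y² + 4 z² + 4 w².
quaternary : Series
quaternary = θo ⊛ dil θ ⊛ (θe ⊛ θe)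

quaternary-E₈ : quaternary ≈ a₈ ⊛ dil (dil u₄)
quaternary-E₈ = ≈-sym (⊛-cong a₈≈θodilθ (≈-trans (dil-cong (dil-cong u₄≈θθ)) (≈-sym θe²-dil)))

quaternary-E₄ : quaternary ≈ b₄ ⊛ dil v₈
quaternary-E₄ = begin
  θo ⊛ dil θ ⊛ (θe ⊛ θe)          ≈⟨ solve 3 (λ o t e → o :* t :* (e :* e) := (o :* e) :* (e :* t)) (λ _ → refl) θo (dil θ) θe ⟩
  θoθe ⊛ (θe ⊛ dil θ)                ≈⟨ ⊛-cong (≈-sym b₄≈θoθe) (≈-trans (⊛-congʳ (dil θ) θe-dil) (≈-trans (≈-sym (dil-⊛ (dil θ) θ)) (dil-cong (≈-trans (⊛-comm (dil θ) θ) (≈-sym v₈≈θdilθ))))) ⟩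
  b₄ ⊛ dil v₈                       ∎
  where open SetoidReasoning seriesSetoid

-- The quaternary count at odd arguments

ddE₄ : Series
ddE₄ = dil (dil E₄)

-- Liouville's identity for the mixed pair `ε`, `ω`. The error of the addition law produces E₈ᵒ
-- E₄(q⁴), which is the product occurring in the other factorisation of `quaternary`.
E₄ᵒ-dilE₈ : ∀ n → (E₄ᵒ ⊛ dil E₈) n +ℤ (E₄ᵒ ⊛ dil E₈) n ≡
  ser Factorisations (λ (d , k) → δ (+ d) *ℤ conv o e k -ℤ o (+ d) *ℤ (ε (+ k) *ℤ conv one ω k)) n +ℤ + 2 *ℤ (E₈ᵒ ⊛ ddE₄) n
E₄ᵒ-dilE₈ n = begin
  (E₄ᵒ ⊛ dil E₈) n +ℤ (E₄ᵒ ⊛ dil E₈) n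
    ≡⟨ cong₂ _+ℤ_ M-eq M-eq ⟨
  ser Quads εωoe.M n +ℤ ser Quads εωoe.M n
    ≡⟨ replace-differences (ser Quads εωoe.M n) (-[1+ 1 ] *ℤ (E₈ᵒ ⊛ ddE₄) n) 0ℤ (εωoe.liouville n)
         (trans (difference εωoe.Y⁻ εωoe.Y⁺ -[1+ 1 ] ω o η e (λ a x b y →
                   reflect-term (ε (+ a) *ℤ ω (+ a +ℤ + b)) -[1+ 1 ] (ω (+ a)) (η (+ b)) (o (+ x)) (e (+ y)) (o (+ x +ℤ + y)) (e (+ y)) (εω-reflectʳ (+ a) (+ b)) (oe-sum (+ x) (+ y))) n)
           (cong (-[1+ 1 ] *ℤ_) (⊛-congˡ E₈ᵒ (≈-trans (Dη e) (dil-cong (D-e ε))) n)))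
         (trans (cong (_-ℤ ser Quads εωoe.Z⁺ n) (ser-cong Quads {εωoe.Z⁻} {εωoe.Z⁺} (λ ((a , x) , (b , y)) _ → cong (λ z → z *ℤ o (+ x) *ℤ e (+ x +ℤ + y)) (εω-reflectˡ (+ a) (+ b))) n))
           (ℤₚ.+-inverseʳ (ser Quads εωoe.Z⁺ n))) ⟩
  ser Factorisations εωoe.D n -ℤ -[1+ 1 ] *ℤ (E₈ᵒ ⊛ ddE₄) n -ℤ 0ℤ
    ≡⟨ arith₂ (ser Factorisations εωoe.D n) ((E₈ᵒ ⊛ ddE₄) n) ⟩
  ser Factorisations εωoe.D n +ℤ + 2 *ℤ (E₈ᵒ ⊛ ddE₄) n
    ≡⟨ cong (_+ℤ + 2 *ℤ (E₈ᵒ ⊛ ddE₄) n) (ser-cong Factorisations (λ (d , k) _ → trans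
         (cong₂ (λ p q → p *ℤ conv o e k +ℤ q *ℤ conv ε ω k -ℤ 0ℤ *ℤ (e (+ d) *ℤ (ω (+ k) *ℤ conv ε one k)) -ℤ 1ℤ *ℤ (o (+ d) *ℤ (ε (+ k) *ℤ conv one ω k)))
           (by-cases₁ (λ i → ε′ i *ℤ ω′ i ℤₚ.≟ δ′ i) (residue (+ d))) (by-cases₁ (λ i → o′ i *ℤ e′ i ℤₚ.≟ 0ℤ) (residue (+ d))))
         (arith (δ (+ d)) (conv o e k) (conv ε ω k) (e (+ d) *ℤ (ω (+ k) *ℤ conv ε one k)) (o (+ d) *ℤ (ε (+ k) *ℤ conv one ω k)))) n) ⟩
  _ ∎
  where
  open ≡-Reasoning
  M-eq : ser Quads εωoe.M n ≡ (E₄ᵒ ⊛ dil E₈) n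
  M-eq = trans (M-series ε ω o e n) (⊛-congˡ E₄ᵒ (D-e ω) n)
  arith : ∀ p x y r s → p *ℤ x +ℤ 0ℤ *ℤ y -ℤ 0ℤ *ℤ r -ℤ 1ℤ *ℤ s ≡ p *ℤ x -ℤ s
  arith = ℤ-Ring.solve-∀
  arith₂ : ∀ d p → d -ℤ -[1+ 1 ] *ℤ p -ℤ 0ℤ ≡ d +ℤ + 2 *ℤ p
  arith₂ = ℤ-Ring.solve-∀

divisorSeries : Series
divisorSeries = ser Factorisations (λ (d , k) → δ (+ d) *ℤ + k)

o-factor : ∀ d k → o (+ (d * k)) ≡ 1ℤ → o (+ d) ≡ 1ℤ × o (+ k) ≡ 1ℤ
o-factor d k odd-product =
  trans (trans (sym (ℤₚ.*-identityʳ (o (+ d)))) (cong (o (+ d) *ℤ_) (sym odd′))) (trans (by-cases₂ (λ i j → o′ i *ℤ o′ (i ⊙ j) ℤₚ.≟ o′ (i ⊙ j)) (residue (+ d)) (residue (+ k))) odd′) ,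
  trans (trans (sym (ℤₚ.*-identityʳ (o (+ k)))) (cong (o (+ k) *ℤ_) (sym odd′))) (trans (by-cases₂ (λ i j → o′ j *ℤ o′ (i ⊙ j) ℤₚ.≟ o′ (i ⊙ j)) (residue (+ d)) (residue (+ k))) odd′)
  where
  odd′ : o′ (residue (+ d) ⊙ residue (+ k)) ≡ 1ℤ
  odd′ = trans (cong o′ (sym (residue-* d k))) odd-product

module _ (n : ℕ) (odd-n : o (+ n) ≡ 1ℤ) where
  private
    N = enum Factorisations n

    -- For odd k, 2 `conv o e k` is k - 1, and `ε` times `partial-ω` is the combination 2 `ε` - `δ`
    -- - `ω` of characters.
    pointwise : ∀ d k → o (+ d) ≡ 1ℤ × o (+ k) ≡ 1ℤ →
      + 2 *ℤ (δ (+ d) *ℤ conv o e k -ℤ o (+ d) *ℤ (ε (+ k) *ℤ conv one ω k)) ≡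
      δ (+ d) *ℤ + k +ℤ -[1+ 0 ] *ℤ (δ (+ d) *ℤ 1ℤ) +ℤ (-[1+ 1 ] *ℤ (1ℤ *ℤ ε (+ k)) +ℤ (1ℤ *ℤ δ (+ k) +ℤ 1ℤ *ℤ ω (+ k)))
    pointwise d k (odd-d , odd-k) = begin
      + 2 *ℤ (δ (+ d) *ℤ conv o e k -ℤ o (+ d) *ℤ (ε (+ k) *ℤ conv one ω k))
        ≡⟨ cong (λ z → + 2 *ℤ (δ (+ d) *ℤ conv o e k -ℤ z *ℤ (ε (+ k) *ℤ conv one ω k))) odd-d ⟩
      + 2 *ℤ (δ (+ d) *ℤ conv o e k -ℤ 1ℤ *ℤ (ε (+ k) *ℤ conv one ω k))
        ≡⟨ arith₁ (δ (+ d)) (conv o e k) (ε (+ k)) (conv one ω k) ⟩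
      δ (+ d) *ℤ (+ 2 *ℤ conv o e k) -ℤ ε (+ k) *ℤ (+ 2 *ℤ conv one ω k)
        ≡⟨ cong₂ (λ p q → δ (+ d) *ℤ p -ℤ ε (+ k) *ℤ q) (trans (conv-oe k) (cong (λ z → + k *ℤ z +ℤ -ℤ z) odd-k)) (conv-1ω k) ⟩
      δ (+ d) *ℤ (+ k *ℤ 1ℤ +ℤ -[1+ 0 ]) -ℤ ε (+ k) *ℤ (+ k *ℤ 0ℤ +ℤ partial-ω (residue (+ k)))
        ≡⟨ arith₂ (δ (+ d)) (+ k) (ε (+ k)) (partial-ω (residue (+ k))) ⟩
      δ (+ d) *ℤ + k +ℤ -[1+ 0 ] *ℤ (δ (+ d) *ℤ 1ℤ) +ℤ -[1+ 0 ] *ℤ (ε (+ k) *ℤ partial-ω (residue (+ k)))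
        ≡⟨ cong (λ z → δ (+ d) *ℤ + k +ℤ -[1+ 0 ] *ℤ (δ (+ d) *ℤ 1ℤ) +ℤ z) (by-cases₁ (λ i → -[1+ 0 ] *ℤ (ε′ i *ℤ partial-ω i) ℤₚ.≟ -[1+ 1 ] *ℤ (1ℤ *ℤ ε′ i) +ℤ (1ℤ *ℤ δ′ i +ℤ 1ℤ *ℤ ω′ i)) (residue (+ k))) ⟩
      δ (+ d) *ℤ + k +ℤ -[1+ 0 ] *ℤ (δ (+ d) *ℤ 1ℤ) +ℤ (-[1+ 1 ] *ℤ (1ℤ *ℤ ε (+ k)) +ℤ (1ℤ *ℤ δ (+ k) +ℤ 1ℤ *ℤ ω (+ k))) ∎
      where
      open ≡-Reasoning
      arith₁ : ∀ p c q r → + 2 *ℤ (p *ℤ c -ℤ 1ℤ *ℤ (q *ℤ r)) ≡ p *ℤ (+ 2 *ℤ c) -ℤ q *ℤ (+ 2 *ℤ r)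
      arith₁ = ℤ-Ring.solve-∀
      arith₂ : ∀ p k q r → p *ℤ (k *ℤ 1ℤ +ℤ -[1+ 0 ]) -ℤ q *ℤ (k *ℤ 0ℤ +ℤ r) ≡ p *ℤ k +ℤ -[1+ 0 ] *ℤ (p *ℤ 1ℤ) +ℤ -[1+ 0 ] *ℤ (q *ℤ r)
      arith₂ = ℤ-Ring.solve-∀

    correction : ℕ × ℕ → ℤ
    correction (d , k) = δ (+ d) *ℤ conv o e k -ℤ o (+ d) *ℤ (ε (+ k) *ℤ conv one ω k)

    -- Exchanging d and k cancels the sum of `δ` over d against that over k, so `δ` remains only in
    -- the weighted divisor sum.
    correction-sum : + 2 *ℤ ser Factorisations correction n ≡ divisorSeries n -ℤ + 2 *ℤ E₄ n +ℤ E₈ n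
    correction-sum = begin
      + 2 *ℤ ser Factorisations correction n
        ≡⟨ ser-scale Factorisations (+ 2) correction n ⟨
      sumE N (λ p → + 2 *ℤ correction p)
        ≡⟨ sumE-cong N (λ (d , k) (_ , w) → pointwise d k (o-factor d k (trans (cong (o ∘ +_) w) odd-n))) ⟩
      sumE N (λ p → s p +ℤ -[1+ 0 ] *ℤ x p +ℤ (-[1+ 1 ] *ℤ y p +ℤ (z p +ℤ w p)))
        ≡⟨ trans (ser-⊞ Factorisations (λ p → s p +ℤ -[1+ 0 ] *ℤ x p) (λ p → -[1+ 1 ] *ℤ y p +ℤ (z p +ℤ w p)) n)
             (cong₂ _+ℤ_ (trans (ser-⊞ Factorisations s (λ p → -[1+ 0 ] *ℤ x p) n) (cong (divisorSeries n +ℤ_) (ser-scale Factorisations -[1+ 0 ] x n)))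
               (trans (ser-⊞ Factorisations (λ p → -[1+ 1 ] *ℤ y p) (λ p → z p +ℤ w p) n) (cong₂ _+ℤ_ (ser-scale Factorisations -[1+ 1 ] y n) (ser-⊞ Factorisations z w n)))) ⟩
      divisorSeries n +ℤ -[1+ 0 ] *ℤ D[ δ , one ] n +ℤ (-[1+ 1 ] *ℤ D[ one , ε ] n +ℤ (D[ one , δ ] n +ℤ D[ one , ω ] n))
        ≡⟨ cong₂ (λ p q → divisorSeries n +ℤ -[1+ 0 ] *ℤ D[ δ , one ] n +ℤ (-[1+ 1 ] *ℤ p +ℤ q)) (D-comm one ε n) (cong₂ _+ℤ_ (D-comm one δ n) (D-comm one ω n)) ⟩
      divisorSeries n +ℤ -[1+ 0 ] *ℤ D[ δ , one ] n +ℤ (-[1+ 1 ] *ℤ E₄ n +ℤ (D[ δ , one ] n +ℤ E₈ n))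
        ≡⟨ arith (divisorSeries n) (D[ δ , one ] n) (E₄ n) (E₈ n) ⟩
      divisorSeries n -ℤ + 2 *ℤ E₄ n +ℤ E₈ n ∎
      where
      open ≡-Reasoning
      s x y z w : ℕ × ℕ → ℤ
      s (d , k) = δ (+ d) *ℤ + k
      x (d , k) = δ (+ d) *ℤ 1ℤ
      y (d , k) = 1ℤ *ℤ ε (+ k)
      z (d , k) = 1ℤ *ℤ δ (+ k)
      w (d , k) = 1ℤ *ℤ ω (+ k)
      arith : ∀ s x b a → s +ℤ -[1+ 0 ] *ℤ x +ℤ (-[1+ 1 ] *ℤ b +ℤ (x +ℤ a)) ≡ s -ℤ + 2 *ℤ b +ℤ a
      arith = ℤ-Ring.solve-∀

    dil-at-odd : ∀ f → dil f n ≡ 0ℤ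
    dil-at-odd f with parity n
    ... | odd k = dil-odd f k
    ... | even k with () ← trans (sym odd-n) (trans (table-+ o′ (+ k) (+ k)) (by-cases₁ (λ i → o′ (i ⊕ i) ℤₚ.≟ 0ℤ) (residue (+ k))))

    E₄≡E₄ᵒ : E₄ n ≡ E₄ᵒ n
    E₄≡E₄ᵒ = trans (D-parity ε n) (trans (cong (_+ℤ E₄ᵒ n) (dil-at-odd E₄)) (ℤₚ.+-identityˡ (E₄ᵒ n)))

    E₈≡E₈ᵒ : E₈ n ≡ E₈ᵒ n
    E₈≡E₈ᵒ = trans (D-parity ω n) (trans (cong (_+ℤ E₈ᵒ n) (dil-at-odd E₈)) (ℤₚ.+-identityˡ (E₈ᵒ n)))

    quaternary-E₈′ : quaternary n ≡ + 2 *ℤ E₈ᵒ n +ℤ + 8 *ℤ (E₈ᵒ ⊛ ddE₄) n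
    quaternary-E₈′ = begin
      quaternary n
        ≡⟨ quaternary-E₈ n ⟩
      (a₈ ⊛ dil (dil u₄)) n
        ≡⟨ ⊛-congˡ a₈ (≈-trans (dil-cong dil-u₄) (≈-trans (dil-⊞ 𝟙 (dil E₄ ⊞ dil E₄ ⊞ (dil E₄ ⊞ dil E₄))) (⊞-cong (≈-trans dil-𝟙 (λ k → sym (ℤₚ.*-identityˡ (𝟙 k))))
             (≈-trans (dil-⊞ (dil E₄ ⊞ dil E₄) (dil E₄ ⊞ dil E₄)) (⊞-cong (dil-⊞ (dil E₄) (dil E₄)) (dil-⊞ (dil E₄) (dil E₄))))))) n ⟩
      (a₈ ⊛ (constant 1ℤ ⊞ (ddE₄ ⊞ ddE₄ ⊞ (ddE₄ ⊞ ddE₄)))) n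
        ≡⟨ solve 2 (λ x y → (x :+ x) :* (con 1ℤ :+ (y :+ y :+ (y :+ y))) := let z = x :* y :+ x :* y :+ (x :* y :+ x :* y) in x :+ x :+ (z :+ z)) (λ _ → refl) E₈ᵒ ddE₄ n ⟩
      _ ≡⟨ arith (E₈ᵒ n) ((E₈ᵒ ⊛ ddE₄) n) ⟩
      + 2 *ℤ E₈ᵒ n +ℤ + 8 *ℤ (E₈ᵒ ⊛ ddE₄) n ∎
      where
      open ≡-Reasoning
      arith : ∀ x y → x +ℤ x +ℤ (y +ℤ y +ℤ (y +ℤ y) +ℤ (y +ℤ y +ℤ (y +ℤ y))) ≡ + 2 *ℤ x +ℤ + 8 *ℤ y
      arith = ℤ-Ring.solve-∀

    quaternary-E₄′ : quaternary n ≡ + 2 *ℤ E₄ᵒ n +ℤ + 2 *ℤ ((E₄ᵒ ⊛ dil E₈) n +ℤ (E₄ᵒ ⊛ dil E₈) n)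
    quaternary-E₄′ = begin
      quaternary n
        ≡⟨ quaternary-E₄ n ⟩
      (b₄ ⊛ dil v₈) n
        ≡⟨ ⊛-congˡ b₄ (≈-trans dil-v₈ (⊞-cong (λ k → sym (ℤₚ.*-identityˡ (𝟙 k))) (≈-refl {dil E₈ ⊞ dil E₈}))) n ⟩
      (b₄ ⊛ (constant 1ℤ ⊞ (dil E₈ ⊞ dil E₈))) n
        ≡⟨ solve 2 (λ x y → (x :+ x) :* (con 1ℤ :+ (y :+ y)) := x :+ x :+ (x :* y :+ x :* y :+ (x :* y :+ x :* y))) (λ _ → refl) E₄ᵒ (dil E₈) n ⟩
      _ ≡⟨ arith (E₄ᵒ n) ((E₄ᵒ ⊛ dil E₈) n) ⟩
      + 2 *ℤ E₄ᵒ n +ℤ + 2 *ℤ ((E₄ᵒ ⊛ dil E₈) n +ℤ (E₄ᵒ ⊛ dil E₈) n) ∎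
      where
      open ≡-Reasoning
      arith : ∀ x y → x +ℤ x +ℤ (y +ℤ y +ℤ (y +ℤ y)) ≡ + 2 *ℤ x +ℤ + 2 *ℤ (y +ℤ y)
      arith = ℤ-Ring.solve-∀

  -- Twice the evaluation by `E₄ᵒ` minus the one by `E₈ᵒ` removes the unknown E₈ᵒ E₄(q⁴), and the
  -- sums of (-4/d) and (-8/d) drop out with it.
  quaternary-odd : quaternary n ≡ + 2 *ℤ divisorSeries n
  quaternary-odd = eliminate (quaternary n) (divisorSeries n) (E₈ᵒ n) (E₄ᵒ n) ((E₈ᵒ ⊛ ddE₄) n) (ser Factorisations correction n) quaternary-E₈′
    (trans quaternary-E₄′ (cong (λ z → + 2 *ℤ E₄ᵒ n +ℤ + 2 *ℤ z) (E₄ᵒ-dilE₈ n)))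
    (trans correction-sum (cong₂ (λ x y → divisorSeries n -ℤ + 2 *ℤ x +ℤ y) E₄≡E₄ᵒ E₈≡E₈ᵒ))
    where
    eliminate : ∀ p s a b t c → p ≡ + 2 *ℤ a +ℤ + 8 *ℤ t → p ≡ + 2 *ℤ b +ℤ + 2 *ℤ (c +ℤ + 2 *ℤ t) → + 2 *ℤ c ≡ s -ℤ + 2 *ℤ b +ℤ a → p ≡ + 2 *ℤ s
    eliminate p s a b t c eq₁ eq₂ eq₃ = begin
      p                                                   ≡⟨ arith₀ p ⟩
      + 2 *ℤ p -ℤ p                                       ≡⟨ cong₂ (λ x y → + 2 *ℤ x -ℤ y) eq₂ eq₁ ⟩
      + 2 *ℤ (+ 2 *ℤ b +ℤ + 2 *ℤ (c +ℤ + 2 *ℤ t)) -ℤ (+ 2 *ℤ a +ℤ + 8 *ℤ t) ≡⟨ arith₁ a b t c ⟩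
      + 4 *ℤ b +ℤ + 2 *ℤ (+ 2 *ℤ c) -ℤ + 2 *ℤ a           ≡⟨ cong (λ z → + 4 *ℤ b +ℤ + 2 *ℤ z -ℤ + 2 *ℤ a) eq₃ ⟩
      + 4 *ℤ b +ℤ + 2 *ℤ (s -ℤ + 2 *ℤ b +ℤ a) -ℤ + 2 *ℤ a ≡⟨ arith₂ s a b ⟩
      + 2 *ℤ s                                            ∎
      where
      open ≡-Reasoning
      arith₀ : ∀ p → p ≡ + 2 *ℤ p -ℤ p
      arith₀ = ℤ-Ring.solve-∀
      arith₁ : ∀ a b t c → + 2 *ℤ (+ 2 *ℤ b +ℤ + 2 *ℤ (c +ℤ + 2 *ℤ t)) -ℤ (+ 2 *ℤ a +ℤ + 8 *ℤ t) ≡ + 4 *ℤ b +ℤ + 2 *ℤ (+ 2 *ℤ c) -ℤ + 2 *ℤ a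
      arith₁ = ℤ-Ring.solve-∀
      arith₂ : ∀ s a b → + 4 *ℤ b +ℤ + 2 *ℤ (s -ℤ + 2 *ℤ b +ℤ a) -ℤ + 2 *ℤ a ≡ + 2 *ℤ s
      arith₂ = ℤ-Ring.solve-∀

-- The quadratic character of 2

δ-* : ∀ m n → δ (+ (m * n)) ≡ δ (+ m) *ℤ δ (+ n)
δ-* m n = trans (cong δ′ (residue-* m n)) (by-cases₂ (λ i j → δ′ (i ⊙ j) ℤₚ.≟ δ′ i *ℤ δ′ j) (residue (+ m)) (residue (+ n)))

-- An explicit integer cofactor rather than a remainder: the descent takes the cofactor as its next
-- modulus.
2-IsSquareMod : ℕ → Set
2-IsSquareMod p = ∃₂ λ (y : ℕ) (f : ℤ) → + (y * y) ≡ + 2 +ℤ f *ℤ + p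

-- Fermat's descent: if y is odd, 0 < y ≤ d and y² = 2 + f d, then 0 < f < d, and d f ≡ -1 (mod 8) passes the
-- hypothesis on to f.
δ≡-1⇒nonsquare : ∀ d → δ (+ d) ≡ -[1+ 0 ] → ¬ 2-IsSquareMod d
δ≡-1⇒nonsquare = <-rec _ descend
  where
  descend : ∀ d → (∀ {k} → k < d → δ (+ k) ≡ -[1+ 0 ] → ¬ 2-IsSquareMod k) → δ (+ d) ≡ -[1+ 0 ] → ¬ 2-IsSquareMod d
  descend 0 _ ()
  descend 1 _ ()
  descend 2 _ ()
  descend d@(suc (suc (suc d′))) rec δd (y , f , eq) = case odd-root of λ (z , g , o-z , z≤d , eq′) → contradict z g o-z z≤d eq′
    where
    r = y % d
    q = y / d
    g : ℤ
    -- The cofactor belonging to r² = (y - q d)².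
    g = f -ℤ + 2 *ℤ (+ r *ℤ + q) -ℤ + q *ℤ + q *ℤ + d
    root-r : + r *ℤ + r ≡ + 2 +ℤ g *ℤ + d
    root-r = begin
      + r *ℤ + r
        ≡⟨ arith₁ (+ r) (+ q) (+ d) ⟩
      (+ r +ℤ + q *ℤ + d) *ℤ (+ r +ℤ + q *ℤ + d) -ℤ (+ 2 *ℤ (+ r *ℤ + q) +ℤ + q *ℤ + q *ℤ + d) *ℤ + d
        ≡⟨ cong (_-ℤ (+ 2 *ℤ (+ r *ℤ + q) +ℤ + q *ℤ + q *ℤ + d) *ℤ + d) (trans (cong (λ z → z *ℤ z) split) (trans (sym (ℤₚ.pos-* y y)) eq)) ⟩
      + 2 +ℤ f *ℤ + d -ℤ (+ 2 *ℤ (+ r *ℤ + q) +ℤ + q *ℤ + q *ℤ + d) *ℤ + d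
        ≡⟨ arith₂ f (+ r) (+ q) (+ d) ⟩
      + 2 +ℤ g *ℤ + d ∎
      where
      open ≡-Reasoning
      split : + r +ℤ + q *ℤ + d ≡ + y
      split = trans (cong (+ r +ℤ_) (sym (ℤₚ.pos-* q d))) (cong +_ (sym (m≡m%n+[m/n]*n y d)))
      arith₁ : ∀ r q d → r *ℤ r ≡ (r +ℤ q *ℤ d) *ℤ (r +ℤ q *ℤ d) -ℤ (+ 2 *ℤ (r *ℤ q) +ℤ q *ℤ q *ℤ d) *ℤ d
      arith₁ = ℤ-Ring.solve-∀
      arith₂ : ∀ f r q d → + 2 +ℤ f *ℤ d -ℤ (+ 2 *ℤ (r *ℤ q) +ℤ q *ℤ q *ℤ d) *ℤ d ≡ + 2 +ℤ (f -ℤ + 2 *ℤ (r *ℤ q) -ℤ q *ℤ q *ℤ d) *ℤ d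
      arith₂ = ℤ-Ring.solve-∀
    r≤d : r ≤ d
    r≤d = ℕₚ.<⇒≤ (m%n<n y d)
    OddRoot : ℕ → ℤ → Set
    OddRoot z g = o (+ z) ≡ 1ℤ × z ≤ d × + z *ℤ + z ≡ + 2 +ℤ g *ℤ + d
    odd-d : o (+ d) ≡ 1ℤ
    odd-d = trans (sym (by-cases₁ (λ i → δ′ i *ℤ δ′ i ℤₚ.≟ o′ i) (residue (+ d)))) (cong (λ z → z *ℤ z) δd)
    odd-root : ∃₂ OddRoot
    odd-root with even⊎odd (+ r)
    ... | inj₂ odd-r = r , g , odd-r , r≤d , root-r
    -- As d is odd, d - r is an odd root whenever r is even.
    ... | inj₁ even-r = d ∸ r , g +ℤ + d -ℤ + 2 *ℤ + r , odd-z , ℕₚ.m∸n≤m d r , root-z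
      where
      z-eq : + (d ∸ r) ≡ + d -ℤ + r
      z-eq = sym (trans (ℤₚ.m-n≡m⊖n d r) (ℤₚ.⊖-≥ r≤d))
      o-r : o (+ r) ≡ 0ℤ
      o-r = trans (cong o (sym even-r)) (trans (table-+ o′ (half (+ r)) (half (+ r))) (by-cases₁ (λ i → o′ (i ⊕ i) ℤₚ.≟ 0ℤ) (residue (half (+ r)))))
      odd-z : o (+ (d ∸ r)) ≡ 1ℤ
      odd-z = begin
        o (+ (d ∸ r))                  ≡⟨ cong o z-eq ⟩
        o (+ d -ℤ + r)                 ≡⟨ table-- o′ (+ d) (+ r) ⟩
        o′ (residue (+ d) ⊕ opposite (residue (+ r))) ≡⟨ by-cases₂ (λ i j → o′ (i ⊕ opposite j) ℤₚ.≟ o′ i +ℤ o′ j -ℤ + 2 *ℤ (o′ i *ℤ o′ j)) (residue (+ d)) (residue (+ r)) ⟩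
        o (+ d) +ℤ o (+ r) -ℤ + 2 *ℤ (o (+ d) *ℤ o (+ r)) ≡⟨ cong₂ (λ a b → a +ℤ b -ℤ + 2 *ℤ (a *ℤ b)) odd-d o-r ⟩
        1ℤ                             ∎
        where open ≡-Reasoning
      root-z : + (d ∸ r) *ℤ + (d ∸ r) ≡ + 2 +ℤ (g +ℤ + d -ℤ + 2 *ℤ + r) *ℤ + d
      root-z = begin
        + (d ∸ r) *ℤ + (d ∸ r)                          ≡⟨ cong (λ z → z *ℤ z) z-eq ⟩
        (+ d -ℤ + r) *ℤ (+ d -ℤ + r)                    ≡⟨ arith₁ (+ d) (+ r) ⟩
        + r *ℤ + r +ℤ (+ d -ℤ + 2 *ℤ + r) *ℤ + d        ≡⟨ cong (_+ℤ (+ d -ℤ + 2 *ℤ + r) *ℤ + d) root-r ⟩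
        + 2 +ℤ g *ℤ + d +ℤ (+ d -ℤ + 2 *ℤ + r) *ℤ + d   ≡⟨ arith₂ g (+ d) (+ r) ⟩
        + 2 +ℤ (g +ℤ + d -ℤ + 2 *ℤ + r) *ℤ + d          ∎
        where
        open ≡-Reasoning
        arith₁ : ∀ d r → (d -ℤ r) *ℤ (d -ℤ r) ≡ r *ℤ r +ℤ (d -ℤ + 2 *ℤ r) *ℤ d
        arith₁ = ℤ-Ring.solve-∀
        arith₂ : ∀ g d r → + 2 +ℤ g *ℤ d +ℤ (d -ℤ + 2 *ℤ r) *ℤ d ≡ + 2 +ℤ (g +ℤ d -ℤ + 2 *ℤ r) *ℤ d
        arith₂ = ℤ-Ring.solve-∀
    contradict : ∀ z g → o (+ z) ≡ 1ℤ → z ≤ d → + z *ℤ + z ≡ + 2 +ℤ g *ℤ + d → ⊥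
    contradict z (+ k) odd-z z≤d eq′ = rec k<d δk (z , + d , trans (cong +_ nat) (cong (+ 2 +ℤ_) (trans (cong +_ (ℕₚ.*-comm k d)) (ℤₚ.pos-* d k))))
      where
      nat : z * z ≡ 2 + k * d
      nat = ℤₚ.+-injective (trans (ℤₚ.pos-* z z) (trans eq′ (cong (+ 2 +ℤ_) (sym (ℤₚ.pos-* k d)))))
      k<d : k < d
      k<d = ℕₚ.*-cancelʳ-< d k d (ℕₚ.<-≤-trans (ℕₚ.<-≤-trans (ℕₚ.m<n+m (k * d) {2} (s≤s z≤n)) (ℕₚ.≤-reflexive (sym nat))) (ℕₚ.*-mono-≤ z≤d z≤d))
      o-zz : residue (+ z) ⊙ residue (+ z) ≡ residue (+ (2 + k * d))
      o-zz = trans (sym (residue-* z z)) (cong (λ n → residue (+ n)) nat)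
      δ-product : δ (+ (k * d)) ≡ 1ℤ
      δ-product = begin
        δ (+ (k * d))                                     ≡⟨ ℤₚ.*-identityʳ _ ⟨
        δ (+ (k * d)) *ℤ 1ℤ                               ≡⟨ cong (δ (+ (k * d)) *ℤ_) odd-z ⟨
        δ (+ (k * d)) *ℤ o (+ z)                          ≡⟨ table-check ⟩
        o (+ z)                                           ≡⟨ odd-z ⟩
        1ℤ                                                ∎
        where
        open ≡-Reasoning
        residue-kd : residue (+ (k * d)) ≡ prev (prev (residue (+ z) ⊙ residue (+ z)))
        residue-kd = trans (sym (by-cases₁ (λ i → prev (prev (next (next i))) Finₚ.≟ i) (residue (+ (k * d))))) (cong (prev ∘ prev) (sym o-zz))
        table-check : δ (+ (k * d)) *ℤ o (+ z) ≡ o (+ z)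
        table-check = trans (cong (λ i → δ′ i *ℤ o (+ z)) residue-kd) (by-cases₁ (λ i → δ′ (prev (prev (i ⊙ i))) *ℤ o′ i ℤₚ.≟ o′ i) (residue (+ z)))
      δk : δ (+ k) ≡ -[1+ 0 ]
      δk = trans (arith (δ (+ k))) (cong -ℤ_ (trans (cong (δ (+ k) *ℤ_) (sym δd)) (trans (sym (δ-* k d)) δ-product)))
        where
        arith : ∀ x → x ≡ -ℤ (x *ℤ -[1+ 0 ])
        arith = ℤ-Ring.solve-∀
    -- A negative cofactor would give z² + (k + 1) d = 2, against d ≥ 3.
    contradict z -[1+ k ] odd-z z≤d eq′ = ℕₚ.<⇒≱ {2} (s≤s (s≤s (s≤s z≤n))) (ℕₚ.≤-trans (ℕₚ.≤-trans (ℕₚ.m≤m+n d (k * d)) (ℕₚ.m≤n+m (suc k * d) (z * z))) (ℕₚ.≤-reflexive nat))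
      where
      nat : z * z + suc k * d ≡ 2
      nat = ℤₚ.+-injective (begin
        + (z * z) +ℤ + (suc k * d)               ≡⟨ cong₂ _+ℤ_ (trans (ℤₚ.pos-* z z) eq′) (ℤₚ.pos-* (suc k) d) ⟩
        + 2 +ℤ -ℤ (+ suc k) *ℤ + d +ℤ + suc k *ℤ + d ≡⟨ arith (+ suc k) (+ d) ⟩
        + 2                                      ∎)
        where
        open ≡-Reasoning
        arith : ∀ k d → + 2 +ℤ -ℤ k *ℤ d +ℤ k *ℤ d ≡ + 2
        arith = ℤ-Ring.solve-∀

-- Square roots of 2 modulo primes p ≡ ±1 (mod 8)

residue-expansion : ∀ n → ∃ λ k → n ≡ Fin.toℕ (residue (+ n)) + 8 * k
residue-expansion 0 = 0 , refl
residue-expansion 1 = 0 , refl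
residue-expansion 2 = 0 , refl
residue-expansion 3 = 0 , refl
residue-expansion 4 = 0 , refl
residue-expansion 5 = 0 , refl
residue-expansion 6 = 0 , refl
residue-expansion 7 = 0 , refl
residue-expansion (suc (suc (suc (suc (suc (suc (suc (suc n)))))))) with residue-expansion n
... | k , eq = suc k , trans (cong (λ z → 8 + z) eq) (trans (arith (Fin.toℕ (residue (+ n))) k)
  (cong (λ i → Fin.toℕ i + 8 * suc k) (sym (by-cases₁ (λ i → next^ 8 i Finₚ.≟ i) (residue (+ n))))))
  where
  arith : ∀ r k → 8 + (r + 8 * k) ≡ r + 8 * suc k
  arith = ℕ-Ring.solve-∀

evens odds : ℕ → ℕ
evens zero = 1
evens (suc n) = evens n * (suc n + suc n)
odds zero = 1
odds (suc n) = odds n * suc (n + n)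

evens≡2^n*n! : ∀ n → evens n ≡ 2 ^ n * n !
evens≡2^n*n! zero = refl
evens≡2^n*n! (suc n) = trans (cong (_* (suc n + suc n)) (evens≡2^n*n! n)) (arith n (2 ^ n) (n !))
  where
  arith : ∀ n p f → p * f * (suc n + suc n) ≡ 2 * p * (suc n * f)
  arith = ℕ-Ring.solve-∀

-- With h = 2 n + 1 this is h!, the factor that Gauss's lemma leaves on both sides.
evens*odds : ∀ n → suc (n + n) ! ≡ evens n * odds (suc n)
evens*odds zero = refl
evens*odds (suc n) = begin
  suc (suc n + suc n) !                                      ≡⟨ cong (λ m → (2 + m) !) (ℕₚ.+-suc n n) ⟩
  (3 + (n + n)) * ((2 + (n + n)) * suc (n + n) !)            ≡⟨ cong (λ z → (3 + (n + n)) * ((2 + (n + n)) * z)) (evens*odds n) ⟩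
  (3 + (n + n)) * ((2 + (n + n)) * (evens n * odds (suc n))) ≡⟨ arith n (evens n) (odds (suc n)) ⟩
  evens (suc n) * odds (2 + n)                               ∎
  where
  open ≡-Reasoning
  arith : ∀ n x y → (3 + (n + n)) * ((2 + (n + n)) * (x * y)) ≡ x * (suc n + suc n) * (y * suc (suc n + suc n))
  arith = ℕ-Ring.solve-∀

alternating : ℕ → ℤ
alternating zero = 1ℤ
alternating (suc n) = -ℤ alternating n

alternating-even : ∀ n → alternating (n + n) ≡ 1ℤ
alternating-even zero = refl
alternating-even (suc n) = trans (cong (-ℤ_ ∘ alternating) (ℕₚ.+-suc n n)) (trans (ℤₚ.neg-involutive _) (alternating-even n))

-- Gauss's lemma for 2: the even numbers above h are the negatives modulo p = 2 h + 1 of the odd numbers below h.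
gauss : ∀ h m n → n + m ≡ h → ∃ λ c → + evens h ≡ + evens n *ℤ (alternating m *ℤ + odds m) +ℤ c *ℤ + suc (h + h)
gauss h zero n refl = 0ℤ , trans (cong (+_ ∘ evens) (ℕₚ.+-identityʳ n)) (arith (+ evens n) (+ suc (n + 0 + (n + 0))))
  where
  arith : ∀ x p → x ≡ x *ℤ (1ℤ *ℤ 1ℤ) +ℤ 0ℤ *ℤ p
  arith = ℤ-Ring.solve-∀
gauss h (suc m) n eq with gauss h m (suc n) (trans (sym (ℕₚ.+-suc n m)) eq)
... | c , ih = c +ℤ + evens n *ℤ (alternating m *ℤ + odds m) , (begin
  + evens h
    ≡⟨ ih ⟩
  + (evens n * (suc n + suc n)) *ℤ (alternating m *ℤ + odds m) +ℤ c *ℤ p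
    ≡⟨ cong (λ z → z *ℤ (alternating m *ℤ + odds m) +ℤ c *ℤ p) (trans (ℤₚ.pos-* (evens n) (suc n + suc n)) (cong (+ evens n *ℤ_) complement)) ⟩
  + evens n *ℤ (p -ℤ + suc (m + m)) *ℤ (alternating m *ℤ + odds m) +ℤ c *ℤ p
    ≡⟨ arith (+ evens n) p (+ suc (m + m)) (alternating m) (+ odds m) c ⟩
  + evens n *ℤ (-ℤ alternating m *ℤ (+ odds m *ℤ + suc (m + m))) +ℤ (c +ℤ + evens n *ℤ (alternating m *ℤ + odds m)) *ℤ p
    ≡⟨ cong (λ z → + evens n *ℤ (-ℤ alternating m *ℤ z) +ℤ (c +ℤ + evens n *ℤ (alternating m *ℤ + odds m)) *ℤ p) (ℤₚ.pos-* (odds m) (suc (m + m))) ⟨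
  + evens n *ℤ (alternating (suc m) *ℤ + odds (suc m)) +ℤ (c +ℤ + evens n *ℤ (alternating m *ℤ + odds m)) *ℤ p ∎)
  where
  open ≡-Reasoning
  p = + suc (h + h)
  complement : + (suc n + suc n) ≡ p -ℤ + suc (m + m)
  complement = trans (arith′ (+ (suc n + suc n)) (+ suc (m + m))) (cong (λ z → + z -ℤ + suc (m + m)) (trans (arith″ n m) (cong (λ h → suc (h + h)) eq)))
    where
    arith′ : ∀ x y → x ≡ x +ℤ y -ℤ y
    arith′ = ℤ-Ring.solve-∀
    arith″ : ∀ n m → suc n + suc n + suc (m + m) ≡ suc (n + suc m + (n + suc m))
    arith″ = ℕ-Ring.solve-∀
  arith : ∀ x p y s o c → x *ℤ (p -ℤ y) *ℤ (s *ℤ o) +ℤ c *ℤ p ≡ x *ℤ (-ℤ s *ℤ (o *ℤ y)) +ℤ (c +ℤ x *ℤ (s *ℤ o)) *ℤ p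
  arith = ℤ-Ring.solve-∀

prime∤! : ∀ {p} → Prime p → ∀ n → n < p → ¬ p ∣ₙ n !
prime∤! pr zero _ p∣1 = ℕₚ.<-irrefl (sym (∣1⇒≡1 p∣1)) (nonTrivial⇒n>1 _ {{prime⇒nonTrivial pr}})
prime∤! pr (suc n) n<p p∣ with euclidsLemma (suc n) (n !) pr p∣
... | inj₁ p∣n = ℕₚ.<⇒≱ n<p (∣⇒≤ p∣n)
... | inj₂ p∣n! = prime∤! pr n (ℕₚ.<⇒≤ n<p) p∣n!

-- Here h = (p - 1)/2 = 4 k + 3, and Gauss's lemma involves an even number 2 k + 2 of sign changes,
-- so 2^h h! ≡ h! and 2^h ≡ 1. Since h + 1 is even, 2 ≡ 2^(h + 1) is the square of 2^(2 k + 2).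
square-mod-7 : ∀ k → Prime (7 + 8 * k) → 2-IsSquareMod (7 + 8 * k)
square-mod-7 k pr = 2 ^ (2 + (k + k)) , + 2 *ℤ quotient , (begin
  + (2 ^ (2 + (k + k)) * 2 ^ (2 + (k + k)))   ≡⟨ cong +_ (trans (sym (ℕₚ.^-distribˡ-+-* 2 (2 + (k + k)) (2 + (k + k)))) (cong (2 ^_) (arith₂ k))) ⟩
  + (2 * 2 ^ h)                               ≡⟨ ℤₚ.pos-* 2 (2 ^ h) ⟩
  + 2 *ℤ + (2 ^ h)                            ≡⟨ arith₃ (+ (2 ^ h)) ⟩
  + 2 +ℤ + 2 *ℤ (+ (2 ^ h) -ℤ 1ℤ)             ≡⟨ cong (λ z → + 2 +ℤ + 2 *ℤ z) quotient-eq ⟩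
  + 2 +ℤ + 2 *ℤ (quotient *ℤ + p)             ≡⟨ cong (+ 2 +ℤ_) (ℤₚ.*-assoc (+ 2) quotient (+ p)) ⟨
  + 2 +ℤ + 2 *ℤ quotient *ℤ + p               ∎)
  where
  open ≡-Reasoning
  p n h : ℕ
  p = 7 + 8 * k
  n = suc (k + k)
  h = suc (n + n)
  h-eq : suc (h + h) ≡ p
  h-eq = arith k
    where
    arith : ∀ k → suc (suc (suc (k + k) + suc (k + k)) + suc (suc (k + k) + suc (k + k))) ≡ 7 + 8 * k
    arith = ℕ-Ring.solve-∀
  arith₂ : ∀ k → 2 + (k + k) + (2 + (k + k)) ≡ suc (suc (suc (k + k) + suc (k + k)))
  arith₂ = ℕ-Ring.solve-∀
  arith₃ : ∀ x → + 2 *ℤ x ≡ + 2 +ℤ + 2 *ℤ (x -ℤ 1ℤ)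
  arith₃ = ℤ-Ring.solve-∀
  c : ℤ
  c = proj₁ (gauss h (suc n) n (ℕₚ.+-suc n n))
  product : (+ (2 ^ h) -ℤ 1ℤ) *ℤ + (h !) ≡ c *ℤ + p
  product = begin
    (+ (2 ^ h) -ℤ 1ℤ) *ℤ + (h !)                   ≡⟨ arith₄ (+ (2 ^ h)) (+ (h !)) ⟩
    + (2 ^ h) *ℤ + (h !) -ℤ + (h !)                ≡⟨ cong (_-ℤ + (h !)) (trans (sym (ℤₚ.pos-* (2 ^ h) (h !))) (cong +_ (sym (evens≡2^n*n! h)))) ⟩
    + evens h -ℤ + (h !)                           ≡⟨ cong (_-ℤ + (h !)) (proj₂ (gauss h (suc n) n (ℕₚ.+-suc n n))) ⟩
    + evens n *ℤ (alternating (suc n) *ℤ + odds (suc n)) +ℤ c *ℤ + suc (h + h) -ℤ + (h !)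
      ≡⟨ cong₂ (λ s q → + evens n *ℤ (s *ℤ + odds (suc n)) +ℤ c *ℤ + q -ℤ + (h !))
           (trans (cong alternating (sym (cong suc (ℕₚ.+-suc k k)))) (alternating-even (suc k))) h-eq ⟩
    + evens n *ℤ (1ℤ *ℤ + odds (suc n)) +ℤ c *ℤ + p -ℤ + (h !)
      ≡⟨ cong (λ z → + evens n *ℤ (1ℤ *ℤ + odds (suc n)) +ℤ c *ℤ + p -ℤ z) (trans (cong +_ (evens*odds n)) (ℤₚ.pos-* (evens n) (odds (suc n)))) ⟩
    + evens n *ℤ (1ℤ *ℤ + odds (suc n)) +ℤ c *ℤ + p -ℤ + evens n *ℤ + odds (suc n)
      ≡⟨ arith₅ (+ evens n) (+ odds (suc n)) (c *ℤ + p) ⟩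
    c *ℤ + p ∎
    where
    arith₄ : ∀ x y → (x -ℤ 1ℤ) *ℤ y ≡ x *ℤ y -ℤ y
    arith₄ = ℤ-Ring.solve-∀
    arith₅ : ∀ x y z → x *ℤ (1ℤ *ℤ y) +ℤ z -ℤ x *ℤ y ≡ z
    arith₅ = ℤ-Ring.solve-∀
  p∣product : p ∣ₙ ∣ + (2 ^ h) -ℤ 1ℤ ∣ * h !
  p∣product = divides ∣ c ∣ (trans (sym (ℤₚ.abs-* (+ (2 ^ h) -ℤ 1ℤ) (+ (h !)))) (trans (cong ∣_∣ product) (ℤₚ.abs-* c (+ p))))
  h<p : h < p
  h<p = subst (h <_) h-eq (s≤s (ℕₚ.m≤m+n h h))
  p∣ : + p ℤ-Signed.∣ (+ (2 ^ h) -ℤ 1ℤ)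
  p∣ = [ ℤ-Signed.∣ᵤ⇒∣ , (λ q → ⊥-elim (prime∤! pr h h<p q)) ]′ (euclidsLemma ∣ + (2 ^ h) -ℤ 1ℤ ∣ (h !) pr p∣product)
  quotient : ℤ
  quotient = ℤ-Signed._∣_.quotient p∣
  quotient-eq : + (2 ^ h) -ℤ 1ℤ ≡ quotient *ℤ + p
  quotient-eq = ℤ-Signed._∣_.equality p∣

primeFactorisations : ∀ {p} → Prime p → Enum (λ a → Ok Factorisations a × wt Factorisations a ≡ p)
primeFactorisations {p} pr = record
  { elems = (1 , p) ∷ (p , 1) ∷ []
  ; unique = ((λ eq → ℕₚ.<-irrefl (cong proj₁ eq) p>1) ∷ []) ∷ [] ∷ []
  ; sound = λ where
      (here refl) → (s≤s z≤n , p>0) , ℕₚ.*-identityˡ p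
      (there (here refl)) → (p>0 , s≤s z≤n) , ℕₚ.*-identityʳ p
  ; complete = complete′ }
  where
  p>1 : 1 < p
  p>1 = nonTrivial⇒n>1 p {{prime⇒nonTrivial pr}}
  p>0 : 0 < p
  p>0 = ℕₚ.<⇒≤ p>1
  complete′ : ∀ {de} → Ok Factorisations de × wt Factorisations de ≡ p → de ∈ (1 , p) ∷ (p , 1) ∷ []
  complete′ {d , e} ((d>0 , e>0) , w) with prime⇒irreducible pr (divides e (trans (sym w) (ℕₚ.*-comm d e)))
  ... | inj₁ refl = here (cong (1 ,_) (trans (sym (ℕₚ.*-identityˡ e)) w))
  ... | inj₂ refl = there (here (cong (d ,_) (ℕₚ.*-cancelˡ-≡ e 1 d {{>-nonZero d>0}} (trans w (sym (ℕₚ.*-identityʳ d))))))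

D-prime : ∀ φ {p} → Prime p → D[ φ , one ] p ≡ φ 1ℤ +ℤ φ (+ p)
D-prime φ {p} pr = trans (sumE-unique (enum Factorisations p) (primeFactorisations pr) (λ (d , e) → φ (+ d) *ℤ 1ℤ)) (arith (φ 1ℤ) (φ (+ p)))
  where
  arith : ∀ x y → x *ℤ 1ℤ +ℤ (y *ℤ 1ℤ +ℤ 0ℤ) ≡ x +ℤ y
  arith = ℤ-Ring.solve-∀

nonzero⇒∃ : {A : Set} (G : Graded A) {f : A → ℤ} {n : ℕ} → ser G f n ≢ 0ℤ → ∃ λ a → Ok G a × wt G a ≡ n
nonzero⇒∃ G {f} {n} nz with elems (enum G n) | (λ {x} → sound (enum G n) {x})
... | [] | _ = ⊥-elim (nz refl)
... | x ∷ _ | s = x , s (here refl)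

module _ {p : ℕ} (pr : Prime p) (p≡1 : residue (+ p) ≡ # 1) where
  private
    p>1 : 1 < p
    p>1 = nonTrivial⇒n>1 p {{prime⇒nonTrivial pr}}

    𝟙p : 𝟙 p ≡ 0ℤ
    𝟙p with s≤s _ ← p>1 = refl

    -- For p ≡ 1 (mod 8) both characters are 1 at the divisors 1 and p. This gives 4 · 2
    -- representations by z² + w² and, next, 2 · 2 by x² + 2 y².
    θ² : ser Squares² (λ _ → 1ℤ) p ≡ + 8
    θ² = trans (ser-⊗ Squares Squares one one p) (trans (sym (u₄≈θθ p)) (cong₂ (λ i x → i +ℤ (x +ℤ x +ℤ (x +ℤ x))) 𝟙p
      (trans (D-prime ε pr) (cong (λ j → 1ℤ +ℤ ε′ j) p≡1))))

    θθ₂ : ser (Squares ⊗ dilated Squares) (λ _ → 1ℤ) p ≡ + 4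
    θθ₂ = trans (ser-⊗ Squares (dilated Squares) one one p) (trans (⊛-congˡ θ (ser-dilated Squares one) p) (trans (sym (v₈≈θdilθ p)) (cong₂ (λ i x → i +ℤ (x +ℤ x)) 𝟙p
      (trans (D-prime ω pr) (cong (λ j → 1ℤ +ℤ ω′ j) p≡1)))))

    -- If p divided y or w it would divide x or z too, and then p² would divide p.
    no-common : ∀ x c → x * x + c ≡ p → p ∣ₙ c → ¬ p * p ∣ₙ c
    no-common x c eq p∣c p²∣c = ℕₚ.<⇒≱ p>1 (ℕₚ.*-cancelʳ-≤ p 1 p {{prime⇒nonZero pr}} (ℕₚ.≤-trans (∣⇒≤ {{prime⇒nonZero pr}} p²∣p) (ℕₚ.≤-reflexive (sym (ℕₚ.*-identityˡ p)))))
      where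
      p∣x² : p ∣ₙ x * x
      p∣x² = ∣m+n∣m⇒∣n (∣-reflexive (trans (sym eq) (ℕₚ.+-comm (x * x) c))) p∣c
      p∣x : p ∣ₙ x
      p∣x = [ id , id ]′ (euclidsLemma x x pr p∣x²)
      p²∣p : p * p ∣ₙ p
      p²∣p = subst (p * p ∣ₙ_) eq (∣m∣n⇒∣m+n (*-pres-∣ p∣x p∣x) p²∣c)

  -- Modulo p, x² ≡ -2 y² and z² ≡ -w², so x z / (y w) squares to 2. The inverse of y w comes from
  -- Bézout's identity.
  root-from-representations : ∀ x y z w → x * x + (y * y + y * y) ≡ p → z * z + w * w ≡ p → 2-IsSquareMod p
  root-from-representations x y z w xy zw = ∣ X ∣ , F , root
    where
    t : ℕ
    t = y * w
    p∤w : ¬ p ∣ₙ w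
    p∤w d = no-common z (w * w) zw (∣-trans d (m∣m*n w)) (*-pres-∣ d d)
    p∤y : ¬ p ∣ₙ y
    p∤y d = no-common x (y * y + y * y) xy (∣m∣n⇒∣m+n (∣-trans d (m∣m*n y)) (∣-trans d (m∣m*n y))) (∣m∣n⇒∣m+n (*-pres-∣ d d) (*-pres-∣ d d))
    coprime : Coprime p t
    coprime (d∣p , d∣t) with prime⇒irreducible pr d∣p
    ... | inj₁ d≡1 = d≡1
    ... | inj₂ refl = ⊥-elim ([ p∤y , p∤w ]′ (euclidsLemma y w pr d∣t))
    inverse : ∃₂ λ s c → s *ℤ + t ≡ 1ℤ +ℤ c *ℤ + p
    inverse with coprime-Bézout coprime
    ... | Bézout.+- i j eq = -ℤ (+ j) , -ℤ (+ i) , (begin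
      -ℤ (+ j) *ℤ + t                ≡⟨ arith (+ j) (+ t) ⟩
      1ℤ -ℤ (1ℤ +ℤ + j *ℤ + t)       ≡⟨ cong (1ℤ +ℤ_) (cong -ℤ_ (trans (cong (1ℤ +ℤ_) (sym (ℤₚ.pos-* j t))) (trans (cong +_ eq) (ℤₚ.pos-* i p)))) ⟩
      1ℤ -ℤ + i *ℤ + p               ≡⟨ cong (1ℤ +ℤ_) (ℤₚ.neg-distribˡ-* (+ i) (+ p)) ⟩
      1ℤ +ℤ -ℤ (+ i) *ℤ + p          ∎)
      where
      open ≡-Reasoning
      arith : ∀ j t → -ℤ j *ℤ t ≡ 1ℤ -ℤ (1ℤ +ℤ j *ℤ t)
      arith = ℤ-Ring.solve-∀
    ... | Bézout.-+ i j eq = + j , + i , trans (sym (ℤₚ.pos-* j t)) (trans (cong +_ (sym eq)) (cong (1ℤ +ℤ_) (ℤₚ.pos-* i p)))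
    s c X E F : ℤ
    s = proj₁ inverse
    c = proj₁ (proj₂ inverse)
    X = + x *ℤ + z *ℤ s
    E = + p -ℤ + w *ℤ + w -ℤ (+ y *ℤ + y +ℤ + y *ℤ + y)
    -- All multiples of p in X²: the terms in c come from 2 (1 + c p)², and `E` from expanding (p -
    -- 2 y²)(p - w²).
    F = + 4 *ℤ c +ℤ + 2 *ℤ (c *ℤ c *ℤ + p) +ℤ E *ℤ (s *ℤ s)
    x²-eq : + x *ℤ + x ≡ + p -ℤ (+ y *ℤ + y +ℤ + y *ℤ + y)
    x²-eq = trans (arith (+ x *ℤ + x) (+ y *ℤ + y)) (cong (_-ℤ (+ y *ℤ + y +ℤ + y *ℤ + y)) (trans (cong₂ (λ a b → a +ℤ (b +ℤ b)) (sym (ℤₚ.pos-* x x)) (sym (ℤₚ.pos-* y y))) (cong +_ xy)))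
      where
      arith : ∀ a b → a ≡ a +ℤ (b +ℤ b) -ℤ (b +ℤ b)
      arith = ℤ-Ring.solve-∀
    z²-eq : + z *ℤ + z ≡ + p -ℤ + w *ℤ + w
    z²-eq = trans (arith (+ z *ℤ + z) (+ w *ℤ + w)) (cong (_-ℤ + w *ℤ + w) (trans (cong₂ _+ℤ_ (sym (ℤₚ.pos-* z z)) (sym (ℤₚ.pos-* w w))) (cong +_ zw)))
      where
      arith : ∀ a b → a ≡ a +ℤ b -ℤ b
      arith = ℤ-Ring.solve-∀
    root : + (∣ X ∣ * ∣ X ∣) ≡ + 2 +ℤ F *ℤ + p
    root = begin
      + (∣ X ∣ * ∣ X ∣)                             ≡⟨ ∣x∣²≡x² X ⟩
      X *ℤ X                                        ≡⟨ arith₁ (+ x) (+ z) s ⟩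
      (+ x *ℤ + x) *ℤ (+ z *ℤ + z) *ℤ (s *ℤ s)      ≡⟨ cong₂ (λ a b → a *ℤ b *ℤ (s *ℤ s)) x²-eq z²-eq ⟩
      (+ p -ℤ (+ y *ℤ + y +ℤ + y *ℤ + y)) *ℤ (+ p -ℤ + w *ℤ + w) *ℤ (s *ℤ s)
        ≡⟨ arith₂ (+ p) (+ y) (+ w) s ⟩
      + 2 *ℤ (s *ℤ (+ y *ℤ + w) *ℤ (s *ℤ (+ y *ℤ + w))) +ℤ E *ℤ (s *ℤ s) *ℤ + p
        ≡⟨ cong (λ a → + 2 *ℤ (a *ℤ a) +ℤ E *ℤ (s *ℤ s) *ℤ + p) (trans (cong (s *ℤ_) (sym (ℤₚ.pos-* y w))) (proj₂ (proj₂ inverse))) ⟩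
      + 2 *ℤ ((1ℤ +ℤ c *ℤ + p) *ℤ (1ℤ +ℤ c *ℤ + p)) +ℤ E *ℤ (s *ℤ s) *ℤ + p
        ≡⟨ arith₃ c (+ p) (E *ℤ (s *ℤ s)) ⟩
      + 2 +ℤ F *ℤ + p ∎
      where
      open ≡-Reasoning
      arith₁ : ∀ x z s → x *ℤ z *ℤ s *ℤ (x *ℤ z *ℤ s) ≡ (x *ℤ x) *ℤ (z *ℤ z) *ℤ (s *ℤ s)
      arith₁ = ℤ-Ring.solve-∀
      arith₂ : ∀ p y w s → (p -ℤ (y *ℤ y +ℤ y *ℤ y)) *ℤ (p -ℤ w *ℤ w) *ℤ (s *ℤ s) ≡
        + 2 *ℤ (s *ℤ (y *ℤ w) *ℤ (s *ℤ (y *ℤ w))) +ℤ (p -ℤ w *ℤ w -ℤ (y *ℤ y +ℤ y *ℤ y)) *ℤ (s *ℤ s) *ℤ p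
      arith₂ = ℤ-Ring.solve-∀
      arith₃ : ∀ c p e → + 2 *ℤ ((1ℤ +ℤ c *ℤ p) *ℤ (1ℤ +ℤ c *ℤ p)) +ℤ e *ℤ p ≡ + 2 +ℤ (+ 4 *ℤ c +ℤ + 2 *ℤ (c *ℤ c *ℤ p) +ℤ e) *ℤ p
      arith₃ = ℤ-Ring.solve-∀

  square-mod-1 : 2-IsSquareMod p
  square-mod-1 =
    let (x , y) , _ , xy = nonzero⇒∃ (Squares ⊗ dilated Squares) {n = p} (λ eq → case trans (sym θθ₂) eq of λ ())
        (z , w) , _ , zw = nonzero⇒∃ Squares² {n = p} (λ eq → case trans (sym θ²) eq of λ ())
    in root-from-representations (∣ x ∣) (∣ y ∣) (∣ z ∣) (∣ w ∣) xy zw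

δ≡1⇒square : ∀ {p} → Prime p → δ (+ p) ≡ 1ℤ → 2-IsSquareMod p
δ≡1⇒square {p} pr δp with residue (+ p) in eq | δp
... | Fin.suc Fin.zero | _ = square-mod-1 pr eq
... | Fin.suc (Fin.suc (Fin.suc (Fin.suc (Fin.suc (Fin.suc (Fin.suc Fin.zero)))))) | _ with residue-expansion p
...   | k , expansion = subst 2-IsSquareMod (sym p-eq) (square-mod-7 k (subst Prime p-eq pr))
  where
  p-eq : p ≡ 7 + 8 * k
  p-eq = trans expansion (cong (λ i → Fin.toℕ i + 8 * k) eq)

-- The local functions of Defs cannot be named; the underscores below are solved by the equations that follow them,
-- after abstracting the arguments of the recursive call.
mutual
  kroneckerLoop : ℕ → ℕ → ℕ → ℤ
  kroneckerLoop = _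

  kroneckerLoop-solution : ∀ m → kronecker 2 (2 + m) ≡
    legendre 2 (2 + leastFactor-2 (2 + m)) *ℤ kroneckerLoop (2 + m) (suc m) ((2 + m) / (2 + leastFactor-2 (2 + m)))
  kroneckerLoop-solution m with leastFactor-2 (2 + m)
  ... | j with (2 + m) / (2 + j)
  ... | q with 2 + m
  ... | M with suc m
  ... | f = refl

mutual
  leastFactorLoop : ℕ → ℕ → ℕ → ℕ
  leastFactorLoop = _

  leastFactorLoop-solution : ∀ m → leastFactor-2 (suc m) ≡ (if ⌊ 2 ∣? suc m ⌋ then 0 else leastFactorLoop (suc m) m 1)
  leastFactorLoop-solution m with ⌊ 2 ∣? suc m ⌋
  ... | true = refl
  ... | false with suc m
  ... | M with 1
  ... | j = refl

mutual
  squareLoop : (a p : ℕ) → .{{NonZero p}} → ℕ → Bool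
  squareLoop = _

  squareLoop-solution : ∀ a p .{{nz : NonZero (suc p)}} → isSquareMod a (suc p) {{nz}} ≡
    (if ⌊ _%_ (p * p) (suc p) {{nz}} ℕₚ.≟ _%_ a (suc p) {{nz}} ⌋ then true else squareLoop a (suc p) {{nz}} p)
  squareLoop-solution a p {{nz}} with ⌊ _%_ (p * p) (suc p) {{nz}} ℕₚ.≟ _%_ a (suc p) {{nz}} ⌋
  ... | true = refl
  ... | false with suc p
  ... | M = refl

-- The Legendre and Kronecker symbols as computed by search

squareLoop-sound : ∀ a p .{{_ : NonZero p}} x → squareLoop a p x ≡ true → ∃ λ y → (y * y) % p ≡ a % p
squareLoop-sound a p (suc x) eq with (x * x) % p ℕₚ.≟ a % p
... | yes root = x , root
... | no _ = squareLoop-sound a p x eq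

squareLoop-complete : ∀ a p .{{_ : NonZero p}} x y → y < x → (y * y) % p ≡ a % p → squareLoop a p x ≡ true
squareLoop-complete a p (suc x) y y<x root with (x * x) % p ℕₚ.≟ a % p
... | yes _ = refl
... | no ¬root = squareLoop-complete a p x y (ℕₚ.≤∧≢⇒< (ℕₚ.≤-pred y<x) (λ where refl → ¬root root)) root

2-IsSquareMod⇒% : ∀ p .{{_ : NonZero p}} y f → + (y * y) ≡ + 2 +ℤ f *ℤ + p → (y * y) % p ≡ 2 % p
2-IsSquareMod⇒% p y (+ k) eq = trans (cong (_% p) (ℤₚ.+-injective (trans eq (cong (+ 2 +ℤ_) (sym (ℤₚ.pos-* k p)))))) ([m+kn]%n≡m%n 2 k p)
2-IsSquareMod⇒% p y -[1+ k ] eq = trans (sym ([m+kn]%n≡m%n (y * y) (suc k) p)) (cong (_% p) (ℤₚ.+-injective (begin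
  + (y * y) +ℤ + (suc k * p)                    ≡⟨ cong₂ _+ℤ_ eq (ℤₚ.pos-* (suc k) p) ⟩
  + 2 +ℤ -ℤ (+ suc k) *ℤ + p +ℤ + suc k *ℤ + p  ≡⟨ arith (+ suc k) (+ p) ⟩
  + 2                                           ∎)))
  where
  open ≡-Reasoning
  arith : ∀ k d → + 2 +ℤ -ℤ k *ℤ d +ℤ k *ℤ d ≡ + 2
  arith = ℤ-Ring.solve-∀

%⇒2-IsSquareMod : ∀ p .{{_ : NonZero p}} y → (y * y) % p ≡ 2 % p → 2-IsSquareMod p
%⇒2-IsSquareMod p y eq = y , + ((y * y) / p) -ℤ + (2 / p) , (begin
  + (y * y)
    ≡⟨ expand (y * y) ⟩
  + ((y * y) % p) +ℤ + ((y * y) / p) *ℤ + p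
    ≡⟨ cong (λ r → + r +ℤ + ((y * y) / p) *ℤ + p) eq ⟩
  + (2 % p) +ℤ + ((y * y) / p) *ℤ + p
    ≡⟨ arith (+ (2 % p)) (+ ((y * y) / p)) (+ (2 / p)) (+ p) ⟩
  + (2 % p) +ℤ + (2 / p) *ℤ + p +ℤ (+ ((y * y) / p) -ℤ + (2 / p)) *ℤ + p
    ≡⟨ cong (_+ℤ (+ ((y * y) / p) -ℤ + (2 / p)) *ℤ + p) (expand 2) ⟨
  + 2 +ℤ (+ ((y * y) / p) -ℤ + (2 / p)) *ℤ + p ∎)
  where
  open ≡-Reasoning
  expand : ∀ n → + n ≡ + (n % p) +ℤ + (n / p) *ℤ + p
  expand n = trans (cong +_ (m≡m%n+[m/n]*n n p)) (cong (+ (n % p) +ℤ_) (ℤₚ.pos-* (n / p) p))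
  arith : ∀ r q q′ p → r +ℤ q *ℤ p ≡ r +ℤ q′ *ℤ p +ℤ (q -ℤ q′) *ℤ p
  arith = ℤ-Ring.solve-∀

-- A root found by the search contradicts the descent if δ(p) = -1. If δ(p) = 1, a root exists, and
-- its remainder modulo p lies in the range searched.
legendre-2 : ∀ {p} → Prime p → o (+ p) ≡ 1ℤ → legendre 2 p ≡ δ (+ p)
legendre-2 {0} _ ()
legendre-2 {1} pr _ = ⊥-elim (ℕₚ.<-irrefl refl (nonTrivial⇒n>1 1 {{prime⇒nonTrivial pr}}))
legendre-2 {2} _ ()
legendre-2 {p@(suc (suc (suc _)))} pr odd-p with isSquareMod 2 p in eq
  | by-cases₁ (λ i → (o′ i ℤₚ.≟ 0ℤ) ⊎-dec ((δ′ i ℤₚ.≟ 1ℤ) ⊎-dec (δ′ i ℤₚ.≟ -[1+ 0 ]))) (residue (+ p))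
... | _ | inj₁ even-p = case trans (sym odd-p) even-p of λ ()
... | true | inj₂ (inj₁ δp) = sym δp
... | false | inj₂ (inj₂ δp) = sym δp
... | true | inj₂ (inj₂ δp) = let y , root = squareLoop-sound 2 p p eq in ⊥-elim (δ≡-1⇒nonsquare p δp (%⇒2-IsSquareMod p y root))
... | false | inj₂ (inj₁ δp) = let y , f , root = δ≡1⇒square pr δp in
  case trans (sym eq) (squareLoop-complete 2 p p (y % p) (m%n<n y p) (trans (sym (%-distribˡ-* y y p)) (2-IsSquareMod⇒% p y f root))) of λ ()

-- The invariant is that m has no divisor between 2 and 1 + j. When the fuel is exhausted, m ≤ 2 +
-- j, so m is its own least factor, which is what the default value m - 2 encodes.
leastFactorLoop-spec : ∀ m f j → 2 ≤ m → (2 + j) Rough m → m ≤ 2 + j + f →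
  (2 + leastFactorLoop m f j) ∣ₙ m × (2 + leastFactorLoop m f j) Rough m
leastFactorLoop-spec m zero j 2≤m rough m≤ = subst (λ k → k ∣ₙ m × k Rough m) (sym (ℕₚ.m+[n∸m]≡n 2≤m))
  (∣-refl , λ where (hasNonTrivialDivisor d<m d∣m) → rough (hasNonTrivialDivisor (ℕₚ.<-≤-trans d<m (subst (m ≤_) (ℕₚ.+-identityʳ (2 + j)) m≤)) d∣m))
leastFactorLoop-spec m (suc f) j 2≤m rough m≤ with (2 + j) ∣? m
... | yes d = d , rough
... | no ¬d = leastFactorLoop-spec m f (suc j) 2≤m (∤⇒rough-suc ¬d rough) (subst (m ≤_) (ℕₚ.+-suc (2 + j) f) m≤)

-- `δ` is completely multiplicative and agrees with the Legendre symbol at odd primes. Removing a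
-- prime factor decreases k, so fuel k is enough.
kroneckerLoop-2 : ∀ M f k → k ≤ f → o (+ k) ≡ 1ℤ → kroneckerLoop M f k ≡ δ (+ k)
kroneckerLoop-2 M zero zero _ ()
kroneckerLoop-2 M (suc f) 0 _ ()
kroneckerLoop-2 M (suc f) 1 _ _ = refl
kroneckerLoop-2 M (suc f) k@(suc (suc k′)) (s≤s k≤f) odd-k = begin
  legendre 2 r *ℤ kroneckerLoop M f (k / r) ≡⟨ cong₂ _*ℤ_ (legendre-2 r-prime (proj₂ odd-factors)) (kroneckerLoop-2 M f (k / r) q≤f (proj₁ odd-factors)) ⟩
  δ (+ r) *ℤ δ (+ (k / r))                ≡⟨ ℤₚ.*-comm (δ (+ r)) (δ (+ (k / r))) ⟩
  δ (+ (k / r)) *ℤ δ (+ r)                ≡⟨ δ-* (k / r) r ⟨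
  δ (+ (k / r * r))                       ≡⟨ cong (δ ∘ +_) (m/n*n≡m r∣k) ⟩
  δ (+ k)                                 ∎
  where
  open ≡-Reasoning
  r : ℕ
  r = 2 + leastFactor-2 k
  spec = leastFactorLoop-spec k k 0 (s≤s (s≤s z≤n)) 2-rough (ℕₚ.m≤n+m k 2)
  r∣k : r ∣ₙ k
  r∣k = proj₁ spec
  r-prime : Prime r
  r-prime = rough∧∣⇒prime (proj₂ spec) r∣k
  odd-factors : o (+ (k / r)) ≡ 1ℤ × o (+ r) ≡ 1ℤ
  odd-factors = o-factor (k / r) r (trans (cong (o ∘ +_) (m/n*n≡m r∣k)) odd-k)
  q≤f : k / r ≤ f
  q≤f = ℕₚ.≤-trans (ℕₚ.≤-pred (m/n<m k r (s≤s (s≤s z≤n)))) k≤f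

kronecker-2 : ∀ m → o (+ m) ≡ 1ℤ → kronecker 2 m ≡ δ (+ m)
kronecker-2 m = kroneckerLoop-2 m m m ℕₚ.≤-refl

-- The two sides of the formula

-- A divisor d corresponds to the factorisation (d , m/d); divisors of an odd m are odd, where the
-- Kronecker symbol is `δ`.
divisorSum-series : ∀ m → o (+ m) ≡ 1ℤ → divisorSum m ≡ divisorSeries m
divisorSum-series m odd-m = trans (reindex divisorsE (enum Factorisations m) {f′ = λ (d , k) → δ (+ d) *ℤ + k} pair proj₁ to from value) refl
  where
  divisorsE : Enum (λ d → (0 < d × d ≤ m) × d ∣ₙ m)
  divisorsE = filterE (_∣? m) (mapE suc Data.Nat.pred (λ i i<m → (s≤s z≤n , i<m) , refl) (λ where (suc i) (_ , i<m) → i<m , refl) (upToE m))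
  pair : ℕ → ℕ × ℕ
  pair zero = 0 , 0
  pair d@(suc _) = d , m / d
  m>0 : 0 < m
  m>0 = positive m odd-m
    where
    positive : ∀ m → o (+ m) ≡ 1ℤ → 0 < m
    positive (suc m) _ = s≤s z≤n
  to : Matches (λ d → (0 < d × d ≤ m) × d ∣ₙ m) (λ a → Ok Factorisations a × wt Factorisations a ≡ m) pair proj₁
  to d@(suc _) (_ , d∣m) = ((s≤s z≤n , quotient>0 (m / d) refl) , product) , refl
    where
    product : d * (m / d) ≡ m
    product = trans (ℕₚ.*-comm d (m / d)) (m/n*n≡m d∣m)
    quotient>0 : ∀ q → m / d ≡ q → 0 < q
    quotient>0 zero eq = subst (0 <_) (trans (sym product) (trans (cong (d *_) eq) (ℕₚ.*-zeroʳ d))) m>0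
    quotient>0 (suc q) _ = s≤s z≤n
  from : Matches (λ a → Ok Factorisations a × wt Factorisations a ≡ m) (λ d → (0 < d × d ≤ m) × d ∣ₙ m) proj₁ pair
  from (d@(suc _) , k) ((d>0 , k>0) , w) = ((d>0 , subst (d ≤_) w (ℕₚ.m≤m*n d k {{>-nonZero k>0}})) , divides k (trans (sym w) (ℕₚ.*-comm d k))) ,
    cong (d ,_) (trans (cong (_/ d) (trans (sym w) (ℕₚ.*-comm d k))) (m*n/n≡m k d))
  value : ∀ d → (0 < d × d ≤ m) × d ∣ₙ m → _ ≡ δ (+ proj₁ (pair d)) *ℤ + proj₂ (pair d)
  value d@(suc _) (_ , d∣m) = trans (cong (+ (m / d) *ℤ_) (kronecker-2 d (proj₂ (o-factor (m / d) d (trans (cong (o ∘ +_) (m/n*n≡m d∣m)) odd-m)))))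
    (ℤₚ.*-comm (+ (m / d)) (δ (+ d)))

-- The sum of r over m = r² + 2 s²

sumℤ-++ : ∀ xs ys → sumℤ (xs ++ ys) ≡ sumℤ xs +ℤ sumℤ ys
sumℤ-++ [] ys = sym (ℤₚ.+-identityˡ _)
sumℤ-++ (x ∷ xs) ys = trans (cong (x +ℤ_) (sumℤ-++ xs ys)) (sym (ℤₚ.+-assoc x _ _))

sumℤ-concatMap : ∀ {A : Set} (f : A → List ℤ) xs → sumℤ (concatMap f xs) ≡ ∑ (sumℤ ∘ f) xs
sumℤ-concatMap f [] = refl
sumℤ-concatMap f (x ∷ xs) = trans (sumℤ-++ (f x) (concatMap f xs)) (cong (sumℤ (f x) +ℤ_) (sumℤ-concatMap f xs))

[1+4q] : ∀ q i → residue (i +ℤ q *ℤ + 4) ≡ residue i ⊕ ((residue q ⊕ residue q) ⊕ (residue q ⊕ residue q))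
[1+4q] q i = trans (residue-+ i (q *ℤ + 4)) (cong (residue i ⊕_) (trans (cong residue (arith q)) (trans (residue-+ (q +ℤ q) (q +ℤ q)) (cong₂ _⊕_ (residue-+ q q) (residue-+ q q)))))
  where
  arith : ∀ q → q *ℤ + 4 ≡ q +ℤ q +ℤ (q +ℤ q)
  arith = ℤ-Ring.solve-∀

ε≡1⇔ : ∀ r → ((r -ℤ 1ℤ) modℤ (+ 4) ≡ 0 → ε r ≡ 1ℤ) × (ε r ≡ 1ℤ → (r -ℤ 1ℤ) modℤ (+ 4) ≡ 0)
ε≡1⇔ r = (λ eq → trans ε-r (cong (λ z → ε (1ℤ +ℤ + z)) eq)) , λ eq → small k (n%d<d (r -ℤ 1ℤ) (+ 4)) (trans (sym ε-r) eq)
  where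
  k : ℕ
  k = (r -ℤ 1ℤ) modℤ (+ 4)
  q : ℤ
  q = (r -ℤ 1ℤ) divℤ (+ 4)
  expand : r ≡ 1ℤ +ℤ + k +ℤ q *ℤ + 4
  expand = trans (arith r) (trans (cong (1ℤ +ℤ_) (a≡a%n+[a/n]*n (r -ℤ 1ℤ) (+ 4))) (sym (ℤₚ.+-assoc 1ℤ (+ k) (q *ℤ + 4))))
    where
    arith : ∀ r → r ≡ 1ℤ +ℤ (r -ℤ 1ℤ)
    arith = ℤ-Ring.solve-∀
  ε-r : ε r ≡ ε (1ℤ +ℤ + k)
  ε-r = trans (cong ε expand) (trans (cong ε′ ([1+4q] q (1ℤ +ℤ + k))) (by-cases₂ (λ i j → ε′ (i ⊕ ((j ⊕ j) ⊕ (j ⊕ j))) ℤₚ.≟ ε′ i) (residue (1ℤ +ℤ + k)) (residue q)))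
  small : ∀ k → k < 4 → ε (1ℤ +ℤ + k) ≡ 1ℤ → k ≡ 0
  small 0 _ _ = refl
  small 1 _ ()
  small 2 _ ()
  small 3 _ ()
  small (suc (suc (suc (suc _)))) (s≤s (s≤s (s≤s (s≤s ())))) _

Rep : Graded (ℤ × ℤ)
Rep = Squares ⊗ dilated Squares

wt-Rep : ∀ r s → + wt Rep (r , s) ≡ r *ℤ r +ℤ + 2 *ℤ (s *ℤ s)
wt-Rep r s = trans (cong₂ (λ a b → a +ℤ (b +ℤ b)) (∣x∣²≡x² r) (∣x∣²≡x² s)) (arith (r *ℤ r) (s *ℤ s))
  where
  arith : ∀ a b → a +ℤ (b +ℤ b) ≡ a +ℤ + 2 *ℤ b
  arith = ℤ-Ring.solve-∀

module _ (m : ℕ) where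
  private
    box : Enum (λ rs → ∣ proj₁ rs ∣ ≤ m × ∣ proj₂ rs ∣ ≤ m)
    box = pairE (intervalE m) (λ _ → intervalE m)

    Good : ℤ × ℤ → Set
    Good (r , s) = ((r -ℤ 1ℤ) modℤ (+ 4) ≡ 0) × (+ m ≡ r *ℤ r +ℤ + 2 *ℤ (s *ℤ s))

    good? : Decidable Good
    good? (r , s) = ((r -ℤ 1ℤ) modℤ (+ 4) ℕₚ.≟ 0) ×-dec (+ m ℤₚ.≟ r *ℤ r +ℤ + 2 *ℤ (s *ℤ s))

    sign? : ∀ c → Decidable (λ (rs : ℤ × ℤ) → ε (proj₁ rs) ≡ c)
    sign? c (r , s) = ε r ℤₚ.≟ c

    positives : Enum (λ rs → (Ok Rep rs × wt Rep rs ≡ m) × ε (proj₁ rs) ≡ 1ℤ)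
    positives = filterE (sign? 1ℤ) (enum Rep m)

    good-sum : sumE (filterE good? box) proj₁ ≡ sumE positives proj₁
    good-sum = reindex (filterE good? box) positives id id
      (λ (r , s) (_ , mod4 , eq) → ((_ , ℤₚ.+-injective (trans (wt-Rep r s) (sym eq))) , proj₁ (ε≡1⇔ r) mod4) , refl)
      (λ (r , s) ((_ , w) , εr) → ((bound-r r s w , bound-s r s w) , proj₂ (ε≡1⇔ r) εr , trans (cong +_ (sym w)) (wt-Rep r s)) , refl)
      (λ _ _ → refl)
      where
      bound-r : ∀ r s → wt Rep (r , s) ≡ m → ∣ r ∣ ≤ m
      bound-r r s w = subst (∣ r ∣ ≤_) w (ℕₚ.≤-trans (n≤n*n ∣ r ∣) (ℕₚ.m≤m+n (∣ r ∣ * ∣ r ∣) _))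
      bound-s : ∀ r s → wt Rep (r , s) ≡ m → ∣ s ∣ ≤ m
      bound-s r s w = subst (∣ s ∣ ≤_) w (ℕₚ.≤-trans (n≤n*n ∣ s ∣) (ℕₚ.≤-trans (ℕₚ.m≤m+n (∣ s ∣ * ∣ s ∣) _) (ℕₚ.m≤n+m _ (∣ r ∣ * ∣ r ∣))))

  repSum-positives : repSum m ≡ sumE positives proj₁
  repSum-positives = trans (trans (sumℤ-concatMap (λ r → concatMap (selected r) (rangeℤ m)) (rangeℤ m)) (trans (∑-cong (rangeℤ m) (λ {r} _ → trans (sumℤ-concatMap (selected r) (rangeℤ m))
      (∑-cong (rangeℤ m) (λ {s} _ → term r s))))
      (sym (sumE-pair (intervalE m) (λ _ → intervalE m) F))))
    (trans (sumE-split good? box F) (trans (cong₂ _+ℤ_ goods bads) (trans (ℤₚ.+-identityʳ _) good-sum)))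
    where
    F : ℤ × ℤ → ℤ
    F (r , s) = if ⌊ (r -ℤ 1ℤ) modℤ (+ 4) ℕₚ.≟ 0 ⌋ ∧ ⌊ + m ℤₚ.≟ r *ℤ r +ℤ + 2 *ℤ (s *ℤ s) ⌋ then r else 0ℤ
    selected : ℤ → ℤ → List ℤ
    selected r s = if ⌊ (r -ℤ 1ℤ) modℤ (+ 4) ℕₚ.≟ 0 ⌋ ∧ ⌊ + m ℤₚ.≟ r *ℤ r +ℤ + 2 *ℤ (s *ℤ s) ⌋ then r ∷ [] else []
    term : ∀ r s → sumℤ (selected r s) ≡ F (r , s)
    term r s with ⌊ (r -ℤ 1ℤ) modℤ (+ 4) ℕₚ.≟ 0 ⌋ ∧ ⌊ + m ℤₚ.≟ r *ℤ r +ℤ + 2 *ℤ (s *ℤ s) ⌋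
    ... | true = ℤₚ.+-identityʳ r
    ... | false = refl
    F-good : ∀ r s → Good (r , s) → F (r , s) ≡ r
    F-good r s (p , q) with (r -ℤ 1ℤ) modℤ (+ 4) ℕₚ.≟ 0 | + m ℤₚ.≟ r *ℤ r +ℤ + 2 *ℤ (s *ℤ s)
    ... | yes _ | yes _ = refl
    ... | no ¬p | _ = ⊥-elim (¬p p)
    ... | yes _ | no ¬q = ⊥-elim (¬q q)
    F-bad : ∀ r s → ¬ Good (r , s) → F (r , s) ≡ 0ℤ
    F-bad r s ¬good with (r -ℤ 1ℤ) modℤ (+ 4) ℕₚ.≟ 0 | + m ℤₚ.≟ r *ℤ r +ℤ + 2 *ℤ (s *ℤ s)
    ... | yes p | yes q = ⊥-elim (¬good (p , q))
    ... | no _ | _ = refl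
    ... | yes _ | no _ = refl
    goods : sumE (filterE good? box) F ≡ sumE (filterE good? box) proj₁
    goods = sumE-cong (filterE good? box) (λ (r , s) (_ , g) → F-good r s g)
    bads : sumE (filterE (¬? ∘ good?) box) F ≡ 0ℤ
    bads = sumE-0 (filterE (¬? ∘ good?) box) (λ (r , s) (_ , ¬g) → F-bad r s ¬g)

  -- The map r ↦ -r preserves ε(r) r and exchanges r ≡ 3 with r ≡ 1 (mod 4), hence the factor 2;
  -- even r contribute nothing.
  θ₁′-positives : ser Rep (λ rs → ε (proj₁ rs) *ℤ proj₁ rs) m ≡ + 2 *ℤ sumE positives proj₁
  θ₁′-positives = begin
    sumE (enum Rep m) f
      ≡⟨ sumE-split (sign? 1ℤ) (enum Rep m) f ⟩
    sumE positives f +ℤ sumE others f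
      ≡⟨ cong₂ _+ℤ_ (sumE-cong positives (λ (r , s) (_ , εr) → trans (cong (_*ℤ r) εr) (ℤₚ.*-identityˡ r)))
           (trans (sumE-split (sign? -[1+ 0 ]) others f) (cong₂ _+ℤ_ negatives zeros)) ⟩
    sumE positives proj₁ +ℤ (sumE positives proj₁ +ℤ 0ℤ)
      ≡⟨ arith (sumE positives proj₁) ⟩
    + 2 *ℤ sumE positives proj₁ ∎
    where
    open ≡-Reasoning
    f : ℤ × ℤ → ℤ
    f rs = ε (proj₁ rs) *ℤ proj₁ rs
    others = filterE (¬? ∘ sign? 1ℤ) (enum Rep m)
    arith : ∀ x → x +ℤ (x +ℤ 0ℤ) ≡ + 2 *ℤ x
    arith = ℤ-Ring.solve-∀
    flip : ℤ × ℤ → ℤ × ℤ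
    flip (r , s) = -ℤ r , s
    wt-flip : ∀ r s → wt Rep (flip (r , s)) ≡ wt Rep (r , s)
    wt-flip r s = cong (λ z → z * z + (∣ s ∣ * ∣ s ∣ + ∣ s ∣ * ∣ s ∣)) (ℤₚ.∣-i∣≡∣i∣ r)
    negatives : sumE (filterE (sign? -[1+ 0 ]) others) f ≡ sumE positives proj₁
    negatives = reindex (filterE (sign? -[1+ 0 ]) others) positives flip flip
      (λ (r , s) (((_ , w) , _) , εr) → ((_ , trans (wt-flip r s) w) , trans (ε-odd r) (cong -ℤ_ εr)) , cong (_, s) (ℤₚ.neg-involutive r))
      (λ (r , s) ((_ , w) , εr) → (((_ , trans (wt-flip r s) w) , (λ eq → case trans (sym eq) (trans (ε-odd r) (cong -ℤ_ εr)) of λ ())) , trans (ε-odd r) (cong -ℤ_ εr)) , cong (_, s) (ℤₚ.neg-involutive r))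
      (λ (r , s) (_ , εr) → trans (cong (_*ℤ r) εr) (ℤₚ.-1*i≡-i r))
    zeros : sumE (filterE (¬? ∘ sign? -[1+ 0 ]) others) f ≡ 0ℤ
    zeros = sumE-0 (filterE (¬? ∘ sign? -[1+ 0 ]) others) (λ (r , s) ((_ , ≢1) , ≢-1) → vanish r ≢1 ≢-1)
      where
      open import Relation.Nullary.Decidable using (_⊎-dec_)
      vanish : ∀ r → ε r ≢ 1ℤ → ε r ≢ -[1+ 0 ] → ε r *ℤ r ≡ 0ℤ
      vanish r ≢1 ≢-1 with by-cases₁ (λ i → (ε′ i ℤₚ.≟ 0ℤ) ⊎-dec ((ε′ i ℤₚ.≟ 1ℤ) ⊎-dec (ε′ i ℤₚ.≟ -[1+ 0 ]))) (residue r)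
      ... | inj₁ z = trans (cong (_*ℤ r) z) (ℤₚ.*-zeroˡ r)
      ... | inj₂ (inj₁ eq) = ⊥-elim (≢1 eq)
      ... | inj₂ (inj₂ eq) = ⊥-elim (≢-1 eq)

  repSum-θ₁′ : (θ₁′ ⊛ dil θ) m ≡ + 2 *ℤ repSum m
  repSum-θ₁′ = begin
    (θ₁′ ⊛ dil θ) m
      ≡⟨ trans (ser-⊗ Squares (dilated Squares) (λ r → ε r *ℤ r) one m) (⊛-congˡ θ₁′ (ser-dilated Squares one) m) ⟨
    ser Rep (λ rs → ε (proj₁ rs) *ℤ proj₁ rs *ℤ 1ℤ) m
      ≡⟨ ser-cong Rep (λ (r , s) _ → ℤₚ.*-identityʳ (ε r *ℤ r)) m ⟩
    ser Rep (λ rs → ε (proj₁ rs) *ℤ proj₁ rs) m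
      ≡⟨ θ₁′-positives ⟩
    + 2 *ℤ sumE positives proj₁
      ≡⟨ cong (+ 2 *ℤ_) repSum-positives ⟨
    + 2 *ℤ repSum m ∎
    where open ≡-Reasoning

-- Triangular numbers and odd squares

tri-double : ∀ x → + 2 *ℤ tri x ≡ x *ℤ (x -ℤ 1ℤ)
tri-double x with (x *ℤ (x -ℤ 1ℤ)) modℤ (+ 2) | n%d<d (x *ℤ (x -ℤ 1ℤ)) (+ 2) | a≡a%n+[a/n]*n (x *ℤ (x -ℤ 1ℤ)) (+ 2)
... | 0 | _ | eq = trans (arith (tri x)) (sym eq)
  where
  arith : ∀ t → + 2 *ℤ t ≡ 0ℤ +ℤ t *ℤ + 2
  arith = ℤ-Ring.solve-∀
... | suc (suc _) | s≤s (s≤s ()) | _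
-- Remainder 1 is impossible, because one of x and x - 1 is even.
... | 1 | _ | eq = case trans (sym odd-product) even-product of λ ()
  where
  odd-product : o (x *ℤ (x -ℤ 1ℤ)) ≡ 1ℤ
  odd-product = trans (cong o (trans eq (arith (tri x)))) (o-odd (tri x))
    where
    arith : ∀ t → 1ℤ +ℤ t *ℤ + 2 ≡ 1ℤ +ℤ (t +ℤ t)
    arith = ℤ-Ring.solve-∀
  o-double : ∀ y → o (y +ℤ y) ≡ 0ℤ
  o-double y = trans (table-+ o′ y y) (by-cases₁ (λ i → o′ (i ⊕ i) ℤₚ.≟ 0ℤ) (residue y))
  even-product : o (x *ℤ (x -ℤ 1ℤ)) ≡ 0ℤ
  even-product with even⊎odd x | even⊎odd (x -ℤ 1ℤ)
  ... | inj₁ ev | _ = trans (cong o (trans (cong (_*ℤ (x -ℤ 1ℤ)) (sym ev)) (ℤₚ.*-distribʳ-+ (x -ℤ 1ℤ) (half x) (half x)))) (o-double (half x *ℤ (x -ℤ 1ℤ)))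
  ... | _ | inj₁ ev = trans (cong o (trans (cong (x *ℤ_) (sym ev)) (ℤₚ.*-distribˡ-+ x (half (x -ℤ 1ℤ)) (half (x -ℤ 1ℤ))))) (o-double (x *ℤ half (x -ℤ 1ℤ)))
  ... | inj₂ od | inj₂ od′ = case trans (sym (cong₂ _*ℤ_ od od′)) (trans (cong (o x *ℤ_) (table-- o′ x 1ℤ)) (by-cases₁ (λ i → o′ i *ℤ o′ (i ⊕ opposite (residue 1ℤ)) ℤₚ.≟ 0ℤ) (residue x))) of λ ()

odd-double-pred : ∀ x → o (x +ℤ x -ℤ 1ℤ) ≡ 1ℤ
odd-double-pred x = trans (cong o (arith x)) (o-odd (x -ℤ 1ℤ))
  where
  arith : ∀ x → x +ℤ x -ℤ 1ℤ ≡ 1ℤ +ℤ (x -ℤ 1ℤ +ℤ (x -ℤ 1ℤ))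
  arith = ℤ-Ring.solve-∀

odd-square : ∀ x → (x +ℤ x -ℤ 1ℤ) *ℤ (x +ℤ x -ℤ 1ℤ) ≡ 1ℤ +ℤ + 8 *ℤ tri x
odd-square x = trans (arith x) (trans (cong (λ z → 1ℤ +ℤ + 4 *ℤ z) (sym (tri-double x))) (arith′ (tri x)))
  where
  arith : ∀ x → (x +ℤ x -ℤ 1ℤ) *ℤ (x +ℤ x -ℤ 1ℤ) ≡ 1ℤ +ℤ + 4 *ℤ (x *ℤ (x -ℤ 1ℤ))
  arith = ℤ-Ring.solve-∀
  arith′ : ∀ t → 1ℤ +ℤ + 4 *ℤ (+ 2 *ℤ t) ≡ 1ℤ +ℤ + 8 *ℤ t
  arith′ = ℤ-Ring.solve-∀

toOdd fromOdd : ℤ → ℤ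
toOdd x = x +ℤ x -ℤ 1ℤ
fromOdd x = half (x +ℤ 1ℤ)

fromOdd-toOdd : ∀ x → fromOdd (toOdd x) ≡ x
fromOdd-toOdd x = trans (cong half (arith x)) (half-double x)
  where
  arith : ∀ x → x +ℤ x -ℤ 1ℤ +ℤ 1ℤ ≡ x +ℤ x
  arith = ℤ-Ring.solve-∀

toOdd-fromOdd : ∀ x → o x ≡ 1ℤ → toOdd (fromOdd x) ≡ x
toOdd-fromOdd x odd-x with even⊎odd (x +ℤ 1ℤ)
... | inj₁ ev = trans (cong (_-ℤ 1ℤ) ev) (arith x)
  where
  arith : ∀ x → x +ℤ 1ℤ -ℤ 1ℤ ≡ x
  arith = ℤ-Ring.solve-∀
... | inj₂ od = case trans (sym (cong₂ _*ℤ_ odd-x od)) (trans (cong (o x *ℤ_) (table-+ o′ x 1ℤ)) (by-cases₁ (λ i → o′ i *ℤ o′ (i ⊕ residue 1ℤ) ℤₚ.≟ 0ℤ) (residue x))) of λ ()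

Quadruple : Set
Quadruple = (ℤ × ℤ) × (ℤ × ℤ)

-- The form X² + Y² + 2 Z² + 16 W²; four dilations multiply W² by 16.
Quadruples : Graded Quadruple
Quadruples = (Squares ⊗ Squares) ⊗ (dilated Squares ⊗ dilated (dilated (dilated (dilated Squares))))

AllOdd : Quadruple → Set
AllOdd ((x , y) , (z , w)) = (o x ≡ 1ℤ × o y ≡ 1ℤ) × (o z ≡ 1ℤ × o w ≡ 1ℤ)

allOdd? : Decidable AllOdd
allOdd? ((x , y) , (z , w)) = ((o x ℤₚ.≟ 1ℤ) ×-dec (o y ℤₚ.≟ 1ℤ)) ×-dec ((o z ℤₚ.≟ 1ℤ) ×-dec (o w ℤₚ.≟ 1ℤ))

odds⁴ : Quadruple → ℤ
odds⁴ ((x , y) , (z , w)) = o x *ℤ o y *ℤ (o z *ℤ o w)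

o-zero-one : ∀ x → o x ≢ 1ℤ → o x ≡ 0ℤ
o-zero-one x ¬odd with by-cases₁ (λ i → (o′ i ℤₚ.≟ 0ℤ) ⊎-dec (o′ i ℤₚ.≟ 1ℤ)) (residue x)
  where open import Relation.Nullary.Decidable using (_⊎-dec_)
... | inj₁ zero-x = zero-x
... | inj₂ odd-x = ⊥-elim (¬odd odd-x)

odds⁴-odd : ∀ q → AllOdd q → odds⁴ q ≡ 1ℤ
odds⁴-odd ((x , y) , (z , w)) ((ox , oy) , (oz , ow)) = cong₂ _*ℤ_ (cong₂ _*ℤ_ ox oy) (cong₂ _*ℤ_ oz ow)

odds⁴-even : ∀ q → ¬ AllOdd q → odds⁴ q ≡ 0ℤ
odds⁴-even ((x , y) , (z , w)) ¬odd with o x ℤₚ.≟ 1ℤ | o y ℤₚ.≟ 1ℤ | o z ℤₚ.≟ 1ℤ | o w ℤₚ.≟ 1ℤ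
... | no ¬x | _ | _ | _ = trans (cong (λ p → p *ℤ o y *ℤ (o z *ℤ o w)) (o-zero-one x ¬x)) (arith (o y) (o z *ℤ o w))
  where
  arith : ∀ p q → 0ℤ *ℤ p *ℤ q ≡ 0ℤ
  arith = ℤ-Ring.solve-∀
... | yes _ | no ¬y | _ | _ = trans (cong (λ p → o x *ℤ p *ℤ (o z *ℤ o w)) (o-zero-one y ¬y)) (arith (o x) (o z *ℤ o w))
  where
  arith : ∀ p q → p *ℤ 0ℤ *ℤ q ≡ 0ℤ
  arith = ℤ-Ring.solve-∀
... | yes _ | yes _ | no ¬z | _ = trans (cong (λ p → o x *ℤ o y *ℤ (p *ℤ o w)) (o-zero-one z ¬z)) (arith (o x *ℤ o y) (o w))
  where
  arith : ∀ p q → p *ℤ (0ℤ *ℤ q) ≡ 0ℤ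
  arith = ℤ-Ring.solve-∀
... | yes _ | yes _ | yes _ | no ¬w = trans (cong (λ p → o x *ℤ o y *ℤ (o z *ℤ p)) (o-zero-one w ¬w)) (arith (o x *ℤ o y) (o z))
  where
  arith : ∀ p q → p *ℤ (q *ℤ 0ℤ) ≡ 0ℤ
  arith = ℤ-Ring.solve-∀
... | yes ox | yes oy | yes oz | yes ow = ⊥-elim (¬odd ((ox , oy) , (oz , ow)))

-- The predicate inside `TSol` is an anonymous pattern-matching function; unifying `TSol` with a
-- Σ-type recovers that very function.
Solution : ℕ → ℤ × ℤ × ℤ × ℤ → Set
Solution n = proj₁ (predicate n)
  where
  predicate : ∀ n → ∃ λ (R : ℤ × ℤ × ℤ × ℤ → Set) → TSol 1 1 2 16 n ≡ Σ _ R
  predicate n = _ , refl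

module _ (n : ℕ) where
  private
    -- As (2 x - 1)² = 1 + 8 `tri x` and 1 + 1 + 2 + 16 = 20, solutions for n become odd quadruples
    -- of weight 8 n + 20 = 4 m.
    m N : ℕ
    m = 2 * n + 5
    N = (m + m) + (m + m)

    toQuadruple : ℤ × ℤ × ℤ × ℤ → Quadruple
    toQuadruple (x , y , z , w) = (toOdd x , toOdd y) , (toOdd z , toOdd w)

    fromQuadruple : Quadruple → ℤ × ℤ × ℤ × ℤ
    fromQuadruple ((x , y) , (z , w)) = fromOdd x , fromOdd y , fromOdd z , fromOdd w

    total : ℤ × ℤ × ℤ × ℤ → ℤ
    total (x , y , z , w) = + 1 *ℤ tri x +ℤ + 1 *ℤ tri y +ℤ + 2 *ℤ tri z +ℤ + 16 *ℤ tri w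

    weight : ∀ t → + wt Quadruples (toQuadruple t) ≡ + 20 +ℤ + 8 *ℤ total t
    weight (x , y , z , w) = trans (cong₂ _+ℤ_ (cong₂ _+ℤ_ (sq x) (sq y)) (cong₂ (λ a b → a +ℤ a +ℤ (b +ℤ b +ℤ (b +ℤ b) +ℤ (b +ℤ b +ℤ (b +ℤ b)) +ℤ (b +ℤ b +ℤ (b +ℤ b) +ℤ (b +ℤ b +ℤ (b +ℤ b))))) (sq z) (sq w)))
      (arith (tri x) (tri y) (tri z) (tri w))
      where
      sq : ∀ x → + (∣ toOdd x ∣ * ∣ toOdd x ∣) ≡ 1ℤ +ℤ + 8 *ℤ tri x
      sq x = trans (∣x∣²≡x² (toOdd x)) (odd-square x)
      arith : ∀ a b c d → let f = λ t → 1ℤ +ℤ + 8 *ℤ t in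
        f a +ℤ f b +ℤ (f c +ℤ f c +ℤ (f d +ℤ f d +ℤ (f d +ℤ f d) +ℤ (f d +ℤ f d +ℤ (f d +ℤ f d)) +ℤ (f d +ℤ f d +ℤ (f d +ℤ f d) +ℤ (f d +ℤ f d +ℤ (f d +ℤ f d)))))
        ≡ + 20 +ℤ + 8 *ℤ (+ 1 *ℤ a +ℤ + 1 *ℤ b +ℤ + 2 *ℤ c +ℤ + 16 *ℤ d)
      arith = ℤ-Ring.solve-∀

    N-eq : + N ≡ + 20 +ℤ + 8 *ℤ + n
    N-eq = trans (cong +_ (arith n)) (cong (+ 20 +ℤ_) (ℤₚ.pos-* 8 n))
      where
      arith : ∀ n → 2 * n + 5 + (2 * n + 5) + (2 * n + 5 + (2 * n + 5)) ≡ 20 + 8 * n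
      arith = ℕ-Ring.solve-∀

    weight⇒solution : ∀ t → wt Quadruples (toQuadruple t) ≡ N → + n ≡ total t
    weight⇒solution t w = ℤₚ.*-cancelˡ-≡ (+ 8) (+ n) (total t) (begin
      + 8 *ℤ + n                          ≡⟨ arith (+ 8 *ℤ + n) ⟩
      + 20 +ℤ + 8 *ℤ + n -ℤ + 20          ≡⟨ cong (_-ℤ + 20) (trans (sym N-eq) (trans (cong +_ (sym w)) (weight t))) ⟩
      + 20 +ℤ + 8 *ℤ total t -ℤ + 20      ≡⟨ arith (+ 8 *ℤ total t) ⟨
      + 8 *ℤ total t                      ∎)
      where
      open ≡-Reasoning
      arith : ∀ x → x ≡ + 20 +ℤ x -ℤ + 20
      arith = ℤ-Ring.solve-∀

    solution⇒weight : ∀ t → + n ≡ total t → wt Quadruples (toQuadruple t) ≡ N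
    solution⇒weight t eq = ℤₚ.+-injective (trans (weight t) (trans (cong (λ z → + 20 +ℤ + 8 *ℤ z) (sym eq)) (sym N-eq)))

    odd-quadruples : Enum (λ q → (Ok Quadruples q × wt Quadruples q ≡ N) × AllOdd q)
    odd-quadruples = filterE allOdd? (enum Quadruples N)

    to-from : ∀ q → AllOdd q → toQuadruple (fromQuadruple q) ≡ q
    to-from ((x , y) , (z , w)) ((ox , oy) , (oz , ow)) = cong₂ _,_ (cong₂ _,_ (toOdd-fromOdd x ox) (toOdd-fromOdd y oy)) (cong₂ _,_ (toOdd-fromOdd z oz) (toOdd-fromOdd w ow))

    from-to : ∀ t → fromQuadruple (toQuadruple t) ≡ t
    from-to (x , y , z , w) = cong₂ _,_ (fromOdd-toOdd x) (cong₂ _,_ (fromOdd-toOdd y) (cong₂ _,_ (fromOdd-toOdd z) (fromOdd-toOdd w)))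

    solutions : Enum (Solution n)
    solutions = mapE fromQuadruple toQuadruple
      (λ q ((_ , w) , odd-q) → weight⇒solution (fromQuadruple q) (trans (cong (wt Quadruples) (to-from q odd-q)) w) , to-from q odd-q)
      (λ t@(x , y , z , w) eq → ((_ , solution⇒weight t eq) , (odd-double-pred x , odd-double-pred y) , (odd-double-pred z , odd-double-pred w)) , from-to t)
      odd-quadruples

    solutions-count : + length (elems solutions) ≡ ser Quadruples odds⁴ N
    solutions-count = begin
      + length (elems solutions)            ≡⟨ sumE-length solutions ⟨
      sumE solutions (λ _ → 1ℤ)             ≡⟨ ∑-map (λ _ → 1ℤ) fromQuadruple (elems odd-quadruples) ⟩
      sumE odd-quadruples (λ _ → 1ℤ)        ≡⟨ sumE-cong odd-quadruples (λ q (_ , odd-q) → sym (odds⁴-odd q odd-q)) ⟩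
      sumE odd-quadruples odds⁴             ≡⟨ ℤₚ.+-identityʳ _ ⟨
      sumE odd-quadruples odds⁴ +ℤ 0ℤ       ≡⟨ cong (sumE odd-quadruples odds⁴ +ℤ_) (sumE-0 (filterE (¬? ∘ allOdd?) (enum Quadruples N)) (λ q (_ , ¬odd) → odds⁴-even q ¬odd)) ⟨
      sumE odd-quadruples odds⁴ +ℤ sumE (filterE (¬? ∘ allOdd?) (enum Quadruples N)) odds⁴
                                            ≡⟨ sumE-split allOdd? (enum Quadruples N) odds⁴ ⟨
      ser Quadruples odds⁴ N                ∎
      where open ≡-Reasoning

    -- Counts x² + 2 y² + 4 z² + 4 w² with x and w odd, the form reached after both rotations.
    K : Series
    K = θoθe ⊛ dil θ ⊛ dil (dil θo)

    -- θ₂² = 2 θ₂ θ₃ is applied twice. The first use, on X and Y, leaves one `θo` at q², which pairs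
    -- with the `θo` of Z for the second. Each use halves the exponent and contributes a factor 2.
    quadruples-series : ser Quadruples odds⁴ ≈ dil (dil (K ⊞ K) ⊞ dil (K ⊞ K))
    quadruples-series = begin
      ser Quadruples odds⁴
        ≈⟨ ser-⊗ (Squares ⊗ Squares) (dilated Squares ⊗ D⁴) (λ (x , y) → o x *ℤ o y) (λ (z , w) → o z *ℤ o w) ⟩
      ser Squares² (λ (x , y) → o x *ℤ o y) ⊛ ser (dilated Squares ⊗ D⁴) (λ (z , w) → o z *ℤ o w)
        ≈⟨ ⊛-cong (ser-⊗ Squares Squares o o) (ser-⊗ (dilated Squares) D⁴ o o) ⟩
      (θo ⊛ θo) ⊛ (ser (dilated Squares) o ⊛ ser D⁴ o)
        ≈⟨ ⊛-cong θo² (⊛-cong (ser-dilated Squares o) D⁴-series) ⟩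
      dil (θo ⊛ θe ⊞ θe ⊛ θo) ⊛ (dil θo ⊛ dil (dil (dil (dil θo))))
        ≈⟨ ⊛-congˡ (dil (θo ⊛ θe ⊞ θe ⊛ θo)) (dil-⊛ θo (dil (dil (dil θo)))) ⟨
      dil (θo ⊛ θe ⊞ θe ⊛ θo) ⊛ dil (θo ⊛ dil (dil (dil θo)))
        ≈⟨ dil-⊛ (θo ⊛ θe ⊞ θe ⊛ θo) (θo ⊛ dil (dil (dil θo))) ⟨
      dil ((θo ⊛ θe ⊞ θe ⊛ θo) ⊛ (θo ⊛ dil (dil (dil θo))))
        ≈⟨ dil-cong (solve 3 (λ o e t → (o :* e :+ e :* o) :* (o :* t) := o :* o :* (e :* t) :+ o :* o :* (e :* t)) (λ _ → refl) θo θe (dil (dil (dil θo)))) ⟩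
      dil (θo ⊛ θo ⊛ (θe ⊛ dil (dil (dil θo))) ⊞ θo ⊛ θo ⊛ (θe ⊛ dil (dil (dil θo))))
        ≈⟨ dil-cong (⊞-cong inner inner) ⟩
      dil (dil (K ⊞ K) ⊞ dil (K ⊞ K)) ∎
      where
      open SetoidReasoning seriesSetoid
      D⁴ = dilated (dilated (dilated (dilated Squares)))
      D⁴-series : ser D⁴ o ≈ dil (dil (dil (dil θo)))
      D⁴-series = ≈-trans (ser-dilated (dilated (dilated (dilated Squares))) o) (dil-cong (≈-trans (ser-dilated (dilated (dilated Squares)) o)
        (dil-cong (≈-trans (ser-dilated (dilated Squares) o) (dil-cong (ser-dilated Squares o))))))
      inner : θo ⊛ θo ⊛ (θe ⊛ dil (dil (dil θo))) ≈ dil (K ⊞ K)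
      inner = begin
        θo ⊛ θo ⊛ (θe ⊛ dil (dil (dil θo)))
          ≈⟨ ⊛-cong θo² (≈-trans (⊛-congʳ (dil (dil (dil θo))) θe-dil) (≈-sym (dil-⊛ (dil θ) (dil (dil θo))))) ⟩
        dil (θo ⊛ θe ⊞ θe ⊛ θo) ⊛ dil (dil θ ⊛ dil (dil θo))
          ≈⟨ dil-⊛ (θo ⊛ θe ⊞ θe ⊛ θo) (dil θ ⊛ dil (dil θo)) ⟨
        dil ((θo ⊛ θe ⊞ θe ⊛ θo) ⊛ (dil θ ⊛ dil (dil θo)))
          ≈⟨ dil-cong (solve 4 (λ o e t d → (o :* e :+ e :* o) :* (t :* d) := o :* e :* t :* d :+ o :* e :* t :* d) (λ _ → refl) θo θe (dil θ) (dil (dil θo))) ⟩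
        dil (K ⊞ K) ∎

    -- One factor θ(q⁴) is written as its signed version plus twice its odd part. The signed half is
    -- where Jacobi's identity applies; the other half is 2 `K`.
    quaternary-split : quaternary ≈ θ₁′ ⊛ dil θ ⊞ (K ⊞ K)
    quaternary-split = begin
      θo ⊛ dil θ ⊛ (θe ⊛ θe)
        ≈⟨ ⊛-congˡ (θo ⊛ dil θ) (⊛-congˡ θe θe-θs) ⟩
      θo ⊛ dil θ ⊛ (θe ⊛ (θs ⊞ dil (dil (θo ⊞ θo))))
        ≈⟨ ⊛-congˡ (θo ⊛ dil θ) (⊛-congˡ θe (⊞-congˡ θs (≈-trans (dil-cong (dil-⊞ θo θo)) (dil-⊞ (dil θo) (dil θo))))) ⟩
      θo ⊛ dil θ ⊛ (θe ⊛ (θs ⊞ (dil (dil θo) ⊞ dil (dil θo))))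
        ≈⟨ solve 5 (λ o e s t d → o :* t :* (e :* (s :+ (d :+ d))) := o :* e :* s :* t :+ (o :* e :* t :* d :+ o :* e :* t :* d)) (λ _ → refl) θo θe θs (dil θ) (dil (dil θo)) ⟩
      θo ⊛ θe ⊛ θs ⊛ dil θ ⊞ (K ⊞ K)
        ≈⟨ ⊞-cong (⊛-congʳ (dil θ) jacobi) (≈-refl {K ⊞ K}) ⟨
      θ₁′ ⊛ dil θ ⊞ (K ⊞ K) ∎
      where open SetoidReasoning seriesSetoid

    odd-m : o (+ m) ≡ 1ℤ
    odd-m = trans (cong o (trans (cong +_ (arith n)) refl)) (o-odd (+ (n + 2)))
      where
      arith : ∀ n → 2 * n + 5 ≡ 1 + (n + 2 + (n + 2))
      arith = ℕ-Ring.solve-∀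

    -- At m, `quaternary` minus θ₁′ θ(q²) is 2 `K`, whereas the rotations give 4 `K`; doubling the
    -- evaluations accounts for the two coefficients 4.
    count : + 4 *ℤ divisorSum m -ℤ + 4 *ℤ repSum m ≡ + length (elems solutions)
    count = begin
      + 4 *ℤ divisorSum m -ℤ + 4 *ℤ repSum m
        ≡⟨ arith₁ (divisorSum m) (repSum m) ⟩
      + 2 *ℤ (+ 2 *ℤ divisorSum m -ℤ + 2 *ℤ repSum m)
        ≡⟨ cong₂ (λ x y → + 2 *ℤ (x -ℤ y)) (trans (cong (+ 2 *ℤ_) (divisorSum-series m odd-m)) (sym (quaternary-odd m odd-m))) (sym (repSum-θ₁′ m)) ⟩
      + 2 *ℤ (quaternary m -ℤ (θ₁′ ⊛ dil θ) m)
        ≡⟨ cong (λ x → + 2 *ℤ (x -ℤ (θ₁′ ⊛ dil θ) m)) (quaternary-split m) ⟩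
      + 2 *ℤ ((θ₁′ ⊛ dil θ) m +ℤ (K m +ℤ K m) -ℤ (θ₁′ ⊛ dil θ) m)
        ≡⟨ arith₂ ((θ₁′ ⊛ dil θ) m) (K m +ℤ K m) ⟩
      K m +ℤ K m +ℤ (K m +ℤ K m)
        ≡⟨ cong (λ x → x +ℤ x) (dil-double (K ⊞ K) m) ⟨
      dil (K ⊞ K) (m + m) +ℤ dil (K ⊞ K) (m + m)
        ≡⟨ dil-double (dil (K ⊞ K) ⊞ dil (K ⊞ K)) (m + m) ⟨
      dil (dil (K ⊞ K) ⊞ dil (K ⊞ K)) N
        ≡⟨ quadruples-series N ⟨
      ser Quadruples odds⁴ N
        ≡⟨ solutions-count ⟨
      + length (elems solutions) ∎
      where
      open ≡-Reasoning
      arith₁ : ∀ a b → + 4 *ℤ a -ℤ + 4 *ℤ b ≡ + 2 *ℤ (+ 2 *ℤ a -ℤ + 2 *ℤ b)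
      arith₁ = ℤ-Ring.solve-∀
      arith₂ : ∀ h k → + 2 *ℤ (h +ℤ k -ℤ h) ≡ k +ℤ k
      arith₂ = ℤ-Ring.solve-∀

  triangular-count : t≡ 1 1 2 16 n (+ 4 *ℤ divisorSum m -ℤ + 4 *ℤ repSum m)
  triangular-count = length (elems solutions) , count , hasCard ≡-irrelevant solutions
    where open import Axiom.UniquenessOfIdentityProofs.WithK using () renaming (uip to ≡-irrelevant)

theorem3p2 : (n : ℕ) → 1 Data.Nat.≤ n →
    t≡ 1 1 2 16 n
    (((+ 4) *ℤ divisorSum (2 * n + 5)) -ℤ ((+ 4) *ℤ repSum (2 * n + 5)))
theorem3p2 n _ = triangular-count n
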